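{- Let $n\ge 1$ be fixed and let $p$ be a monic polynomial of degree $d\ge n$. Then \[ m_n(p) - \sum_{\pi\in NC(n)} \kappa_\pi^d(p) = - \frac{n}{2 d} \sum_{\substack{r,s\ge1,\ r+s=n}}\ \sum_{\pi \in S_{NC}(r,s)} \frac{\kappa_\pi^d(p)}{rs} +O(1/d^2).\]
   Context: For a monic polynomial $p$ of degree $d$ with roots $\lambda_1,\dots,\lambda_d$, write $p(x)=\sum_{i=0}^d(-1)^ia^p_ix^{d-i}$ and $m_n(p)=\frac1d\sum_i\lambda_i^n$. Let $(d)_k=d(d-1)\cdots(d-k+1)$. For a set partition $\pi$ of $\{1,\dots,n\}$ with $|\pi|$ blocks, set $a^p_\pi=\prod_{V\in\pi}a^p_{|V|}$, $N!_\pi=\prod_V|V|!$, $(d)_\pi=\prod_V(d)_{|V|}$. Finite free cumulants: for $n=1,\dots,d$, $\kappa_n^d(p)=\frac{(-d)^n}{d(n-1)!}\sum_{\pi\in P(n)}(-1)^{|\pi|}\frac{N!_\pi a_\pi^p(|\pi|-1)!}{(d)_\pi}$, where $P(n)$ is the set of all set partitions of $\{1,\dots,n\}$; and $\kappa^d_\pi(p)=\prod_{V\in\pi}\kappa^d_{|V|}(p)$. $NC(n)$ is the set of non-crossing partitions of $\{1,\dots,n\}$. For a permutation $\alpha$, $\kappa^d_\alpha(p)$ means $\kappa^d_{f(\alpha)}(p)$ where $f(\alpha)$ is the partition into cycles of $\alpha$; $\#(\alpha)$ denotes the number of cycles. For $r,s\ge1$, let $\gamma_{r,s}=(1,\dots,r)(r+1,\dots,r+s)\in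 S_{r+s}$. The set $S_{NC}(r,s)$ of annular non-crossing permutations is the set of $\alpha\in S_{r+s}$ such that the subgroup generated by $\alpha$ and $\gamma_{r,s}$ acts transitively on $\{1,\dots,r+s\}$ and $\#(\alpha)+\#(\alpha^{ -1}\gamma_{r,s})=r+s$ (equivalently, the cycles of $\alpha$ can be drawn without crossings on an annulus with $1,\dots,r$ clockwise on the outer circle and $r+1,\dots,r+s$ counterclockwise on the inner circle, each cycle bounding a disc oriented clockwise, and at least one cycle connecting the two circles). Here $O(1/d^2)$ stands for an expression $\sum_{k=2}^{n-1}d^{ -k}E_k$ with each $E_k$ a linear combination, with coefficients depending only on $n$ and $k$, of products $\kappa^d_\sigma(p)$, $\sigma\in P(n)$. -}

module Defs where

open import Level using (0ℓ)
open import Data.Bool using (Bool; true; false; _∧_; _∨_; not; if_then_else_)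
open import Data.Nat as ℕ using (ℕ; zero; suc; _+_; _*_; _∸_; _≡ᵇ_; _<ᵇ_; _≤ᵇ_)
open import Data.Integer as ℤ using (ℤ)
open import Data.Rational as ℚ using (ℚ)
open import Data.List using (List; []; _∷_; map; concatMap; upTo; filterᵇ; length; foldr)
open import Data.Bool.ListAction using (all; any)
open import Data.Vec as Vec using (Vec)
open import Algebra.Bundles using (CommutativeRing)

-- Generic finite helpers (0-indexed: the set {1,…,n} is {0,…,n-1})

range : ℕ → ℕ → List ℕ
range a b = map (λ i → a + i) (upTo (b ∸ a))

at : List ℕ → ℕ → ℕ
at []       _       = 0
at (x ∷ _)  zero    = x
at (_ ∷ xs) (suc i) = at xs i

count : (ℕ → Bool) → List ℕ → ℕ
count p xs = length (filterᵇ p xs)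

factorial : ℕ → ℕ
factorial zero    = 1
factorial (suc k) = suc k * factorial k

falling : ℕ → ℕ → ℕ
falling d zero    = 1
falling d (suc k) = (d ∸ k) * falling d k

-- rational number z / m  (m = 0 never occurs in the uses below;
-- returns 0 in that case)
divN : ℤ → ℕ → ℚ
divN z zero    = ℚ.0ℚ
divN z (suc m) = z ℚ./ suc m

-- Set partitions of {0,…,n-1}, encoded bijectively as restricted growth
-- strings: list of block labels l_0 … l_{n-1} with l_0 = 0 and
-- l_i ≤ 1 + max(l_0,…,l_{i-1}).  Blocks = label classes.

rgsFrom : ℕ → ℕ → List (List ℕ)
rgsFrom zero    m = [] ∷ []
rgsFrom (suc k) m =
  concatMap (λ j → map (j ∷_) (rgsFrom k (if j ≡ᵇ m then suc m else m)))
            (upTo (suc m))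

SetPartitions : ℕ → List (List ℕ)
SetPartitions n = rgsFrom n 0

numBlocks : List ℕ → ℕ
numBlocks π = count (λ j → any (j ≡ᵇ_) π) (upTo (length π))

blockSizes : List ℕ → List ℕ
blockSizes π = map (λ j → count (j ≡ᵇ_) π) (upTo (numBlocks π))

crossingAt : List ℕ → ℕ → ℕ → ℕ → ℕ → Bool
crossingAt π a b c e =
  (at π a ≡ᵇ at π c) ∧ (at π b ≡ᵇ at π e) ∧ not (at π a ≡ᵇ at π b)

isNonCrossing : List ℕ → Bool
isNonCrossing π =
  let n = length π in
  all (λ a → all (λ b → all (λ c → all (λ e → not (crossingAt π a b c e))
      (range (suc c) n)) (range (suc b) n)) (range (suc a) n)) (upTo n)

NCPartitions : ℕ → List (List ℕ)
NCPartitions n = filterᵇ isNonCrossing (SetPartitions n)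

-- Permutations of {0,…,N-1}, encoded as the list of images
-- (σ(0), …, σ(N-1)).

allWords : ℕ → ℕ → List (List ℕ)
allWords zero    N = [] ∷ []
allWords (suc k) N = concatMap (λ j → map (j ∷_) (allWords k N)) (upTo N)

isBijection : ℕ → List ℕ → Bool
isBijection N σ = all (λ j → any (j ≡ᵇ_) σ) (upTo N)

Perms : ℕ → List (List ℕ)
Perms N = filterᵇ (isBijection N) (allWords N N)

iter : (ℕ → ℕ) → ℕ → ℕ → ℕ
iter f zero    i = i
iter f (suc k) i = f (iter f k i)

sameCycle : ℕ → (ℕ → ℕ) → ℕ → ℕ → Bool
sameCycle N σ i j = any (λ k → iter σ k i ≡ᵇ j) (upTo N)

cycleMin : ℕ → (ℕ → ℕ) → ℕ → Bool
cycleMin N σ i = all (λ j → not (sameCycle N σ i j) ∨ (i ≤ᵇ j)) (upTo N)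

cycleLengths : ℕ → (ℕ → ℕ) → List ℕ
cycleLengths N σ =
  map (λ i → count (sameCycle N σ i) (upTo N)) (filterᵇ (cycleMin N σ) (upTo N))

numCycles : ℕ → (ℕ → ℕ) → ℕ
numCycles N σ = length (cycleLengths N σ)

inverse : ℕ → (ℕ → ℕ) → ℕ → ℕ
inverse N σ j = foldr (λ i r → if σ i ≡ᵇ j then i else r) 0 (upTo N)

_∘ₚ_ : (ℕ → ℕ) → (ℕ → ℕ) → ℕ → ℕ
(σ ∘ₚ τ) i = σ (τ i)

-- γ_{r,s} = (1,…,r)(r+1,…,r+s), 0-indexed
gamma : ℕ → ℕ → ℕ → ℕ
gamma r s i =
  if i <ᵇ r then (if suc i ≡ᵇ r then 0 else suc i)
  else (if suc i ≡ᵇ r + s then r else suc i)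

-- the group generated by σ and τ acts transitively on {0,…,N-1}:
-- every point is reachable from 0 by applying σ, τ (N steps suffice)
reach : ℕ → (ℕ → ℕ) → (ℕ → ℕ) → ℕ → ℕ → Bool
reach N σ τ zero    j = j ≡ᵇ 0
reach N σ τ (suc t) j =
  reach N σ τ t j ∨
  any (λ i → reach N σ τ t i ∧ ((σ i ≡ᵇ j) ∨ (τ i ≡ᵇ j))) (upTo N)

transitive : ℕ → (ℕ → ℕ) → (ℕ → ℕ) → Bool
transitive N σ τ = all (reach N σ τ N) (upTo N)

isAnnularNC : ℕ → ℕ → List ℕ → Bool
isAnnularNC r s α =
  let N = r + s ; a = at α ; g = gamma r s in
  transitive N a g ∧
  (numCycles N a + numCycles N (inverse N a ∘ₚ g) ≡ᵇ N)

SNC : ℕ → ℕ → List (List ℕ)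
SNC r s = filterᵇ (isAnnularNC r s) (Perms (r + s))

-- Ring-valued quantities.  R is a commutative ring with a ring
-- homomorphism ι : ℚ → R (i.e. a ℚ-algebra, e.g. ℂ); the polynomial
-- p(x) = ∏ (x - λ_i) is given by its d roots λ ∈ R^d.

module Poly (R : CommutativeRing 0ℓ 0ℓ) (ι : ℚ → CommutativeRing.Carrier R) where
  open CommutativeRing R using (Carrier; 0#; 1#)
    renaming (_+_ to _+ᴿ_; _*_ to _*ᴿ_; _-_ to _-ᴿ_)

  sumR : List Carrier → Carrier
  sumR = foldr _+ᴿ_ 0#

  prodR : List Carrier → Carrier
  prodR = foldr _*ᴿ_ 1#

  powR : Carrier → ℕ → Carrier
  powR x zero    = 1#
  powR x (suc k) = x *ᴿ powR x k

  esym : ∀ {d} → Vec Carrier d → ℕ → Carrier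
  esym Vec.[]       zero    = 1#
  esym Vec.[]       (suc i) = 0#
  esym (x Vec.∷ xs) zero    = 1#
  esym (x Vec.∷ xs) (suc i) = esym xs (suc i) +ᴿ x *ᴿ esym xs i

  -- a^p_i : p(x) = Σ (-1)^i a_i x^{d-i}
  coeff : ∀ {d} → Vec Carrier d → ℕ → Carrier
  coeff = esym

  moment : ∀ {d} → Vec Carrier d → ℕ → Carrier
  moment {d} λs n = ι (divN (ℤ.+ 1) d) *ᴿ Vec.foldr _ (λ x r → powR x n +ᴿ r) 0# λs

  coeffπ : ∀ {d} → Vec Carrier d → List ℕ → Carrier
  coeffπ λs π = prodR (map (coeff λs) (blockSizes π))

  cumCoef : ℕ → ℕ → List ℕ → ℚ
  cumCoef d n π =
    divN ((ℤ.- (ℤ.+ d)) ℤ.^ n ℤ.* ((ℤ.- (ℤ.+ 1)) ℤ.^ numBlocks π)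
            ℤ.* (ℤ.+ foldr _*_ 1 (map factorial (blockSizes π)))
            ℤ.* (ℤ.+ factorial (numBlocks π ∸ 1)))
         (d * factorial (n ∸ 1) * foldr _*_ 1 (map (falling d) (blockSizes π)))

  cumulant : ∀ {d} → Vec Carrier d → ℕ → Carrier
  cumulant {d} λs n =
    sumR (map (λ π → ι (cumCoef d n π) *ᴿ coeffπ λs π) (SetPartitions n))

  cumulantπ : ∀ {d} → Vec Carrier d → List ℕ → Carrier
  cumulantπ λs π = prodR (map (cumulant λs) (blockSizes π))

  cumulantPerm : ∀ {d} → Vec Carrier d → ℕ → List ℕ → Carrier
  cumulantPerm λs N α = prodR (map (cumulant λs) (cycleLengths N (at α)))

  LHS : ∀ {d} → Vec Carrier d → ℕ → Carrier
  LHS λs n = moment λs n -ᴿ sumR (map (cumulantπ λs) (NCPartitions n))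

  mainTerm : ∀ {d} → Vec Carrier d → ℕ → Carrier
  mainTerm {d} λs n =
    ι (divN (ℤ.- (ℤ.+ n)) (2 * d)) *ᴿ
    sumR (map (λ r → let s = n ∸ r in
                 sumR (map (λ α → ι (divN (ℤ.+ 1) (r * s)) *ᴿ cumulantPerm λs (r + s) α)
                           (SNC r s)))
              (range 1 n))

  errorTerm : ∀ {d} → Vec Carrier d → ℕ → (ℕ → List ℕ → ℚ) → Carrier
  errorTerm {d} λs n c =
    sumR (map (λ k → ι (divN (ℤ.+ 1) (d ℕ.^ k)) *ᴿ
                     sumR (map (λ σ → ι (c k σ) *ᴿ cumulantπ λs σ) (SetPartitions n)))
              (range 2 n))

{-# OPTIONS --safe #-}

-- Write e = 1/d and κ_0 = 1.  Newton's identities and the definition of the cumulants as logarithmic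
-- coefficients give, for the coefficients b of p, the moments m and suitable numbers c_n,
--     m b = b - e θ b   and   b_n = c_n h_n,   θ h = -d (Σ_{j ≥ 1} κ_j y^j) h,   c_{n+1} = (1 - e n) c_n,
-- where θ = y d/dy.
-- It follows that m = Φ_0 for the universal family of polynomials in e and the κ_j defined by
--     Φ_j(0) = κ_j,   Φ_j(n+1) = Σ_{a+b=n} Φ_0(a) Φ_{j+1}(b) - e n Φ_{j+1}(n).
-- Since Φ_0(n) has degree less than n in e, it remains to identify its coefficients of degree 0 and 1.
-- In degree 0 the recursion is the one obtained by reading a non-crossing partition from left to right.
-- In degree 1 it is the linearised recursion, which is solved by -Σ_{r+s=n} Y_s(r)/s, where Y_s(r) is the sum
-- over S_NC(r,s): deleting a letter x from α (replacing α and γ by their products with the transposition of x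
-- and α(x)) cuts a cycle of γ or joins two of them.  The quantity #(α) + #(α⁻¹γ) + 2 #(joins) is determined by
-- γ, so an annular non-crossing permutation is one with exactly one join, of the two circles.  Finally
-- n/(2rs) = (1/r + 1/s)/2, and Y_s(r) = Y_r(s) because the peeling may start on either circle.

module Submission where

open import Defs
open import Data.Nat using (ℕ; _≤_)
open import Data.Rational using (ℚ)
open import Data.Rational.Base using (+-*-rawRing)
open import Data.Vec using (Vec)
open import Data.List using (List)
open import Data.Product using (Σ-syntax)
open import Algebra.Bundles using (CommutativeRing)
open import Algebra.Morphism.Structures using (IsRingHomomorphism)

open import Algebra.Bundles using (CommutativeSemiring)
open import Data.Bool using (Bool; true; false; T; not; _∧_; _∨_; _xor_; if_then_else_)
open import Data.Bool.ListAction using (all; any)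
open import Data.Bool.Properties using (T?; T-∧; T-∨)
open import Data.Empty using (⊥-elim)
open import Data.Integer as ℤ using (ℤ)
import Data.Integer.Properties as ℤ
open import Data.List using ([]; _∷_; map; concatMap; concat; _++_; length; upTo; applyUpTo; filterᵇ; foldr; replicate; initLast; _∷ʳ′_)
open import Data.List.Membership.Propositional using (_∈_; _∉_; find; lose)
open import Data.List.Membership.Propositional.Properties
open import Data.List.Membership.Propositional.Properties.WithK using (unique∧set⇒bag)
open import Data.List.Properties
  using (++-assoc; ++-identityʳ; length-++; length-map; map-∘; map-++; map-cong-local; map-applyUpTo; length-upTo; ∷-injectiveˡ; ∷-injectiveʳ; ≡-dec)
open import Data.List.Relation.Binary.BagAndSetEquality using (∼bag⇒↭)
open import Data.List.Relation.Binary.Permutation.Propositional as Perm using (_↭_; ↭-refl; ↭-sym; ↭-trans; ↭-prep; ↭-reflexive; ↭-swap)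
open import Data.List.Relation.Binary.Permutation.Propositional.Properties
  using (∈-resp-↭; ↭-length; ++⁺ˡ; ++⁺ʳ; ++-comm; shift; shifts; drop-∷; map⁺)
import Data.List.Relation.Binary.Permutation.Setoid.Properties as PermS
open import Data.List.Relation.Unary.All as All using (All; []; _∷_)
import Data.List.Relation.Unary.All.Properties as All
open import Data.List.Relation.Unary.AllPairs as AP using (AllPairs; []; _∷_)
import Data.List.Relation.Unary.AllPairs.Properties as AP
open import Data.List.Relation.Unary.Any using (here; there)
open import Data.List.Relation.Unary.Unique.Propositional using (Unique)
import Data.List.Relation.Unary.Unique.Propositional.Properties as Unique
open import Data.Maybe using (Maybe; just; nothing)
open import Data.Nat as ℕ using (zero; suc; _<_; z≤n; s≤s; _≡ᵇ_; _<ᵇ_; _≤ᵇ_; _⊓_)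
open import Data.Nat.ListAction using (sum)
open import Data.Nat.ListAction.Properties using (sum-++)
import Data.Nat.Properties as ℕ
open import Data.Nat.Solver using (module +-*-Solver)
open import Data.Product using (∃-syntax; _×_; _,_; proj₁; proj₂)
import Data.Rational as ℚ
import Data.Rational.Properties as ℚ
open import Data.Rational.Unnormalised as ℚᵘ using (mkℚᵘ; *≡*)
import Data.Rational.Unnormalised.Properties as ℚᵘ
open import Data.Sum using (_⊎_; inj₁; inj₂)
open import Data.Unit using (tt)
import Data.Vec as Vector
open import Function using (_∘_; id; mk⇔; Equivalence)
open import Level using (0ℓ)
open import Relation.Binary.PropositionalEquality using (_≡_; _≢_; refl; sym; trans; cong; cong₂; subst; module ≡-Reasoning)
open import Relation.Nullary using (¬_; Dec; yes; no)
open import Relation.Nullary.Decidable using (⌊_⌋; toWitness; fromWitness)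
open import Data.List.Membership.DecPropositional ℕ._≟_ using (_∈?_)

-- The index j enters as follows. Let K_j be the series with coefficient κ_(i+j) at y^i. The claim
-- behind the recursion is that Φ_j b has at y^n the coefficient c_n times that of K_j h. For j = 0
-- the equation for θ h turns this into the equation for m b. The step from j to j + 1 removes the
-- constant term and divides by y; with c_(n+1) = (1 - e n) c_n the quotient becomes Φ_(j+1) b - e
-- θ(Φ_(j+1) b) = Φ_(j+1) (b - e θ b) - e (θ Φ_(j+1)) b, and b - e θ b = Φ_0 b gives the recursion
-- after cancelling b. No division by d - i remains, so the error coefficients can be fixed before
-- the ring and the polynomial: the recursion is run on formal terms and evaluated afterwards. All
-- this holds only for coefficients up to y^d, because b_n = c_n h_n divides by (d)_n; identities of
-- series are therefore compared up to a bound. The combinatorial sums live in commutative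
-- semirings, so equations with signs are stated as vanishing sums.

-- Finite sums and products in a commutative semiring.

module Semi (S : CommutativeSemiring 0ℓ 0ℓ) where
  open CommutativeSemiring S renaming (refl to ≈-refl; sym to ≈-sym; trans to ≈-trans)
  open import Algebra.Solver.Ring.NaturalCoefficients.Default S using (solve; _:=_; _:+_; _:*_; con)
  open import Relation.Binary.Reasoning.Setoid setoid

  Σ[_]_ : {A : Set} → List A → (A → Carrier) → Carrier
  Σ[ xs ] f = foldr _+_ 0# (map f xs)

  Π : List Carrier → Carrier
  Π = foldr _*_ 1#

  Πκ : (ℕ → Carrier) → List ℕ → Carrier
  Πκ κ xs = Π (map κ xs)

  nat : ℕ → Carrier
  nat zero    = 0#
  nat (suc n) = 1# + nat n

  nat-+ : ∀ m n → nat (m ℕ.+ n) ≈ nat m + nat n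
  nat-+ zero    n = ≈-sym (+-identityˡ _)
  nat-+ (suc m) n = ≈-trans (+-congˡ (nat-+ m n)) (≈-sym (+-assoc _ _ _))

  nat-* : ∀ m n → nat (m ℕ.* n) ≈ nat m * nat n
  nat-* zero    n = ≈-sym (zeroˡ _)
  nat-* (suc m) n = begin
    nat (n ℕ.+ m ℕ.* n)     ≈⟨ nat-+ n _ ⟩
    nat n + nat (m ℕ.* n)   ≈⟨ +-congˡ (nat-* m n) ⟩
    nat n + nat m * nat n   ≈⟨ solve 2 (λ a b → b :+ a :* b := (con 1 :+ a) :* b) ≈-refl (nat m) (nat n) ⟩
    (1# + nat m) * nat n    ∎

  Σ-cong : ∀ {A : Set} (xs : List A) {f g : A → Carrier} → (∀ x → f x ≈ g x) → Σ[ xs ] f ≈ Σ[ xs ] g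
  Σ-cong []       h = ≈-refl
  Σ-cong (x ∷ xs) h = +-cong (h x) (Σ-cong xs h)

  Σ-congAll : ∀ {A : Set} {xs : List A} {f g : A → Carrier} → All (λ x → f x ≈ g x) xs → Σ[ xs ] f ≈ Σ[ xs ] g
  Σ-congAll []       = ≈-refl
  Σ-congAll (h ∷ hs) = +-cong h (Σ-congAll hs)

  Σ-++ : ∀ {A : Set} (xs ys : List A) {f : A → Carrier} → Σ[ xs ++ ys ] f ≈ Σ[ xs ] f + Σ[ ys ] f
  Σ-++ []       ys = ≈-sym (+-identityˡ _)
  Σ-++ (x ∷ xs) ys = ≈-trans (+-congˡ (Σ-++ xs ys)) (≈-sym (+-assoc _ _ _))

  Σ-map : ∀ {A B : Set} (g : A → B) (xs : List A) {f : B → Carrier} → Σ[ map g xs ] f ≈ Σ[ xs ] (λ x → f (g x))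
  Σ-map g []       = ≈-refl
  Σ-map g (x ∷ xs) = +-congˡ (Σ-map g xs)

  Σ-concatMap : ∀ {A B : Set} (g : A → List B) (xs : List A) {f : B → Carrier} →
                Σ[ concatMap g xs ] f ≈ Σ[ xs ] (λ x → Σ[ g x ] f)
  Σ-concatMap g []       = ≈-refl
  Σ-concatMap g (x ∷ xs) = ≈-trans (Σ-++ (g x) _) (+-congˡ (Σ-concatMap g xs))

  Σ-0 : ∀ {A : Set} (xs : List A) {f : A → Carrier} → (∀ x → f x ≈ 0#) → Σ[ xs ] f ≈ 0#
  Σ-0 []       h = ≈-refl
  Σ-0 (x ∷ xs) h = ≈-trans (+-cong (h x) (Σ-0 xs h)) (+-identityˡ _)

  Σ-+ : ∀ {A : Set} (xs : List A) {f g : A → Carrier} → Σ[ xs ] (λ x → f x + g x) ≈ Σ[ xs ] f + Σ[ xs ] g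
  Σ-+ []       = ≈-sym (+-identityˡ _)
  Σ-+ (x ∷ xs) {f} {g} = ≈-trans (+-congˡ (Σ-+ xs))
    (solve 4 (λ a b c d → (a :+ b) :+ (c :+ d) := (a :+ c) :+ (b :+ d)) ≈-refl (f x) (g x) _ _)

  Σ-*ˡ : ∀ {A : Set} c (xs : List A) {f : A → Carrier} → Σ[ xs ] (λ x → c * f x) ≈ c * Σ[ xs ] f
  Σ-*ˡ c []       = ≈-sym (zeroʳ c)
  Σ-*ˡ c (x ∷ xs) = ≈-trans (+-congˡ (Σ-*ˡ c xs)) (≈-sym (distribˡ c _ _))

  Σ-*ʳ : ∀ {A : Set} c (xs : List A) {f : A → Carrier} → Σ[ xs ] (λ x → f x * c) ≈ Σ[ xs ] f * c
  Σ-*ʳ c []       = ≈-sym (zeroˡ c)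
  Σ-*ʳ c (x ∷ xs) = ≈-trans (+-congˡ (Σ-*ʳ c xs)) (≈-sym (distribʳ c _ _))

  Σ-swap : ∀ {A B : Set} (xs : List A) (ys : List B) {f : A → B → Carrier} →
           Σ[ xs ] (λ x → Σ[ ys ] (λ y → f x y)) ≈ Σ[ ys ] (λ y → Σ[ xs ] (λ x → f x y))
  Σ-swap []       ys = ≈-sym (Σ-0 ys (λ _ → ≈-refl))
  Σ-swap (x ∷ xs) ys = ≈-trans (+-congˡ (Σ-swap xs ys)) (≈-sym (Σ-+ ys))

  Σ-↭ : ∀ {A : Set} {xs ys : List A} {f : A → Carrier} → xs ↭ ys → Σ[ xs ] f ≈ Σ[ ys ] f
  Σ-↭ Perm.refl         = ≈-refl
  Σ-↭ (Perm.prep x p)   = +-congˡ (Σ-↭ p)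
  Σ-↭ {f = f} (Perm.swap x y p) = ≈-trans (+-congˡ (+-congˡ (Σ-↭ p)))
    (solve 3 (λ a b c → a :+ (b :+ c) := b :+ (a :+ c)) ≈-refl (f x) (f y) _)
  Σ-↭ (Perm.trans p q)  = ≈-trans (Σ-↭ p) (Σ-↭ q)

  Πκ-↭ : ∀ κ {xs ys : List ℕ} → xs ↭ ys → Πκ κ xs ≈ Πκ κ ys
  Πκ-↭ κ Perm.refl         = ≈-refl
  Πκ-↭ κ (Perm.prep x p)   = *-congˡ (Πκ-↭ κ p)
  Πκ-↭ κ (Perm.swap x y p) = ≈-trans (*-congˡ (*-congˡ (Πκ-↭ κ p)))
    (solve 3 (λ a b c → a :* (b :* c) := b :* (a :* c)) ≈-refl (κ x) (κ y) _)
  Πκ-↭ κ (Perm.trans p q)  = ≈-trans (Πκ-↭ κ p) (Πκ-↭ κ q)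

  Πκ-++ : ∀ κ (xs ys : List ℕ) → Πκ κ (xs ++ ys) ≈ Πκ κ xs * Πκ κ ys
  Πκ-++ κ []       ys = ≈-sym (*-identityˡ _)
  Πκ-++ κ (x ∷ xs) ys = ≈-trans (*-congˡ (Πκ-++ κ xs ys)) (≈-sym (*-assoc _ _ _))

  Σ-upTo-suc : ∀ l {h : ℕ → Carrier} → Σ[ upTo (suc l) ] h ≈ h 0 + Σ[ upTo l ] (h ∘ suc)
  Σ-upTo-suc l {h} = +-congˡ (≈-trans (reflexive (cong (λ t → Σ[ t ] h) (sym (map-applyUpTo id suc l)))) (Σ-map suc (upTo l)))

  Σ-upTo-last : ∀ l {h : ℕ → Carrier} → Σ[ upTo (suc l) ] h ≈ Σ[ upTo l ] h + h l
  Σ-upTo-last zero    = ≈-trans (+-identityʳ _) (≈-sym (+-identityˡ _))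
  Σ-upTo-last (suc l) {h} = ≈-trans (Σ-upTo-suc (suc l)) (≈-trans (+-congˡ (Σ-upTo-last l)) (≈-trans (≈-sym (+-assoc _ _ _)) (+-congʳ (≈-sym (Σ-upTo-suc l)))))

  -- Formal power series.

  Seq : Set
  Seq = ℕ → Carrier

  infix  4 _≋_
  infixl 6 _⊞_
  infixl 7 _⊛_

  _≋_ : Seq → Seq → Set
  f ≋ g = ∀ n → f n ≈ g n

  tail : Seq → Seq
  tail f n = f (suc n)

  _⊞_ : Seq → Seq → Seq
  (f ⊞ g) n = f n + g n

  -- The Cauchy product without index subtraction: recursion on the tail of the left factor matches
  -- the way in which words are split letter by letter below.
  _⊛_ : Seq → Seq → Seq
  (f ⊛ g) zero    = f 0 * g 0
  (f ⊛ g) (suc n) = f 0 * g (suc n) + (tail f ⊛ g) n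

  const : Carrier → Seq
  const c zero    = c
  const c (suc n) = 0#

  -- Coefficient n of a product sees only coefficients up to n. This makes the later recursions
  -- causal and allows the use of identities that are known only up to d.
  ⊛-cong≤ : ∀ {f f′ g g′} n → (∀ i → i ≤ n → f i ≈ f′ i) → (∀ i → i ≤ n → g i ≈ g′ i) →
            (f ⊛ g) n ≈ (f′ ⊛ g′) n
  ⊛-cong≤ zero    p q = *-cong (p 0 z≤n) (q 0 z≤n)
  ⊛-cong≤ (suc n) p q = +-cong (*-cong (p 0 z≤n) (q (suc n) ℕ.≤-refl))
    (⊛-cong≤ n (λ i i≤n → p (suc i) (s≤s i≤n)) (λ i i≤n → q i (ℕ.m≤n⇒m≤1+n i≤n)))

  ⊛-cong : ∀ {f f′ g g′} → f ≋ f′ → g ≋ g′ → f ⊛ g ≋ f′ ⊛ g′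
  ⊛-cong p q n = ⊛-cong≤ n (λ i _ → p i) (λ i _ → q i)

  const⊛ : ∀ c f n → (const c ⊛ f) n ≈ c * f n
  const⊛ c f zero    = ≈-refl
  const⊛ c f (suc n) = ≈-trans (+-congˡ (z n)) (+-identityʳ _)
    where z : ∀ {f} n → (tail (const c) ⊛ f) n ≈ 0#
          z zero    = zeroˡ _
          z (suc n) = ≈-trans (+-cong (zeroˡ _) (z n)) (+-identityˡ _)

  ⊛-distribʳ : ∀ h f g → (f ⊞ g) ⊛ h ≋ f ⊛ h ⊞ g ⊛ h
  ⊛-distribʳ h f g zero    = distribʳ _ _ _
  ⊛-distribʳ h f g (suc n) = ≈-trans (+-congˡ (⊛-distribʳ h (tail f) (tail g) n))
    (solve 5 (λ a b c d e → (a :+ b) :* c :+ (d :+ e) := (a :* c :+ d) :+ (b :* c :+ e)) ≈-refl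
       (f 0) (g 0) (h (suc n)) _ _)

  ⊛-sucʳ : ∀ f g n → (f ⊛ g) (suc n) ≈ f (suc n) * g 0 + (f ⊛ tail g) n
  ⊛-sucʳ f g zero    = +-comm _ _
  ⊛-sucʳ f g (suc n) = ≈-trans (+-congˡ (⊛-sucʳ (tail f) g n))
    (solve 3 (λ a b c → a :+ (b :+ c) := b :+ (a :+ c)) ≈-refl _ _ _)

  ⊛-comm : ∀ f g → f ⊛ g ≋ g ⊛ f
  ⊛-comm f g zero    = *-comm _ _
  ⊛-comm f g (suc n) = begin
    f 0 * g (suc n) + (tail f ⊛ g) n ≈⟨ +-cong (*-comm _ _) (⊛-comm (tail f) g n) ⟩
    g (suc n) * f 0 + (g ⊛ tail f) n ≈⟨ ⊛-sucʳ g f n ⟨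
    (g ⊛ f) (suc n)                   ∎

  scale⊛ : ∀ c f g n → ((λ i → c * f i) ⊛ g) n ≈ c * (f ⊛ g) n
  scale⊛ c f g zero    = *-assoc _ _ _
  scale⊛ c f g (suc n) = ≈-trans (+-cong (*-assoc _ _ _) (scale⊛ c (tail f) g n)) (≈-sym (distribˡ _ _ _))

  ⊛-assoc : ∀ f g h → (f ⊛ g) ⊛ h ≋ f ⊛ (g ⊛ h)
  ⊛-assoc f g h zero    = *-assoc _ _ _
  ⊛-assoc f g h (suc n) = begin
    (f 0 * g 0) * h (suc n) + (tail (f ⊛ g) ⊛ h) n
      ≈⟨ +-congˡ (⊛-distribʳ h (λ i → f 0 * tail g i) (tail f ⊛ g) n) ⟩
    (f 0 * g 0) * h (suc n) + (((λ i → f 0 * tail g i) ⊛ h) n + ((tail f ⊛ g) ⊛ h) n)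
      ≈⟨ +-congˡ (+-cong (scale⊛ (f 0) (tail g) h n) (⊛-assoc (tail f) g h n)) ⟩
    (f 0 * g 0) * h (suc n) + (f 0 * (tail g ⊛ h) n + (tail f ⊛ (g ⊛ h)) n)
      ≈⟨ solve 5 (λ a b c d e → (a :* b) :* c :+ (a :* d :+ e) := a :* (b :* c :+ d) :+ e) ≈-refl (f 0) (g 0) (h (suc n)) _ _ ⟩
    f 0 * (g 0 * h (suc n) + (tail g ⊛ h) n) + (tail f ⊛ (g ⊛ h)) n ∎

  open import Algebra.Structures {A = Seq} _≋_ using (IsCommutativeSemiring)

  -- Bundled so that the solver applies to identities between whole series.
  series : CommutativeSemiring 0ℓ 0ℓ
  series = record
    { Carrier = Seq ; _≈_ = _≋_ ; _+_ = _⊞_ ; _*_ = _⊛_ ; 0# = λ _ → 0# ; 1# = const 1#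
    ; isCommutativeSemiring = isCS }
    where
    isCS : IsCommutativeSemiring _⊞_ _⊛_ (λ _ → 0#) (const 1#)
    isCS = record
      { isSemiring = record
        { isSemiringWithoutAnnihilatingZero = record
          { +-isCommutativeMonoid = record
            { isMonoid = record
              { isSemigroup = record
                { isMagma = record
                  { isEquivalence = record
                    { refl = λ _ → ≈-refl ; sym = λ p n → ≈-sym (p n) ; trans = λ p q n → ≈-trans (p n) (q n) }
                  ; ∙-cong = λ p q n → +-cong (p n) (q n) }
                ; assoc = λ f g h n → +-assoc _ _ _ }
              ; identity = (λ f n → +-identityˡ _) , (λ f n → +-identityʳ _) }
            ; comm = λ f g n → +-comm _ _ }
          ; *-cong = ⊛-cong
          ; *-assoc = ⊛-assoc
          ; *-identity = id1 , (λ f n → ≈-trans (⊛-comm f (const 1#) n) (id1 f n))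
          ; distrib = (λ h f g n → ≈-trans (⊛-comm h (f ⊞ g) n) (≈-trans (⊛-distribʳ h f g n)
                                     (+-cong (⊛-comm f h n) (⊛-comm g h n)))) , ⊛-distribʳ }
        ; zero = z , (λ f n → ≈-trans (⊛-comm f (λ _ → 0#) n) (z f n)) }
      ; *-comm = ⊛-comm }
      where
      id1 : ∀ f → const 1# ⊛ f ≋ f
      id1 f n = ≈-trans (const⊛ 1# f n) (*-identityˡ _)
      z : ∀ f → (λ _ → 0#) ⊛ f ≋ (λ _ → 0#)
      z f zero    = zeroˡ _
      z f (suc n) = ≈-trans (+-cong (zeroˡ _) (z f n)) (+-identityˡ _)

  ⊛-distribˡ : ∀ h f g → h ⊛ (f ⊞ g) ≋ h ⊛ f ⊞ h ⊛ g
  ⊛-distribˡ = CommutativeSemiring.distribˡ series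

  ⊛scale : ∀ c f g n → (f ⊛ (λ i → c * g i)) n ≈ c * (f ⊛ g) n
  ⊛scale c f g n = ≈-trans (⊛-comm f _ n) (≈-trans (scale⊛ c g f n) (*-congˡ (⊛-comm g f n)))

  θ : Seq → Seq
  θ f n = nat n * f n

  D : Seq → Seq
  D f n = nat (suc n) * f (suc n)

  θ-⊛ : ∀ f g → θ (f ⊛ g) ≋ θ f ⊛ g ⊞ f ⊛ θ g
  θ-⊛ f g zero    = solve 2 (λ a b → con 0 :* (a :* b) := (con 0 :* a) :* b :+ a :* (con 0 :* b)) ≈-refl (f 0) (g 0)
  θ-⊛ f g (suc n) = begin
    nat (suc n) * (f 0 * g (suc n) + (tail f ⊛ g) n)
      ≈⟨ solve 4 (λ n a b c → (con 1 :+ n) :* (a :* b :+ c) := a :* ((con 1 :+ n) :* b) :+ (n :* c :+ c)) ≈-refl (nat n) (f 0) (g (suc n)) _ ⟩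
    f 0 * θ g (suc n) + (θ (tail f ⊛ g) n + (tail f ⊛ g) n)
      ≈⟨ +-congˡ (+-congʳ (θ-⊛ (tail f) g n)) ⟩
    f 0 * θ g (suc n) + (((θ (tail f) ⊛ g) n + (tail f ⊛ θ g) n) + (tail f ⊛ g) n)
      ≈⟨ solve 4 (λ a b c d → a :+ ((b :+ c) :+ d) := (d :+ b) :+ (a :+ c)) ≈-refl _ _ _ _ ⟩
    ((tail f ⊛ g) n + (θ (tail f) ⊛ g) n) + (f 0 * θ g (suc n) + (tail f ⊛ θ g) n)
      ≈⟨ +-congʳ (⊛-distribʳ g (tail f) (θ (tail f)) n) ⟨
    ((tail f ⊞ θ (tail f)) ⊛ g) n + (f 0 * θ g (suc n) + (tail f ⊛ θ g) n)
      ≈⟨ +-congʳ (⊛-cong {g = g} (λ i → solve 2 (λ a b → b :+ a :* b := (con 1 :+ a) :* b) ≈-refl (nat i) (f (suc i))) (λ _ → ≈-refl) n) ⟩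
    (tail (θ f) ⊛ g) n + (f 0 * θ g (suc n) + (tail f ⊛ θ g) n)
      ≈⟨ solve 4 (λ a b c d → a :+ b := (con 0 :* c) :* d :+ a :+ b) ≈-refl _ _ (f 0) (g (suc n)) ⟩
    θ f 0 * g (suc n) + (tail (θ f) ⊛ g) n + (f 0 * θ g (suc n) + (tail f ⊛ θ g) n) ∎

  D-⊛ : ∀ f g → D (f ⊛ g) ≋ D f ⊛ g ⊞ f ⊛ D g
  D-⊛ f g n = begin
    θ (f ⊛ g) (suc n)                         ≈⟨ θ-⊛ f g (suc n) ⟩
    (θ f 0 * g (suc n) + (D f ⊛ g) n) + (f ⊛ θ g) (suc n) ≈⟨ +-congˡ (⊛-sucʳ f (θ g) n) ⟩
    ((0# * f 0) * g (suc n) + (D f ⊛ g) n) + (f (suc n) * (0# * g 0) + (f ⊛ D g) n)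
      ≈⟨ solve 6 (λ a b c d e h → ((con 0 :* a) :* b :+ c) :+ (d :* (con 0 :* e) :+ h) := c :+ h) ≈-refl (f 0) (g (suc n)) _ (f (suc n)) (g 0) _ ⟩
    (D f ⊛ g) n + (f ⊛ D g) n ∎

-- Permutations in cycle notation.

Cycles : Set
Cycles = List (List ℕ)

Unique-resp-↭ : {xs ys : List ℕ} → xs ↭ ys → Unique xs → Unique ys
Unique-resp-↭ p = PermS.Unique-resp-↭ (Relation.Binary.PropositionalEquality.setoid ℕ) (Perm.↭⇒↭ₛ p)

Unique-++ʳ : (xs : List ℕ) {ys : List ℕ} → Unique (xs ++ ys) → Unique ys
Unique-++ʳ []       u       = u
Unique-++ʳ (x ∷ xs) (_ ∷ u) = Unique-++ʳ xs u

Unique-++ˡ : (xs : List ℕ) {ys : List ℕ} → Unique (xs ++ ys) → Unique xs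
Unique-++ˡ []       u       = []
Unique-++ˡ (x ∷ xs) (p ∷ u) = All.++⁻ˡ xs p ∷ Unique-++ˡ xs u

Unique-head : ∀ {x} {xs : List ℕ} → Unique (x ∷ xs) → x ∉ xs
Unique-head (p ∷ _) x∈ = All.lookup p x∈ refl

Unique-disjoint : (xs : List ℕ) {ys : List ℕ} {z : ℕ} → Unique (xs ++ ys) → z ∈ xs → z ∉ ys
Unique-disjoint (x ∷ xs) u (here refl) q = Unique-head u (∈-++⁺ʳ xs q)
Unique-disjoint (x ∷ xs) (_ ∷ u) (there p) q = Unique-disjoint xs u p q

abstract
  -- Kept opaque: all later reasoning goes through its three values, and products of transpositions
  -- do not unfold into nested case distinctions.
  transpose : ℕ → ℕ → ℕ → ℕ
  transpose x y z with z ℕ.≟ x | z ℕ.≟ y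
  ... | yes _ | _     = y
  ... | no _  | yes _ = x
  ... | no _  | no _  = z

  transpose-left : ∀ x y → transpose x y x ≡ y
  transpose-left x y with x ℕ.≟ x | x ℕ.≟ y
  ... | yes _  | _ = refl
  ... | no x≢x | _ = ⊥-elim (x≢x refl)

  transpose-right : ∀ x y → transpose x y y ≡ x
  transpose-right x y with y ℕ.≟ x | y ℕ.≟ y
  ... | yes y≡x | _      = y≡x
  ... | no _    | yes _  = refl
  ... | no _    | no y≢y = ⊥-elim (y≢y refl)

  transpose-other : ∀ x y {z} → z ≢ x → z ≢ y → transpose x y z ≡ z
  transpose-other x y {z} z≢x z≢y with z ℕ.≟ x | z ℕ.≟ y
  ... | yes p | _     = ⊥-elim (z≢x p)
  ... | no _  | yes p = ⊥-elim (z≢y p)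
  ... | no _  | no _  = refl

data Cases (x y : ℕ) : ℕ → Set where
  left  : Cases x y x
  right : Cases x y y
  other : ∀ {z} → z ≢ x → z ≢ y → Cases x y z

cases : ∀ x y z → Cases x y z
cases x y z with z ℕ.≟ x
... | yes refl = left
... | no p with z ℕ.≟ y
...   | yes refl = right
...   | no q = other p q

transpose-involutive : ∀ x y z → transpose x y (transpose x y z) ≡ z
transpose-involutive x y z with cases x y z
... | left = trans (cong (transpose x y) (transpose-left x y)) (transpose-right x y)
... | right = trans (cong (transpose x y) (transpose-right x y)) (transpose-left x y)
... | other p q = trans (cong (transpose x y) (transpose-other x y p q)) (transpose-other x y p q)

transpose-injective : ∀ x y {a b} → transpose x y a ≡ transpose x y b → a ≡ b
transpose-injective x y {a} {b} eq =
  trans (sym (transpose-involutive x y a)) (trans (cong (transpose x y) eq) (transpose-involutive x y b))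

transpose-comm : ∀ x y z → transpose x y z ≡ transpose y x z
transpose-comm x y z with cases x y z
... | left = trans (transpose-left x y) (sym (transpose-right y x))
... | right = trans (transpose-right x y) (sym (transpose-left y x))
... | other p q = trans (transpose-other x y p q) (sym (transpose-other y x q p))

transpose-same : ∀ x z → transpose x x z ≡ z
transpose-same x z with cases x x z
... | left = transpose-left x x
... | right = transpose-left x x
... | other p q = transpose-other x x p q

transpose-∈ : ∀ {x y z} {S : List ℕ} → x ∈ S → y ∈ S → z ∈ S → transpose x y z ∈ S
transpose-∈ {x} {y} {z} {S} p q r with cases x y z
... | left = subst (_∈ S) (sym (transpose-left x y)) q
... | right = subst (_∈ S) (sym (transpose-right x y)) p
... | other a b = subst (_∈ S) (sym (transpose-other x y a b)) r

transpose-commute : ∀ x y (f : ℕ → ℕ) → (∀ {a b} → f a ≡ f b → a ≡ b) → f x ≡ x → f y ≡ y →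
                    ∀ z → f (transpose x y z) ≡ transpose x y (f z)
transpose-commute x y f inj fx fy z with cases x y z
... | left = trans (cong f (transpose-left x y)) (trans fy (sym (trans (cong (transpose x y) fx) (transpose-left x y))))
... | right = trans (cong f (transpose-right x y)) (trans fx (sym (trans (cong (transpose x y) fy) (transpose-right x y))))
... | other p q = trans (cong f (transpose-other x y p q))
    (sym (transpose-other x y (λ e → p (inj (trans e (sym fx)))) (λ e → q (inj (trans e (sym fy))))))

-- Conjugating (a i) by (x a) gives (x i); in this way `cycle-split` carries the cutting
-- transposition to the front.
transpose-braid : ∀ x a i → x ≢ a → a ≢ i → x ≢ i → ∀ z →
                  transpose x a (transpose a i z) ≡ transpose x i (transpose x a z)
transpose-braid x a i x≢a a≢i x≢i z with cases x a z
... | left = trans (cong (transpose x a) (transpose-other a i x≢a x≢i))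
    (trans (transpose-left x a) (sym (trans (cong (transpose x i) (transpose-left x a)) (transpose-other x i (x≢a ∘ sym) a≢i))))
... | right = trans (cong (transpose x a) (transpose-left a i))
    (trans (transpose-other x a (x≢i ∘ sym) (a≢i ∘ sym))
      (sym (trans (cong (transpose x i) (transpose-right x a)) (transpose-left x i))))
... | other z≢x z≢a with cases a i z
...   | left = ⊥-elim (z≢a refl)
...   | right = trans (cong (transpose x a) (transpose-right a i))
    (trans (transpose-right x a) (sym (trans (cong (transpose x i) (transpose-other x a z≢x z≢a)) (transpose-right x i))))
...   | other _ z≢i = trans (cong (transpose x a) (transpose-other a i z≢a z≢i))
    (trans (transpose-other x a z≢x z≢a) (sym (trans (cong (transpose x i) (transpose-other x a z≢x z≢a)) (transpose-other x i z≢x z≢i))))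

-- Written as a product of transpositions so that deleting the first letter strips exactly the
-- outermost factor, which is the peeling step.
cycle : List ℕ → ℕ → ℕ
cycle []          = id
cycle (x ∷ [])    = id
cycle (x ∷ i ∷ w) = transpose x i ∘ cycle (i ∷ w)

perm : Cycles → ℕ → ℕ
perm []      = id
perm (c ∷ C) = cycle c ∘ perm C

cycle-∉ : ∀ c {z} → z ∉ c → cycle c z ≡ z
cycle-∉ []          z∉ = refl
cycle-∉ (x ∷ [])    z∉ = refl
cycle-∉ (x ∷ i ∷ w) z∉ = trans (cong (transpose x i) (cycle-∉ (i ∷ w) (z∉ ∘ there)))
  (transpose-other x i (z∉ ∘ here) (z∉ ∘ there ∘ here))

cycle-∈ : ∀ c {z} → z ∈ c → cycle c z ∈ c
cycle-∈ (x ∷ [])    z∈ = z∈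
cycle-∈ (x ∷ i ∷ w) {z} z∈ = step (cycle-∈ (i ∷ w)) (z ∈? (i ∷ w)) z∈
  where
  step : ∀ {z} → (z ∈ i ∷ w → cycle (i ∷ w) z ∈ i ∷ w) → Dec (z ∈ i ∷ w) → z ∈ x ∷ i ∷ w → cycle (x ∷ i ∷ w) z ∈ x ∷ i ∷ w
  step rec (yes p) _          = transpose-∈ (here refl) (there (here refl)) (there (rec p))
  step rec (no ¬p) (there p)  = ⊥-elim (¬p p)
  step rec (no ¬p) (here refl) =
    subst (_∈ x ∷ i ∷ w) (sym (trans (cong (transpose x i) (cycle-∉ (i ∷ w) ¬p)) (transpose-left x i))) (there (here refl))

cycle-injective : ∀ c {a b} → cycle c a ≡ cycle c b → a ≡ b
cycle-injective []          e = e
cycle-injective (x ∷ [])    e = e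
cycle-injective (x ∷ i ∷ w) e = cycle-injective (i ∷ w) (transpose-injective x i e)

perm-injective : ∀ C {a b} → perm C a ≡ perm C b → a ≡ b
perm-injective []      e = e
perm-injective (c ∷ C) e = perm-injective C (cycle-injective c e)

perm-∉ : ∀ C {z} → z ∉ concat C → perm C z ≡ z
perm-∉ []      z∉ = refl
perm-∉ (c ∷ C) z∉ = trans (cong (cycle c) (perm-∉ C (z∉ ∘ ∈-++⁺ʳ c))) (cycle-∉ c (z∉ ∘ ∈-++⁺ˡ))

perm-∈ : ∀ C {z} → z ∈ concat C → perm C z ∈ concat C
perm-∈ (c ∷ C) {z} z∈ with z ∈? concat C
... | no z∉ with ∈-++⁻ c z∈
...   | inj₁ z∈c = subst (λ t → cycle c t ∈ _) (sym (perm-∉ C z∉)) (∈-++⁺ˡ (cycle-∈ c z∈c))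
...   | inj₂ z∈C = ⊥-elim (z∉ z∈C)
perm-∈ (c ∷ C) {z} z∈ | yes z∈C with perm C z ∈? c
... | yes p = ∈-++⁺ˡ (cycle-∈ c p)
... | no p = subst (_∈ _) (sym (cycle-∉ c p)) (∈-++⁺ʳ c (perm-∈ C z∈C))

-- A transposition of two letters of a cycle cuts it in two and, read backwards, joins two cycles.
-- The moves `cut` and `join` both rest on this identity.
cycle-split : ∀ x u i v → Unique (x ∷ u ++ i ∷ v) → ∀ z →
              cycle (x ∷ u ++ i ∷ v) z ≡ transpose x i (cycle (x ∷ u) (cycle (i ∷ v) z))
cycle-split x []      i v un z = refl
cycle-split x (a ∷ u) i v un@(p ∷ un′) z =
  trans (cong (transpose x a) (cycle-split a u i v un′ z))
    (transpose-braid x a i (All.head p) (λ e → Unique-head un′ (∈-++⁺ʳ u (here e)))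
      (λ e → Unique-head un (there (∈-++⁺ʳ u (here e)))) _)

cycle-snoc : ∀ u y x z → cycle (u ++ y ∷ x ∷ []) z ≡ cycle (u ++ y ∷ []) (transpose y x z)
cycle-snoc []          y x z = refl
cycle-snoc (a ∷ [])    y x z = refl
cycle-snoc (a ∷ b ∷ u) y x z = cong (transpose a b) (cycle-snoc (b ∷ u) y x z)

cycle-rotate₁ : ∀ x u → Unique (x ∷ u) → ∀ z → cycle (x ∷ u) z ≡ cycle (u ++ x ∷ []) z
cycle-rotate₁ x []      un z = refl
cycle-rotate₁ x (a ∷ u) un z = sym (trans
  (cycle-split a u x [] (Unique-resp-↭ (++-comm (x ∷ []) (a ∷ u)) un) z) (transpose-comm a x _))

cycle-rotate : ∀ u v → Unique (u ++ v) → ∀ z → cycle (u ++ v) z ≡ cycle (v ++ u) z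
cycle-rotate []      v un z = cong (λ t → cycle t z) (sym (++-identityʳ v))
cycle-rotate (x ∷ u) v un z = begin
  cycle (x ∷ u ++ v) z             ≡⟨ cycle-rotate₁ x (u ++ v) un z ⟩
  cycle ((u ++ v) ++ x ∷ []) z     ≡⟨ cong (λ t → cycle t z) (++-assoc u v (x ∷ [])) ⟩
  cycle (u ++ v ++ x ∷ []) z       ≡⟨ cycle-rotate u (v ++ x ∷ []) (Unique-resp-↭ p un) z ⟩
  cycle ((v ++ x ∷ []) ++ u) z     ≡⟨ cong (λ t → cycle t z) (++-assoc v (x ∷ []) u) ⟩
  cycle (v ++ x ∷ u) z             ∎
  where
  open ≡-Reasoning
  p : x ∷ u ++ v ↭ u ++ v ++ x ∷ []
  p = ↭-trans (++-comm (x ∷ []) (u ++ v)) (↭-reflexive (++-assoc u v (x ∷ [])))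

cycle-commute : ∀ c d → Unique (c ++ d) → ∀ z → cycle c (cycle d z) ≡ cycle d (cycle c z)
cycle-commute c d un z with z ∈? c
... | yes z∈c = trans (cong (cycle c) (cycle-∉ d (Unique-disjoint c un z∈c)))
                      (sym (cycle-∉ d (Unique-disjoint c un (cycle-∈ c z∈c))))
... | no z∉c with z ∈? d
...   | yes z∈d = trans (cycle-∉ c (λ q → Unique-disjoint c un q (cycle-∈ d z∈d))) (cong (cycle d) (sym (cycle-∉ c z∉c)))
...   | no z∉d = trans (cong (cycle c) (cycle-∉ d z∉d))
          (trans (cycle-∉ c z∉c) (sym (trans (cong (cycle d) (cycle-∉ c z∉c)) (cycle-∉ d z∉d))))

concat-↭ : {C C′ : Cycles} → C ↭ C′ → concat C ↭ concat C′
concat-↭ Perm.refl = ↭-refl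
concat-↭ (Perm.prep c p) = ++⁺ˡ c (concat-↭ p)
concat-↭ (Perm.swap c d p) = ↭-trans (shifts c d) (++⁺ˡ d (++⁺ˡ c (concat-↭ p)))
concat-↭ (Perm.trans p q) = ↭-trans (concat-↭ p) (concat-↭ q)

perm-↭ : {C C′ : Cycles} → C ↭ C′ → Unique (concat C) → ∀ z → perm C z ≡ perm C′ z
perm-↭ Perm.refl un z = refl
perm-↭ (Perm.prep c p) un z = cong (cycle c) (perm-↭ p (Unique-++ʳ c un) z)
perm-↭ {c ∷ d ∷ C} (Perm.swap c d p) un z =
  trans (cycle-commute c d (Unique-++ˡ (c ++ d) (subst Unique (sym (++-assoc c d (concat C))) un)) _)
        (cong (cycle d ∘ cycle c) (perm-↭ p (Unique-++ʳ d (Unique-++ʳ c un)) z))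
perm-↭ (Perm.trans p q) un z = trans (perm-↭ p un z) (perm-↭ q (Unique-resp-↭ (concat-↭ p) un) z)

NonEmpty : List ℕ → Set
NonEmpty c = c ≢ []

-- Right multiplication by the transposition of y and a new letter x only makes y go to x and x to
-- the old image of y, so the number of cycles stays the same.
insertAfter : ∀ B y x → y ∈ concat B → Unique (x ∷ concat B) →
  Σ[ B′ ∈ Cycles ] (length B′ ≡ length B) × (concat B′ ↭ x ∷ concat B) × (All NonEmpty B → All NonEmpty B′) ×
    (∀ z → perm B′ z ≡ perm B (transpose y x z))
insertAfter (c ∷ B) y x y∈ un with ∈-++⁻ c y∈
... | inj₂ y∈B with insertAfter B y x y∈B (Unique-++ʳ c (Unique-resp-↭ (↭-sym (shift x c (concat B))) un))
...   | B′ , len , ↭₁ , ne , eq =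
  c ∷ B′ , cong suc len , ↭-trans (++⁺ˡ c ↭₁) (shift x c (concat B)) , (λ { (a ∷ as) → a ∷ ne as }) , λ z → cong (cycle c) (eq z)
insertAfter (c ∷ B) y x y∈ un | inj₁ y∈c with ∈-∃++ y∈c
... | b₁ , b₂ , refl = c′ ∷ B , refl , letters , (λ { (_ ∷ as) → ne ∷ as }) , eq
  where
  -- The cycle of y is rotated so that y comes last; x can then be appended by `cycle-snoc`.
  c′ : List ℕ
  c′ = (b₂ ++ b₁) ++ y ∷ x ∷ []
  ne : NonEmpty c′
  ne e with b₂ ++ b₁
  ne () | []
  ne () | _ ∷ _
  rot : (b₁ ++ y ∷ b₂) ↭ (b₂ ++ b₁) ++ y ∷ []
  rot = ↭-trans (shift y b₁ b₂) (↭-trans (↭-prep y (++-comm b₁ b₂)) (++-comm (y ∷ []) (b₂ ++ b₁)))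
  letters : c′ ++ concat B ↭ x ∷ (b₁ ++ y ∷ b₂) ++ concat B
  letters = ++⁺ʳ (concat B) (↭-trans (↭-reflexive (sym (++-assoc (b₂ ++ b₁) (y ∷ []) (x ∷ []))))
    (↭-trans (++-comm ((b₂ ++ b₁) ++ y ∷ []) (x ∷ [])) (↭-prep x (↭-sym rot))))
  un-c : Unique (b₁ ++ y ∷ b₂)
  un-c = Unique-++ˡ (b₁ ++ y ∷ b₂) (AP.tail un)
  x∉B : x ∉ concat B
  x∉B = Unique-head un ∘ ∈-++⁺ʳ (b₁ ++ y ∷ b₂)
  y∉B : y ∉ concat B
  y∉B = Unique-disjoint (b₁ ++ y ∷ b₂) (AP.tail un) y∈c
  open ≡-Reasoning
  eq : ∀ z → cycle c′ (perm B z) ≡ cycle (b₁ ++ y ∷ b₂) (perm B (transpose y x z))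
  eq z = begin
    cycle c′ (perm B z)                                         ≡⟨ cycle-snoc (b₂ ++ b₁) y x _ ⟩
    cycle ((b₂ ++ b₁) ++ y ∷ []) (transpose y x (perm B z))     ≡⟨ cong (λ t → cycle t _) (++-assoc b₂ b₁ (y ∷ [])) ⟩
    cycle (b₂ ++ b₁ ++ y ∷ []) (transpose y x (perm B z))
      ≡⟨ cycle-rotate b₂ (b₁ ++ y ∷ []) (Unique-resp-↭ (↭-trans rot (↭-reflexive (++-assoc b₂ b₁ _))) un-c) _ ⟩
    cycle ((b₁ ++ y ∷ []) ++ b₂) (transpose y x (perm B z))     ≡⟨ cong (λ t → cycle t _) (++-assoc b₁ (y ∷ []) b₂) ⟩
    cycle (b₁ ++ y ∷ b₂) (transpose y x (perm B z))
      ≡⟨ cong (cycle (b₁ ++ y ∷ b₂)) (transpose-commute y x (perm B) (perm-injective B) (perm-∉ B y∉B) (perm-∉ B x∉B) z) ⟨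
    cycle (b₁ ++ y ∷ b₂) (perm B (transpose y x z))             ∎

-- Peeling factorisations of permutations.

-- FD x u C w A nb jn : a factorisation perm A ∘ perm B = perm ((x ∷ u) ∷ C) in which the cycle of x in A
-- is x ∷ w and the remaining cycles are A.  It is built by deleting the root x and moving on to the root
-- i = perm A x; this cuts the cycle of x in perm C (if i lies on it) or joins it to the cycle of i.
-- The counter nb is the number of cycles of B, counting also the empty cycles of C, and jn the number of joins.
mutual
  data HD : Cycles → Cycles → ℕ → ℕ → Set where
    nil   : HD [] [] 0 0
    empty : ∀ {C A nb jn} → HD C A nb jn → HD ([] ∷ C) A (suc nb) jn
    root  : ∀ {x u C w A nb jn} → FD x u C w A nb jn → HD ((x ∷ u) ∷ C) ((x ∷ w) ∷ A) nb jn

  data FD : ℕ → List ℕ → Cycles → List ℕ → Cycles → ℕ → ℕ → Set where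
    close : ∀ {x u C A nb jn} → HD (u ∷ C) A nb jn → FD x u C [] A nb jn
    cut   : ∀ {x} u₁ {i u₂ C w A nb jn} → FD i u₂ (u₁ ∷ C) w A nb jn → FD x (u₁ ++ i ∷ u₂) C (i ∷ w) A nb jn
    join  : ∀ {x u} C₁ {C₂} v₁ {i v₂ w A nb jn} → FD i (v₂ ++ v₁ ++ u) (C₁ ++ C₂) w A nb jn →
            FD x u (C₁ ++ (v₁ ++ i ∷ v₂) ∷ C₂) (i ∷ w) A nb (suc jn)

empties : Cycles → ℕ
empties []            = 0
empties ([] ∷ C)      = suc (empties C)
empties ((_ ∷ _) ∷ C) = empties C

empties-++ : ∀ C {C′} → empties (C ++ C′) ≡ empties C ℕ.+ empties C′
empties-++ []            = refl
empties-++ ([] ∷ C)      = cong suc (empties-++ C)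
empties-++ ((_ ∷ _) ∷ C) = empties-++ C

empties-snoc : ∀ v i v′ C → empties ((v ++ i ∷ v′) ∷ C) ≡ empties C
empties-snoc []      i v′ C = refl
empties-snoc (_ ∷ v) i v′ C = refl

-- If A and C represent α and γ, then B represents α⁻¹γ. An empty entry of C stands for a cycle of
-- the final cofactor all of whose letters have been deleted; B itself holds only cycles with
-- letters, hence the separate count in `size`.
record Cofactor (A C : Cycles) (k : ℕ) : Set where
  constructor cofactor
  field
    B        : Cycles
    size     : length B ℕ.+ empties C ≡ k
    letters  : concat B ↭ concat C
    nonEmpty : All NonEmpty B
    factors  : ∀ z → perm A (perm B z) ≡ perm C z

-- The two sides of `euler` change together: `close` gives up a letter and a cycle of A, `cut`
-- exchanges a letter for a cycle of C, `join` gives up a letter and a cycle of C at once, and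
-- `empty` moves an entry of C into `nb`.
record Valid (A C : Cycles) (nb jn : ℕ) : Set where
  constructor valid
  field
    letters  : concat A ↭ concat C
    nonEmpty : All NonEmpty A
    euler    : nb ℕ.+ length A ℕ.+ 2 ℕ.* jn ≡ length (concat C) ℕ.+ length C
    cof      : Cofactor A C nb

-- Putting x back in front of u multiplies on the right by the transposition of x and the last
-- letter of u, since (x u) rotates to (u x). The same multiplication of B leaves A alone. If u is
-- empty, an empty entry turns into the cycle (x), and the total in `size` is kept.
enlarge : ∀ {A x} u {C k} → Unique (x ∷ u ++ concat C) → Cofactor A (u ∷ C) k → Cofactor A ((x ∷ u) ∷ C) k
enlarge {A} {x} u {C} un (cofactor B size let-B ne fac) with initLast u
... | [] = cofactor ((x ∷ []) ∷ B) (trans (sym (ℕ.+-suc (length B) (empties C))) size)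
             (↭-prep x let-B) ((λ ()) ∷ ne) fac
... | v ∷ʳ′ y with insertAfter B y x (∈-resp-↭ (↭-sym let-B) (∈-++⁺ˡ (∈-++⁺ʳ v (here refl))))
                     (Unique-resp-↭ (↭-prep x (↭-sym let-B)) un)
...   | B′ , len , ↭₁ , ne′ , eq = cofactor B′
          (trans (cong₂ ℕ._+_ len (sym (empties-snoc v y [] C))) size)
          (↭-trans ↭₁ (↭-prep x let-B)) (ne′ ne) fac′
  where
  open ≡-Reasoning
  x∉C : x ∉ concat C
  x∉C = Unique-head un ∘ ∈-++⁺ʳ (v ++ y ∷ [])
  y∉C : y ∉ concat C
  y∉C = Unique-disjoint (v ++ y ∷ []) (AP.tail un) (∈-++⁺ʳ v (here refl))
  fac′ : ∀ z → perm A (perm B′ z) ≡ perm ((x ∷ v ++ y ∷ []) ∷ C) z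
  fac′ z = begin
    perm A (perm B′ z)                                   ≡⟨ cong (perm A) (eq z) ⟩
    perm A (perm B (transpose y x z))                    ≡⟨ fac _ ⟩
    cycle (v ++ y ∷ []) (perm C (transpose y x z))
      ≡⟨ cong (cycle (v ++ y ∷ [])) (transpose-commute y x (perm C) (perm-injective C) (perm-∉ C y∉C) (perm-∉ C x∉C) z) ⟩
    cycle (v ++ y ∷ []) (transpose y x (perm C z))       ≡⟨ cycle-snoc v y x _ ⟨
    cycle (v ++ y ∷ x ∷ []) (perm C z)                   ≡⟨ cong (λ t → cycle t (perm C z)) (++-assoc v (y ∷ []) (x ∷ [])) ⟨
    cycle ((v ++ y ∷ []) ++ x ∷ []) (perm C z)           ≡⟨ cycle-rotate₁ x (v ++ y ∷ []) (Unique-++ˡ (x ∷ v ++ y ∷ []) un) _ ⟨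
    cycle (x ∷ v ++ y ∷ []) (perm C z)                   ∎

cut-letters : ∀ u₁ i u₂ (C : Cycles) → (u₁ ++ i ∷ u₂) ++ concat C ↭ i ∷ u₂ ++ u₁ ++ concat C
cut-letters u₁ i u₂ C = ↭-trans (↭-reflexive (++-assoc u₁ (i ∷ u₂) (concat C))) (shifts u₁ (i ∷ u₂))

join-letters : ∀ u C₁ v₁ i v₂ C₂ →
  u ++ concat (C₁ ++ (v₁ ++ i ∷ v₂) ∷ C₂) ↭ i ∷ (v₂ ++ v₁ ++ u) ++ concat (C₁ ++ C₂)
join-letters u C₁ v₁ i v₂ C₂ = ↭-trans (++⁺ˡ u (concat-↭ (shift (v₁ ++ i ∷ v₂) C₁ C₂)))
  (↭-trans (shifts u (v₁ ++ i ∷ v₂)) (↭-trans (↭-reflexive (++-assoc v₁ (i ∷ v₂) _))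
    (↭-trans (shifts v₁ (i ∷ v₂)) (↭-reflexive (cong (i ∷_)
      (trans (cong (v₂ ++_) (sym (++-assoc v₁ u K))) (sym (++-assoc v₂ (v₁ ++ u) K))))))))
  where K = concat (C₁ ++ C₂)

extendHead : ∀ {x c A} → All NonEmpty (c ∷ A) → All NonEmpty ((x ∷ c) ∷ A)
extendHead (_ ∷ ne) = (λ ()) ∷ ne

mutual
  HD-valid : ∀ {C A nb jn} → HD C A nb jn → Unique (concat C) → Valid A C nb jn
  HD-valid nil un = valid ↭-refl [] refl (cofactor [] refl ↭-refl [] (λ _ → refl))
  HD-valid {[] ∷ C} (empty h) un with HD-valid h un
  ... | valid l ne eu (cofactor B size lB neB fac) =
    valid l ne (trans (cong suc eu) (sym (ℕ.+-suc _ _)))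
      (cofactor B (trans (ℕ.+-suc _ _) (cong suc size)) lB neB fac)
  HD-valid (root f) un = FD-valid f un

  FD-valid : ∀ {x u C w A nb jn} → FD x u C w A nb jn → Unique (x ∷ u ++ concat C) →
             Valid ((x ∷ w) ∷ A) ((x ∷ u) ∷ C) nb jn
  FD-valid {x} {u} {C} {[]} {A} {nb} {jn} (close h) un with HD-valid h (AP.tail un)
  ... | valid l ne eu cof = valid (↭-prep x l) ((λ ()) ∷ ne)
    (trans (solve 3 (λ a b c → a :+ (con 1 :+ b) :+ c := con 1 :+ (a :+ b :+ c)) refl nb (length A) (2 ℕ.* jn)) (cong suc eu))
    (enlarge {A = (x ∷ []) ∷ A} u un (record { Cofactor cof }))
    where open +-*-Solver
  FD-valid {x} {_} {C} {i ∷ w} {A} {nb} {jn} (cut u₁ {u₂ = u₂} f) un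
    with FD-valid f un′ | Unique-resp-↭ (↭-prep x (cut-letters u₁ i u₂ C)) un
    where un′ = AP.tail (Unique-resp-↭ (↭-prep x (cut-letters u₁ i u₂ C)) un)
  ... | valid l ne eu (cofactor B size lB neB fac) | un₁ with
    enlarge {A = (i ∷ w) ∷ A} {x = x} u₁ {(i ∷ u₂) ∷ C}
      (Unique-resp-↭ (↭-prep x (shifts (i ∷ u₂) u₁)) un₁)
      (cofactor B (trans (cong (length B ℕ.+_) (em u₁)) size) (↭-trans lB (shifts (i ∷ u₂) u₁)) neB
        (λ z → trans (fac z) (perm-↭ (↭-swap (i ∷ u₂) u₁ (↭-refl {x = C})) (AP.tail un₁) z)))
    where em : ∀ u₁ → empties (u₁ ∷ (i ∷ u₂) ∷ C) ≡ empties (u₁ ∷ C)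
          em []      = refl
          em (_ ∷ _) = refl
  ...   | cofactor B′ size′ lB′ neB′ fac′ =
    valid (↭-trans (↭-prep x l) (↭-prep x (↭-sym (cut-letters u₁ i u₂ C))))
      (extendHead ne)
      (trans eu (trans (cong (ℕ._+ (2 ℕ.+ length C)) (↭-length (↭-sym (cut-letters u₁ i u₂ C)))) (ℕ.+-suc _ _)))
      (cofactor B′ size′
        (↭-trans lB′ (↭-prep x (↭-reflexive (sym (++-assoc u₁ (i ∷ u₂) (concat C))))))
        neB′
        (λ z → trans (cong (transpose x i) (fac′ z))
          (sym (cycle-split x u₁ i u₂ (Unique-++ˡ (x ∷ u₁ ++ i ∷ u₂) un) (perm C z)))))
  FD-valid {x} {u} {_} {i ∷ w} {A} {nb} (join C₁ {C₂} v₁ {v₂ = v₂} {jn = jn} f) un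
    with FD-valid f un′ | Unique-resp-↭ (↭-prep x (join-letters u C₁ v₁ i v₂ C₂)) un
    where un′ = AP.tail (Unique-resp-↭ (↭-prep x (join-letters u C₁ v₁ i v₂ C₂)) un)
  ... | valid l ne eu (cofactor B size lB neB fac) | un₁ =
    valid (↭-trans (↭-prep x l) (↭-prep x (↭-sym (join-letters u C₁ v₁ i v₂ C₂))))
      (extendHead ne)
      (trans (solve 3 (λ a b j → a :+ b :+ con 2 :* (con 1 :+ j) := con 2 :+ (a :+ b :+ con 2 :* j)) refl nb (suc (length A)) jn)
        (trans (cong (2 ℕ.+_) eu)
          (trans (cong (λ p → 2 ℕ.+ (p ℕ.+ suc (length (C₁ ++ C₂)))) (↭-length (↭-sym (join-letters u C₁ v₁ i v₂ C₂))))
            (trans (solve 2 (λ a b → con 2 :+ (a :+ (con 1 :+ b)) := (con 1 :+ a) :+ (con 1 :+ (con 1 :+ b))) refl (length (u ++ concat (C₁ ++ v ∷ C₂))) _)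
              (cong (λ q → suc (length (u ++ concat (C₁ ++ v ∷ C₂))) ℕ.+ suc q) (↭-length (↭-sym (shift v C₁ C₂))))))))
      cof′
    where
    open +-*-Solver
    v = v₁ ++ i ∷ v₂
    K = concat (C₁ ++ C₂)
    un₂ : Unique (x ∷ (u ++ i ∷ v₂ ++ v₁) ++ K)
    un₂ = Unique-resp-↭ (↭-prep x (++⁺ʳ K
      (↭-trans (↭-reflexive (cong (i ∷_) (sym (++-assoc v₂ v₁ u)))) (++-comm (i ∷ v₂ ++ v₁) u)))) un₁
    rot : ∀ t → cycle (i ∷ v₂ ++ v₁ ++ u) t ≡ cycle (u ++ i ∷ v₂ ++ v₁) t
    rot t = trans (cong (λ s → cycle (i ∷ s) t) (sym (++-assoc v₂ v₁ u)))
      (sym (cycle-rotate u (i ∷ v₂ ++ v₁) (Unique-++ˡ (u ++ i ∷ v₂ ++ v₁) (AP.tail un₂)) t))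
    cof₂ : Cofactor ((i ∷ w) ∷ A) ((u ++ i ∷ v₂ ++ v₁) ∷ C₁ ++ C₂) nb
    cof₂ = cofactor B (trans (cong (length B ℕ.+_) (empties-snoc u i (v₂ ++ v₁) (C₁ ++ C₂))) size)
      (↭-trans lB (++⁺ʳ K (↭-trans (↭-reflexive (cong (i ∷_) (sym (++-assoc v₂ v₁ u)))) (++-comm (i ∷ v₂ ++ v₁) u))))
      neB (λ z → trans (fac z) (rot (perm (C₁ ++ C₂) z)))
    cof₃ : Cofactor ((i ∷ w) ∷ A) ((x ∷ u ++ i ∷ v₂ ++ v₁) ∷ C₁ ++ C₂) nb
    cof₃ = enlarge {A = (i ∷ w) ∷ A} (u ++ i ∷ v₂ ++ v₁) un₂ cof₂
    open ≡-Reasoning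
    em : empties (C₁ ++ v ∷ C₂) ≡ empties (C₁ ++ C₂)
    em = trans (empties-++ C₁) (trans (cong (empties C₁ ℕ.+_) (empties-snoc v₁ i v₂ C₂)) (sym (empties-++ C₁)))
    move : (u ++ i ∷ v₂ ++ v₁) ++ K ↭ u ++ concat (C₁ ++ v ∷ C₂)
    move = ↭-trans (++⁺ʳ K (++-comm u (i ∷ v₂ ++ v₁)))
      (↭-trans (↭-reflexive (cong (λ s → i ∷ s ++ K) (++-assoc v₂ v₁ u))) (↭-sym (join-letters u C₁ v₁ i v₂ C₂)))
    un₃ : Unique ((x ∷ u) ++ v ++ K)
    un₃ = Unique-resp-↭ (↭-prep x (++⁺ˡ u (concat-↭ (shift v C₁ C₂)))) un
    cof′ : Cofactor ((x ∷ i ∷ w) ∷ A) ((x ∷ u) ∷ C₁ ++ v ∷ C₂) nb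
    cof′ = cofactor (Cofactor.B cof₃) (trans (cong (length (Cofactor.B cof₃) ℕ.+_) em) (Cofactor.size cof₃))
      (↭-trans (Cofactor.letters cof₃) (↭-prep x move)) (Cofactor.nonEmpty cof₃) fac₃
      where
      -- The join is undone: x has been put back into the merged cycle, and the transposition of x
      -- and i now cuts that cycle into the two original ones.
      fac₃ : ∀ z → perm ((x ∷ i ∷ w) ∷ A) (perm (Cofactor.B cof₃) z) ≡ perm ((x ∷ u) ∷ C₁ ++ v ∷ C₂) z
      fac₃ z = begin
        transpose x i (perm ((i ∷ w) ∷ A) (perm (Cofactor.B cof₃) z))
          ≡⟨ cong (transpose x i) (Cofactor.factors cof₃ z) ⟩
        transpose x i (cycle (x ∷ u ++ i ∷ v₂ ++ v₁) t)
          ≡⟨ cong (transpose x i) (cycle-split x u i (v₂ ++ v₁) (Unique-++ˡ (x ∷ u ++ i ∷ v₂ ++ v₁) un₂) t) ⟩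
        transpose x i (transpose x i (cycle (x ∷ u) (cycle (i ∷ v₂ ++ v₁) t)))
          ≡⟨ transpose-involutive x i _ ⟩
        cycle (x ∷ u) (cycle (i ∷ v₂ ++ v₁) t)
          ≡⟨ cong (cycle (x ∷ u)) (cycle-rotate v₁ (i ∷ v₂) (Unique-++ˡ v (Unique-++ʳ (x ∷ u) un₃)) t) ⟨
        cycle (x ∷ u) (cycle v t)
          ≡⟨ perm-↭ (↭-prep (x ∷ u) (shift v C₁ C₂)) un z ⟨
        perm ((x ∷ u) ∷ C₁ ++ v ∷ C₂) z ∎
        where t = perm (C₁ ++ C₂) z

-- Every bijection of the letters has a peeling.

record BijectiveOn (S : List ℕ) (f : ℕ → ℕ) : Set where
  constructor bijectiveOn
  field
    closed    : ∀ {z} → z ∈ S → f z ∈ S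
    injective : ∀ {a b} → a ∈ S → b ∈ S → f a ≡ f b → a ≡ b

BijectiveOn-↭ : ∀ {S S′ f} → S ↭ S′ → BijectiveOn S f → BijectiveOn S′ f
BijectiveOn-↭ p (bijectiveOn c i) = bijectiveOn
  (λ z → ∈-resp-↭ p (c (∈-resp-↭ (↭-sym p) z)))
  (λ a b → i (∈-resp-↭ (↭-sym p) a) (∈-resp-↭ (↭-sym p) b))

-- After composition with the transposition of x and f x the point x is fixed, so what remains is a
-- bijection of the other letters.
delete : ∀ {x S f} → x ∉ S → BijectiveOn (x ∷ S) f → BijectiveOn S (transpose x (f x) ∘ f)
delete {x} {S} {f} x∉ (bijectiveOn c i) = bijectiveOn c′ (λ a b e → i (there a) (there b) (transpose-injective x (f x) e))
  where
  c′ : ∀ {z} → z ∈ S → transpose x (f x) (f z) ∈ S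
  c′ {z} z∈ with transpose-∈ (here refl) (c (here refl)) (c (there z∈))
  ... | there p = p
  ... | here e = ⊥-elim (x∉ (subst (_∈ S) (i (there z∈) (here refl)
          (trans (sym (transpose-involutive x (f x) (f z))) (trans (cong (transpose x (f x)) e) (transpose-left x (f x))))) z∈))

restore : ∀ {x S} (f g : ℕ → ℕ) → g x ≡ x → (∀ {z} → z ∈ S → g z ≡ transpose x (f x) (f z)) →
          ∀ {z} → z ∈ x ∷ S → transpose x (f x) (g z) ≡ f z
restore {x} f g gx h (here refl) = trans (cong (transpose x (f x)) gx) (transpose-left x (f x))
restore {x} f g gx h (there z∈)  = trans (cong (transpose x (f x)) (h z∈)) (transpose-involutive x (f x) _)

mutual
  -- The image of the root dictates the move: `close` if it is fixed, `cut` if the image lies on its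
  -- own cycle of C, `join` otherwise. The number n of letters serves as measure, because the
  -- rearranged lists are not subterms.
  HD-complete : ∀ n C f → length (concat C) ≡ n → Unique (concat C) → BijectiveOn (concat C) f →
    ∃[ A ] ∃[ nb ] ∃[ jn ] HD C A nb jn × (∀ {z} → z ∈ concat C → perm A z ≡ f z)
  HD-complete n []             f len un bij = [] , 0 , 0 , nil , λ ()
  HD-complete n ([] ∷ C)       f len un bij with HD-complete n C f len un bij
  ... | A , nb , jn , h , eq = A , suc nb , jn , empty h , eq
  HD-complete (suc n) ((x ∷ u) ∷ C) f len un bij with FD-complete n x u C f (ℕ.suc-injective len) un bij
  ... | w , A , nb , jn , h , eq = (x ∷ w) ∷ A , nb , jn , root h , eq

  FD-complete : ∀ n x u C f → length (u ++ concat C) ≡ n → Unique (x ∷ u ++ concat C) → BijectiveOn (x ∷ u ++ concat C) f →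
    ∃[ w ] ∃[ A ] ∃[ nb ] ∃[ jn ] FD x u C w A nb jn × (∀ {z} → z ∈ x ∷ u ++ concat C → perm ((x ∷ w) ∷ A) z ≡ f z)
  FD-complete n x u C f len un bij with BijectiveOn.closed bij (here refl)
  ... | here fx≡x with HD-complete n (u ∷ C) (transpose x (f x) ∘ f) len (AP.tail un) (delete (Unique-head un) bij)
  ...   | A , nb , jn , h , eq = [] , A , nb , jn , close h ,
          λ {z} z∈ → trans (sym (transpose-same x _)) (trans (cong (λ t → transpose x t (perm A z)) (sym fx≡x)) (ext z∈))
    where ext : ∀ {z} → z ∈ x ∷ u ++ concat C → transpose x (f x) (perm A z) ≡ f z
          ext = restore f (perm A) (perm-∉ A (λ q → Unique-head un (∈-resp-↭ (Valid.letters (HD-valid h (AP.tail un))) q))) eq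
  FD-complete n x u C f len un bij | there i∈ with ∈-++⁻ u i∈
  FD-complete n x u C f len un bij | there i∈ | inj₁ i∈u with ∈-∃++ i∈u
  FD-complete zero x _ C f len un bij | there i∈ | inj₁ i∈u | u₁ , u₂ , refl
    with () ← trans (sym len) (↭-length (cut-letters u₁ (f x) u₂ C))
  FD-complete (suc n) x _ C f len un bij | there i∈ | inj₁ i∈u | u₁ , u₂ , refl
    with FD-complete n (f x) u₂ (u₁ ∷ C) (transpose x (f x) ∘ f)
           (ℕ.suc-injective (trans (sym (↭-length p)) len)) (Unique-resp-↭ p (AP.tail un)) (BijectiveOn-↭ p (delete (Unique-head un) bij))
    where p = cut-letters u₁ (f x) u₂ C
  ... | w , A , nb , jn , h , eq = f x ∷ w , A , nb , jn , cut u₁ h ,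
    restore f (perm ((f x ∷ w) ∷ A))
      (perm-∉ ((f x ∷ w) ∷ A) (λ q → Unique-head un (∈-resp-↭ (↭-trans (Valid.letters (FD-valid h (Unique-resp-↭ p (AP.tail un)))) (↭-sym p)) q)))
      (λ z∈ → eq (∈-resp-↭ p z∈))
    where p = cut-letters u₁ (f x) u₂ C
  FD-complete n x u C f len un bij | there i∈ | inj₂ i∈C with ∈-concat⁻′ C i∈C
  ... | v , i∈v , v∈C with ∈-∃++ i∈v | ∈-∃++ v∈C
  FD-complete zero x u _ f len un bij | there i∈ | inj₂ i∈C | _ , i∈v , v∈C | v₁ , v₂ , refl | C₁ , C₂ , refl
    with () ← trans (sym len) (↭-length (join-letters u C₁ v₁ (f x) v₂ C₂))
  FD-complete (suc n) x u _ f len un bij | there i∈ | inj₂ i∈C | _ , i∈v , v∈C | v₁ , v₂ , refl | C₁ , C₂ , refl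
    with FD-complete n (f x) (v₂ ++ v₁ ++ u) (C₁ ++ C₂) (transpose x (f x) ∘ f)
           (ℕ.suc-injective (trans (sym (↭-length p)) len)) (Unique-resp-↭ p (AP.tail un)) (BijectiveOn-↭ p (delete (Unique-head un) bij))
    where p = join-letters u C₁ v₁ (f x) v₂ C₂
  ... | w , A , nb , jn , h , eq = f x ∷ w , A , nb , suc jn , join C₁ v₁ h ,
    restore f (perm ((f x ∷ w) ∷ A))
      (perm-∉ ((f x ∷ w) ∷ A) (λ q → Unique-head un (∈-resp-↭ (↭-trans (Valid.letters (FD-valid h (Unique-resp-↭ p (AP.tail un)))) (↭-sym p)) q)))
      (λ z∈ → eq (∈-resp-↭ p z∈))
    where p = join-letters u C₁ v₁ (f x) v₂ C₂

-- Listing all peelings.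

splits : List ℕ → List (List ℕ × ℕ × List ℕ)
splits []      = []
splits (i ∷ u) = ([] , i , u) ∷ map (λ (u₁ , j , u₂) → i ∷ u₁ , j , u₂) (splits u)

picks : Cycles → List (List ℕ × Cycles)
picks []      = []
picks (v ∷ C) = (v , C) ∷ map (λ (v′ , C′) → v′ , v ∷ C′) (picks C)

HOut FOut : Set
HOut = Cycles × ℕ × ℕ
FOut = List ℕ × Cycles × ℕ × ℕ

closing : HOut → FOut
closing (A , nb , jn) = [] , A , nb , jn

cutting joining : ℕ → FOut → FOut
cutting i (w , A , nb , jn) = i ∷ w , A , nb , jn
joining i (w , A , nb , jn) = i ∷ w , A , nb , suc jn

rooting : ℕ → FOut → HOut
rooting x (w , A , nb , jn) = (x ∷ w) ∷ A , nb , jn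

emptying : HOut → HOut
emptying (A , nb , jn) = A , suc nb , jn

-- The first argument is fuel: it is meant to be the number of letters occurring in the other arguments.
mutual
  enumH : ℕ → Cycles → List HOut
  enumH n       []            = ([] , 0 , 0) ∷ []
  enumH n       ([] ∷ C)      = map emptying (enumH n C)
  enumH zero    ((x ∷ u) ∷ C) = []
  enumH (suc n) ((x ∷ u) ∷ C) = map (rooting x) (enumF n x u C)

  enumF : ℕ → ℕ → List ℕ → Cycles → List FOut
  enumF n x u C = concatMap proj₂ (branches n x u C)

  -- Every branch carries the image of the root as a key; by these keys the branches are told apart
  -- later.
  branches : ℕ → ℕ → List ℕ → Cycles → List (ℕ × List FOut)
  branches n x u C = (x , map closing (enumH n (u ∷ C))) ∷ cuts n u C ++ joins n u C (picks C)

  cuts : ℕ → List ℕ → Cycles → List (ℕ × List FOut)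
  cuts zero    u C = []
  cuts (suc n) u C = map (λ (u₁ , i , u₂) → i , map (cutting i) (enumF n i u₂ (u₁ ∷ C))) (splits u)

  joins : ℕ → List ℕ → Cycles → List (List ℕ × Cycles) → List (ℕ × List FOut)
  joins zero    u C ps = []
  joins (suc n) u C ps = concatMap (λ (v , C′) →
    map (λ (v₁ , i , v₂) → i , map (joining i) (enumF n i (v₂ ++ v₁ ++ u) C′)) (splits v)) ps

splits-sound : ∀ u {u₁ i u₂} → (u₁ , i , u₂) ∈ splits u → u ≡ u₁ ++ i ∷ u₂
splits-sound (i ∷ u) (here refl) = refl
splits-sound (i ∷ u) (there p) with ∈-map⁻ _ p
... | _ , q , refl = cong (i ∷_) (splits-sound u q)

splits-complete : ∀ u₁ i u₂ → (u₁ , i , u₂) ∈ splits (u₁ ++ i ∷ u₂)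
splits-complete []       i u₂ = here refl
splits-complete (j ∷ u₁) i u₂ = there (∈-map⁺ _ (splits-complete u₁ i u₂))

picks-sound : ∀ C {v C′} → (v , C′) ∈ picks C → ∃[ C₁ ] ∃[ C₂ ] C ≡ C₁ ++ v ∷ C₂ × C′ ≡ C₁ ++ C₂
picks-sound (v ∷ C) (here refl) = [] , C , refl , refl
picks-sound (v ∷ C) (there p) with ∈-map⁻ _ p
... | _ , q , refl with picks-sound C q
...   | C₁ , C₂ , refl , refl = v ∷ C₁ , C₂ , refl , refl

picks-complete : ∀ C₁ v C₂ → (v , C₁ ++ C₂) ∈ picks (C₁ ++ v ∷ C₂)
picks-complete []       v C₂ = here refl
picks-complete (c ∷ C₁) v C₂ = there (∈-map⁺ _ (picks-complete C₁ v C₂))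

splits-keys : ∀ u → map (λ (_ , i , _) → i) (splits u) ≡ u
splits-keys []      = refl
splits-keys (i ∷ u) = cong (i ∷_) (trans (sym (map-∘ (splits u))) (splits-keys u))

HD′ : Cycles → HOut → Set
HD′ C (A , nb , jn) = HD C A nb jn

FD′ : ℕ → List ℕ → Cycles → FOut → Set
FD′ x u C (w , A , nb , jn) = FD x u C w A nb jn

mutual
  enumH-sound : ∀ n C {o} → o ∈ enumH n C → HD′ C o
  enumH-sound n [] (here refl) = nil
  enumH-sound n ([] ∷ C) p with ∈-map⁻ emptying p
  ... | _ , q , refl = empty (enumH-sound n C q)
  enumH-sound (suc n) ((x ∷ u) ∷ C) p with ∈-map⁻ (rooting x) p
  ... | _ , q , refl = root (enumF-sound n x u C q)

  enumF-sound : ∀ n x u C {o} → o ∈ enumF n x u C → FD′ x u C o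
  enumF-sound n x u C {o} p with find (∈-concatMap⁻ proj₂ {xs = branches n x u C} p)
  ... | _ , here refl , q with ∈-map⁻ closing q
  ...   | _ , r , refl = close (enumH-sound n (u ∷ C) r)
  enumF-sound n x u C {o} p | b , there b∈ , q with ∈-++⁻ (cuts n u C) b∈
  enumF-sound (suc n) x u C {o} p | b , there b∈ , q | inj₁ c∈ with ∈-map⁻ _ c∈
  ... | (u₁ , i , u₂) , s , refl with splits-sound u s | ∈-map⁻ (cutting i) q
  ...   | refl | _ , r , refl = cut u₁ (enumF-sound n i u₂ (u₁ ∷ C) r)
  enumF-sound (suc n) x u C {o} p | b , there b∈ , q | inj₂ j∈ with find (∈-concatMap⁻ _ {xs = picks C} j∈)
  ... | (v , C′) , pk , t with ∈-map⁻ _ t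
  ...   | (v₁ , i , v₂) , s , refl with splits-sound v s | picks-sound C pk | ∈-map⁻ (joining i) q
  ...     | refl | C₁ , C₂ , refl , refl | _ , r , refl = join C₁ v₁ (enumF-sound n i (v₂ ++ v₁ ++ u) (C₁ ++ C₂) r)

mutual
  enumH-complete : ∀ n {C A nb jn} → length (concat C) ≡ n → HD C A nb jn → (A , nb , jn) ∈ enumH n C
  enumH-complete n len nil       = here refl
  enumH-complete n len (empty h) = ∈-map⁺ emptying (enumH-complete n len h)
  enumH-complete (suc n) len (root {x} f) = ∈-map⁺ (rooting x) (enumF-complete n (ℕ.suc-injective len) f)

  enumF-complete : ∀ n {x u C w A nb jn} → length (u ++ concat C) ≡ n → FD x u C w A nb jn → (w , A , nb , jn) ∈ enumF n x u C
  enumF-complete n {x} {u} {C} len (close h) =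
    ∈-++⁺ˡ (∈-map⁺ closing (enumH-complete n len h))
  enumF-complete n {x} {_} {C} len (cut u₁ {i} {u₂} h) =
    viaBranch n x (u₁ ++ i ∷ u₂) C (go n (trans (sym (↭-length (cut-letters u₁ i u₂ C))) len))
    where
    go : ∀ n → suc (length (u₂ ++ u₁ ++ concat C)) ≡ n →
      ∃[ os ] ((i , os) ∈ cuts n (u₁ ++ i ∷ u₂) C ++ joins n (u₁ ++ i ∷ u₂) C (picks C) × _ ∈ os)
    go (suc n) refl = _ , ∈-++⁺ˡ (∈-map⁺ _ (splits-complete u₁ i u₂)) , ∈-map⁺ (cutting i) (enumF-complete n refl h)
  enumF-complete n {x} {u} len (join C₁ {C₂} v₁ {i} {v₂} h) =
    viaBranch n x u (C₁ ++ (v₁ ++ i ∷ v₂) ∷ C₂) (go n (trans (sym (↭-length (join-letters u C₁ v₁ i v₂ C₂))) len))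
    where
    go : ∀ n → suc (length ((v₂ ++ v₁ ++ u) ++ concat (C₁ ++ C₂))) ≡ n →
      ∃[ os ] ((i , os) ∈ cuts n u (C₁ ++ (v₁ ++ i ∷ v₂) ∷ C₂) ++
        joins n u (C₁ ++ (v₁ ++ i ∷ v₂) ∷ C₂) (picks (C₁ ++ (v₁ ++ i ∷ v₂) ∷ C₂)) × _ ∈ os)
    go (suc n) refl = _ , ∈-++⁺ʳ (cuts (suc n) u _) (∈-concatMap⁺ _ (lose (picks-complete C₁ (v₁ ++ i ∷ v₂) C₂) (∈-map⁺ _ (splits-complete v₁ i v₂)))) ,
      ∈-map⁺ (joining i) (enumF-complete n refl h)

  viaBranch : ∀ n x u C {i o} → ∃[ os ] ((i , os) ∈ cuts n u C ++ joins n u C (picks C) × o ∈ os) → o ∈ enumF n x u C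
  viaBranch n x u C (os , b , o) = ∈-concatMap⁺ proj₂ {xs = branches n x u C} (there (lose b o))

-- Distinct peelings give distinct permutations.

module Distinct (U : List ℕ) where

  -- Apartness at a point of U, not inequality of lists: different lists of cycles may represent the
  -- same permutation, and it is the words of images that have to differ.
  _#_ : Cycles → Cycles → Set
  A # A′ = ∃[ z ] (z ∈ U × perm A z ≢ perm A′ z)

  ofF : ℕ → FOut → Cycles
  ofF x (w , A , _) = (x ∷ w) ∷ A

  _#[_]_ : FOut → ℕ → FOut → Set
  o #[ x ] o′ = ofF x o # ofF x o′

  distinct-branches : ∀ {x} → x ∈ U → (bs : List (ℕ × List FOut)) → Unique (map proj₁ bs) →
    (∀ {b} → b ∈ bs → AllPairs _#[ x ]_ (proj₂ b) × (∀ {o} → o ∈ proj₂ b → perm (ofF x o) x ≡ proj₁ b)) →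
    AllPairs _#[ x ]_ (concatMap proj₂ bs)
  distinct-branches x∈ [] un h = []
  distinct-branches {x} x∈ (b ∷ bs) (p ∷ un) h = AP.++⁺ (proj₁ (h (here refl))) (distinct-branches x∈ bs un (h ∘ there))
    (All.tabulate (λ {o} o∈ → All.tabulate (λ {o′} o′∈ → x , x∈ , λ eq →
      let b′ , b′∈ , o′∈b′ = find (∈-concatMap⁻ proj₂ {xs = bs} o′∈) in
      All.lookup p (∈-map⁺ proj₁ b′∈)
        (trans (sym (proj₂ (h (here refl)) o∈)) (trans eq (proj₂ (h (there b′∈)) o′∈b′))))))

  picks-keys : ∀ C → concatMap proj₁ (picks C) ≡ concat C
  picks-keys []      = refl
  picks-keys (v ∷ C) = cong (v ++_) (trans (cong concat (sym (map-∘ (picks C)))) (picks-keys C))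

  joins-keys : ∀ n u C ps → map proj₁ (joins (suc n) u C ps) ≡ concatMap proj₁ ps
  joins-keys n u C []             = refl
  joins-keys n u C ((v , C′) ∷ ps) = trans (map-++ proj₁ (map _ (splits v)) _)
    (cong₂ _++_ (trans (sym (map-∘ (splits v))) (splits-keys v)) (joins-keys n u C ps))

  branches-keys : ∀ n x u C → Unique (x ∷ u ++ concat C) → Unique (map proj₁ (branches n x u C))
  branches-keys zero    x u C un = [] ∷ []
  branches-keys (suc n) x u C un = subst (λ t → Unique (x ∷ t))
    (sym (trans (map-++ proj₁ (cuts (suc n) u C) _)
      (cong₂ _++_ (trans (sym (map-∘ (splits u))) (splits-keys u)) (trans (joins-keys n u C (picks C)) (picks-keys C))))) un

  -- Both sides gain the same transposition in front, and it is injective.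
  push-distinct : ∀ {x i o o′} → o #[ i ] o′ → ∀ {jn jn′} →
    (let (w , A , nb , _) = o ; (w′ , A′ , nb′ , _) = o′ in (i ∷ w , A , nb , jn) #[ x ] (i ∷ w′ , A′ , nb′ , jn′))
  push-distinct {x} {i} (z , z∈ , ne) = z , z∈ , ne ∘ transpose-injective x i

  root-image : ∀ {x S i w A} → x ∉ S → concat ((i ∷ w) ∷ A) ↭ S → perm ((x ∷ i ∷ w) ∷ A) x ≡ i
  root-image {x} {S} {i} {w} {A} x∉ p = trans (cong (transpose x i) (perm-∉ ((i ∷ w) ∷ A) (x∉ ∘ ∈-resp-↭ p))) (transpose-left x i)

  mutual
    enumH-distinct : ∀ n C → Unique (concat C) → (∀ {z} → z ∈ concat C → z ∈ U) → AllPairs (λ o o′ → proj₁ o # proj₁ o′) (enumH n C)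
    enumH-distinct n       []            un sub = [] ∷ []
    enumH-distinct n       ([] ∷ C)      un sub = AP.map⁺ (enumH-distinct n C un sub)
    enumH-distinct zero    ((x ∷ u) ∷ C) un sub = []
    enumH-distinct (suc n) ((x ∷ u) ∷ C) un sub = AP.map⁺ (enumF-distinct n x u C un sub)

    enumF-distinct : ∀ n x u C → Unique (x ∷ u ++ concat C) → (∀ {z} → z ∈ x ∷ u ++ concat C → z ∈ U) → AllPairs _#[ x ]_ (enumF n x u C)
    enumF-distinct n x u C un sub = distinct-branches (sub (here refl)) (branches n x u C) (branches-keys n x u C un) h
      where
      h : ∀ {b} → b ∈ branches n x u C → AllPairs _#[ x ]_ (proj₂ b) × (∀ {o} → o ∈ proj₂ b → perm (ofF x o) x ≡ proj₁ b)
      h (here refl) = AP.map⁺ (enumH-distinct n (u ∷ C) (AP.tail un) (sub ∘ there)) , img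
        where
        img : ∀ {o} → o ∈ map closing (enumH n (u ∷ C)) → perm (ofF x o) x ≡ x
        img o∈ with ∈-map⁻ closing o∈
        ... | (A , _) , q , refl = perm-∉ A (Unique-head un ∘ ∈-resp-↭ (Valid.letters (HD-valid (enumH-sound n (u ∷ C) q) (AP.tail un))))
      h (there b∈) with ∈-++⁻ (cuts n u C) b∈
      h (there b∈) | inj₁ c∈ = hc n c∈
        where
        hc : ∀ n {b} → b ∈ cuts n u C → AllPairs _#[ x ]_ (proj₂ b) × (∀ {o} → o ∈ proj₂ b → perm (ofF x o) x ≡ proj₁ b)
        hc (suc n) c∈ with ∈-map⁻ _ c∈
        ... | (u₁ , i , u₂) , s , refl with splits-sound u s
        ...   | refl = AP.map⁺ (AP.map (λ {o} {o′} d → push-distinct {o = o} {o′} d {0} {0}) (enumF-distinct n i u₂ (u₁ ∷ C) un′ (sub ∘ there ∘ ∈-resp-↭ (↭-sym p)))) , img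
          where
          p = cut-letters u₁ i u₂ C
          un′ = Unique-resp-↭ p (AP.tail un)
          img : ∀ {o} → o ∈ map (cutting i) (enumF n i u₂ (u₁ ∷ C)) → perm (ofF x o) x ≡ i
          img o∈ with ∈-map⁻ (cutting i) o∈
          ... | (w , A , _) , q , refl = root-image {w = w} {A = A} (Unique-head un) (↭-trans (Valid.letters (FD-valid (enumF-sound n i u₂ (u₁ ∷ C) q) un′)) (↭-sym p))
      h (there b∈) | inj₂ j∈ = hj n j∈
        where
        hj : ∀ n {b} → b ∈ joins n u C (picks C) → AllPairs _#[ x ]_ (proj₂ b) × (∀ {o} → o ∈ proj₂ b → perm (ofF x o) x ≡ proj₁ b)
        hj (suc n) j∈ with find (∈-concatMap⁻ _ {xs = picks C} j∈)
        ... | (v , C′) , pk , t with ∈-map⁻ _ t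
        ...   | (v₁ , i , v₂) , s , refl with splits-sound v s | picks-sound C pk
        ...     | refl | C₁ , C₂ , refl , refl =
          AP.map⁺ (AP.map (λ {o} {o′} d → push-distinct {o = o} {o′} d {0} {0}) (enumF-distinct n i (v₂ ++ v₁ ++ u) (C₁ ++ C₂) un′ (sub ∘ there ∘ ∈-resp-↭ (↭-sym p)))) , img
          where
          p = join-letters u C₁ v₁ i v₂ C₂
          un′ = Unique-resp-↭ p (AP.tail un)
          img : ∀ {o} → o ∈ map (joining i) (enumF n i (v₂ ++ v₁ ++ u) (C₁ ++ C₂)) → perm (ofF x o) x ≡ i
          img o∈ with ∈-map⁻ (joining i) o∈
          ... | (w , A , _) , q , refl = root-image {w = w} {A = A} (Unique-head un) (↭-trans (Valid.letters (FD-valid (enumF-sound n i (v₂ ++ v₁ ++ u) (C₁ ++ C₂) q) un′)) (↭-sym p))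

-- Boolean tests on lists.

T-all : {A : Set} (p : A → Bool) (xs : List A) → T (all p xs) → ∀ {x} → x ∈ xs → T (p x)
T-all p (x ∷ xs) h (here refl) = proj₁ (Equivalence.to T-∧ h)
T-all p (x ∷ xs) h (there x∈)  = T-all p xs (proj₂ (Equivalence.to (T-∧ {p x}) h)) x∈

all-T : {A : Set} (p : A → Bool) (xs : List A) → (∀ {x} → x ∈ xs → T (p x)) → T (all p xs)
all-T p []       h = tt
all-T p (x ∷ xs) h = Equivalence.from T-∧ (h (here refl) , all-T p xs (h ∘ there))

T-any : {A : Set} (p : A → Bool) (xs : List A) → T (any p xs) → ∃[ x ] (x ∈ xs × T (p x))
T-any p (x ∷ xs) h with Equivalence.to (T-∨ {p x}) h
... | inj₁ q = x , here refl , q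
... | inj₂ q with T-any p xs q
...   | y , y∈ , r = y , there y∈ , r

any-T : {A : Set} (p : A → Bool) {xs : List A} {x : A} → x ∈ xs → T (p x) → T (any p xs)
any-T p (here refl) h = Equivalence.from T-∨ (inj₁ h)
any-T p {y ∷ _} (there x∈) h = Equivalence.from (T-∨ {p y}) (inj₂ (any-T p x∈ h))

T-ext : ∀ {a b} → (T a → T b) → (T b → T a) → a ≡ b
T-ext {false} {false} f g = refl
T-ext {false} {true}  f g = ⊥-elim (g tt)
T-ext {true}  {false} f g = ⊥-elim (f tt)
T-ext {true}  {true}  f g = refl

T-not : ∀ {a} → T (not a) → ¬ T a
T-not {false} _ ()

not-T : ∀ {a} → ¬ T a → T (not a)
not-T {false} _ = tt
not-T {true} h = h tt

T⇒≡ : ∀ {a} → T a → a ≡ true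
T⇒≡ {true} _ = refl

¬T⇒≡ : ∀ {a} → ¬ T a → a ≡ false
¬T⇒≡ {false} _ = refl
¬T⇒≡ {true} h = ⊥-elim (h tt)

unique-set-↭ : {A : Set} {xs ys : List A} → Unique xs → Unique ys → (∀ {x} → x ∈ xs → x ∈ ys) → (∀ {x} → x ∈ ys → x ∈ xs) → xs ↭ ys
unique-set-↭ u v f g = ∼bag⇒↭ (unique∧set⇒bag u v (mk⇔ f g))

-- Cycle lengths found by iteration agree with cycle notation.

cycle-next : ∀ p a b q → Unique (p ++ a ∷ b ∷ q) → cycle (p ++ a ∷ b ∷ q) a ≡ b
cycle-next p a b q un = trans (cycle-rotate p (a ∷ b ∷ q) un a)
  (trans (cong (transpose a b) (cycle-∉ (b ∷ q ++ p) (Unique-head (Unique-resp-↭ (++-comm p (a ∷ b ∷ q)) un)))) (transpose-left a b))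

iter-comm : ∀ (f : ℕ → ℕ) k i → iter f k (f i) ≡ f (iter f k i)
iter-comm f zero    i = refl
iter-comm f (suc k) i = cong f (iter-comm f k i)

iter-cong : ∀ {f g : ℕ → ℕ} {c i} → (∀ {z} → z ∈ c → f z ≡ g z) → (∀ {z} → z ∈ c → g z ∈ c) → i ∈ c →
            ∀ k → iter f k i ≡ iter g k i × iter g k i ∈ c
iter-cong h cl i∈ zero = refl , i∈
iter-cong {f} h cl i∈ (suc k) with iter-cong {f} h cl i∈ k
... | e , m = trans (cong f e) (h m) , cl m

-- The prefix p carries the induction: each step of the walk moves a letter from the suffix to the
-- prefix while the cycle stays the same list. The bound on k keeps the walk within the number of
-- iterations that `sameCycle` tests.
iter-walk : ∀ p a v {j} → Unique (p ++ a ∷ v) → j ∈ a ∷ v → ∃[ k ] (k ≤ length v × iter (cycle (p ++ a ∷ v)) k a ≡ j)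
iter-walk p a v       un (here refl) = 0 , z≤n , refl
iter-walk p a (b ∷ v) un (there j∈) with iter-walk (p ++ a ∷ []) b v (subst Unique (sym (++-assoc p (a ∷ []) (b ∷ v))) un) j∈
... | k , k≤ , e = suc k , s≤s k≤ , (begin
  f (iter f k a)  ≡⟨ iter-comm f k a ⟨
  iter f k (f a)  ≡⟨ cong (iter f k) (cycle-next p a b v un) ⟩
  iter f k b      ≡⟨ cong (λ t → iter (cycle t) k b) (++-assoc p (a ∷ []) (b ∷ v)) ⟨
  iter (cycle ((p ++ a ∷ []) ++ b ∷ v)) k b  ≡⟨ e ⟩
  _ ∎)
  where open ≡-Reasoning
        f = cycle (p ++ a ∷ b ∷ v)

iter-ext : ∀ {f g : ℕ → ℕ} → (∀ z → f z ≡ g z) → ∀ k i → iter f k i ≡ iter g k i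
iter-ext h zero    i = refl
iter-ext {f} h (suc k) i = trans (cong f (iter-ext h k i)) (h _)

iter-reach : ∀ c {i j} → Unique c → i ∈ c → j ∈ c → ∃[ k ] (k < length c × iter (cycle c) k i ≡ j)
iter-reach c {i} {j} un i∈ j∈ with ∈-∃++ i∈
... | u , v , refl with iter-walk [] i (v ++ u) (Unique-resp-↭ (++-comm u (i ∷ v)) un) (∈-resp-↭ (++-comm u (i ∷ v)) j∈)
...   | k , k≤ , e = k , subst (k <_) (↭-length (++-comm (i ∷ v) u)) (s≤s k≤) ,
        trans (iter-ext (cycle-rotate u (i ∷ v) un) k i) e

∈-cycles : ∀ {C : Cycles} {c z} → c ∈ C → z ∈ c → z ∈ concat C
∈-cycles {C} c∈ z∈ = ∈-concat⁺′ z∈ c∈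

perm-at : ∀ C {c z} → Unique (concat C) → c ∈ C → z ∈ c → perm C z ≡ cycle c z
perm-at C {c} {z} un c∈ z∈ with ∈-∃++ c∈
... | C₁ , C₂ , refl = trans (perm-↭ p un z) (cong (cycle c) (perm-∉ (C₁ ++ C₂) (Unique-disjoint c (Unique-resp-↭ (concat-↭ p) un) z∈)))
  where p = shift c C₁ C₂

Unique-cycle : ∀ {C c} → Unique (concat C) → c ∈ C → Unique c
Unique-cycle {C} {c} un c∈ with ∈-∃++ c∈
... | C₁ , C₂ , refl = Unique-++ˡ c (Unique-resp-↭ (concat-↭ (shift c C₁ C₂)) un)

least : List ℕ → ℕ
least []          = 0
least (x ∷ [])    = x
least (x ∷ y ∷ u) = x ⊓ least (y ∷ u)

least-∈ : ∀ c → NonEmpty c → least c ∈ c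
least-∈ []          ne = ⊥-elim (ne refl)
least-∈ (x ∷ [])    ne = here refl
least-∈ (x ∷ y ∷ u) ne = step (ℕ.⊓-sel x (least (y ∷ u))) (least-∈ (y ∷ u) λ ())
  where
  step : ∀ {a b v} → a ⊓ b ≡ a ⊎ a ⊓ b ≡ b → b ∈ v → a ⊓ b ∈ a ∷ v
  step (inj₁ e) _ = here e
  step (inj₂ e) p = there (subst (_∈ _) (sym e) p)

least-≤ : ∀ c {j} → j ∈ c → least c ≤ j
least-≤ (x ∷ [])    (here refl) = ℕ.≤-refl
least-≤ (x ∷ y ∷ u) (here refl) = ℕ.m⊓n≤m _ _
least-≤ (x ∷ y ∷ u) (there j∈)  = ℕ.≤-trans (ℕ.m⊓n≤n x _) (least-≤ (y ∷ u) j∈)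

Unique-map-least : ∀ C → Unique (concat C) → All NonEmpty C → Unique (map least C)
Unique-map-least [] un ne = []
Unique-map-least (c ∷ C) un (n ∷ ne) = All.tabulate (λ m∈ e → h (∈-map⁻ least m∈) e) ∷ Unique-map-least C (Unique-++ʳ c un) ne
  where
  h : ∀ {m} → ∃[ d ] (d ∈ C × m ≡ least d) → least c ≢ m
  h (d , d∈ , refl) e = Unique-disjoint c un (least-∈ c n) (∈-cycles d∈ (subst (_∈ d) (sym e) (least-∈ d (All.lookup ne d∈))))

module Represented (N : ℕ) (f : ℕ → ℕ) (C : Cycles) (letters : concat C ↭ upTo N) (ne : All NonEmpty C)
                   (rep : ∀ {z} → z < N → f z ≡ perm C z) where

  un : Unique (concat C)
  un = Unique-resp-↭ (↭-sym letters) (Unique.upTo⁺ N)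

  in-range : ∀ {c z} → c ∈ C → z ∈ c → z < N
  in-range c∈ z∈ = ∈-upTo⁻ (∈-resp-↭ letters (∈-cycles c∈ z∈))

  f-at : ∀ {c z} → c ∈ C → z ∈ c → f z ≡ cycle c z
  f-at c∈ z∈ = trans (rep (in-range c∈ z∈)) (perm-at C un c∈ z∈)

  block : ∀ {z} → z < N → ∃[ c ] (z ∈ c × c ∈ C)
  block z< = ∈-concat⁻′ C (∈-resp-↭ (↭-sym letters) (∈-upTo⁺ z<))

  length-≤ : ∀ {c} → c ∈ C → length c ≤ N
  length-≤ {c} c∈ with ∈-∃++ c∈
  ... | C₁ , C₂ , refl = subst (length c ≤_) (trans (sym (length-++ c)) (trans (↭-length (↭-trans (concat-↭ (↭-sym (shift c C₁ C₂))) letters)) (length-upTo N))) (ℕ.m≤m+n _ _)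

  same⁺ : ∀ {c i j} → c ∈ C → i ∈ c → j ∈ c → T (sameCycle N f i j)
  same⁺ {c} {i} {j} c∈ i∈ j∈ with iter-reach c (Unique-cycle un c∈) i∈ j∈
  ... | k , k< , e = any-T _ (∈-upTo⁺ (ℕ.<-≤-trans k< (length-≤ c∈)))
        (ℕ.≡⇒≡ᵇ _ _ (trans (proj₁ (iter-cong {f} (f-at c∈) (cycle-∈ c) i∈ k)) e))

  same⁻ : ∀ {c i j} → c ∈ C → i ∈ c → T (sameCycle N f i j) → j ∈ c
  same⁻ {c} {i} {j} c∈ i∈ t with T-any _ (upTo N) t
  ... | k , _ , e = subst (_∈ c) (ℕ.≡ᵇ⇒≡ _ _ e) (subst (_∈ c) (sym (proj₁ ic)) (proj₂ ic))
    where ic = iter-cong {f} (f-at c∈) (cycle-∈ c) i∈ k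

  -- A cycle passes the test only at its least letter, so one representative per cycle survives.
  minima : filterᵇ (cycleMin N f) (upTo N) ↭ map least C
  minima = unique-set-↭ (Unique.filter⁺ _ (Unique.upTo⁺ N)) (Unique-map-least C un ne) to from
    where
    to : ∀ {i} → i ∈ filterᵇ (cycleMin N f) (upTo N) → i ∈ map least C
    to {i} i∈ with ∈-filter⁻ (T? ∘ cycleMin N f) {xs = upTo N} i∈
    ... | i∈N , t with block (∈-upTo⁻ i∈N)
    ...   | c , i∈c , c∈ = subst (_∈ map least C) (ℕ.≤-antisym (least-≤ c i∈c) i≤) (∈-map⁺ least c∈)
      where
      l∈ = least-∈ c (All.lookup ne c∈)
      i≤ : i ≤ least c
      i≤ with Equivalence.to (T-∨ {not (sameCycle N f i (least c))}) (T-all _ (upTo N) t (∈-upTo⁺ (in-range c∈ l∈)))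
      ... | inj₁ ns = ⊥-elim (T-not ns (same⁺ c∈ i∈c l∈))
      ... | inj₂ le = ℕ.≤ᵇ⇒≤ _ _ le
    from : ∀ {i} → i ∈ map least C → i ∈ filterᵇ (cycleMin N f) (upTo N)
    from i∈ with ∈-map⁻ least i∈
    ... | c , c∈ , refl = ∈-filter⁺ (T? ∘ cycleMin N f) (∈-upTo⁺ (in-range c∈ l∈)) (all-T _ (upTo N) h)
      where
      l∈ = least-∈ c (All.lookup ne c∈)
      h : ∀ {j} → j ∈ upTo N → T (not (sameCycle N f (least c) j) ∨ (least c ≤ᵇ j))
      h {j} j∈ with T? (sameCycle N f (least c) j)
      ... | yes t = Equivalence.from (T-∨ {not (sameCycle N f (least c) j)}) (inj₂ (ℕ.≤⇒≤ᵇ (least-≤ c (same⁻ c∈ l∈ t))))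
      ... | no ¬t = Equivalence.from (T-∨ {not (sameCycle N f (least c) j)}) (inj₁ (not-T ¬t))

  cycleLengths-↭ : cycleLengths N f ↭ map length C
  cycleLengths-↭ = ↭-trans (map⁺ _ minima)
    (↭-reflexive (trans (sym (map-∘ C)) (map-cong-local (All.tabulate (λ {c} c∈ →
      ↭-length (unique-set-↭ (Unique.filter⁺ (T? ∘ sameCycle N f (least c)) (Unique.upTo⁺ N)) (Unique-cycle un c∈)
        (λ j∈ → same⁻ c∈ (least-∈ c (All.lookup ne c∈)) (proj₂ (∈-filter⁻ (T? ∘ sameCycle N f (least c)) {xs = upTo N} j∈)))
        (λ j∈ → ∈-filter⁺ (T? ∘ sameCycle N f (least c)) (∈-upTo⁺ (in-range c∈ j∈)) (same⁺ c∈ (least-∈ c (All.lookup ne c∈)) j∈))))))))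

  numCycles-≡ : numCycles N f ≡ length C
  numCycles-≡ = trans (↭-length cycleLengths-↭) (length-map length C)

-- Permutations as words of images.

Unique-prefixes : ∀ {f : ℕ → List (List ℕ)} ks → Unique ks → (∀ j → Unique (f j)) → Unique (concatMap (λ j → map (j ∷_) (f j)) ks)
Unique-prefixes [] un uf = []
Unique-prefixes {f} (j ∷ ks) (p ∷ un) uf = Unique.++⁺ (Unique.map⁺ ∷-injectiveʳ (uf j)) (Unique-prefixes ks un uf) disjoint
  where
  disjoint : ∀ {w} → ¬ (w ∈ map (j ∷_) (f j) × w ∈ concatMap (λ j → map (j ∷_) (f j)) ks)
  disjoint (a , b) with ∈-map⁻ (j ∷_) a | find (∈-concatMap⁻ (λ j → map (j ∷_) (f j)) {xs = ks} b)
  ... | _ , _ , refl | k , k∈ , b′ with ∈-map⁻ (k ∷_) b′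
  ...   | _ , _ , e = All.lookup p k∈ (∷-injectiveˡ e)

allWords-unique : ∀ k N → Unique (allWords k N)
allWords-unique zero    N = [] ∷ []
allWords-unique (suc k) N = Unique-prefixes (upTo N) (Unique.upTo⁺ N) (λ _ → allWords-unique k N)

allWords-sound : ∀ k N {w} → w ∈ allWords k N → length w ≡ k × All (_< N) w
allWords-sound zero    N (here refl) = refl , []
allWords-sound (suc k) N w∈ with find (∈-concatMap⁻ _ {xs = upTo N} w∈)
... | j , j∈ , w∈′ with ∈-map⁻ (j ∷_) w∈′
...   | w , w∈ , refl with allWords-sound k N w∈
...     | l , a = cong suc l , ∈-upTo⁻ j∈ ∷ a

allWords-complete : ∀ w N → All (_< N) w → w ∈ allWords (length w) N
allWords-complete []      N []      = here refl
allWords-complete (j ∷ w) N (j< ∷ a) = ∈-concatMap⁺ _ (lose (∈-upTo⁺ j<) (∈-map⁺ (j ∷_) (allWords-complete w N a)))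

at-applyUpTo : ∀ (f : ℕ → ℕ) n {z} → z < n → at (applyUpTo f n) z ≡ f z
at-applyUpTo f (suc n) {zero}  z<       = refl
at-applyUpTo f (suc n) {suc z} (s≤s z<) = at-applyUpTo (f ∘ suc) n z<

at-map : ∀ (f : ℕ → ℕ) xs {z} → z < length xs → at (map f xs) z ≡ f (at xs z)
at-map f (x ∷ xs) {zero}  z<       = refl
at-map f (x ∷ xs) {suc z} (s≤s z<) = at-map f xs z<

word : ℕ → (ℕ → ℕ) → List ℕ
word N f = map f (upTo N)

at-word : ∀ N f {z} → z < N → at (word N f) z ≡ f z
at-word N f {z} z< = trans (at-map f (upTo N) (subst (z <_) (sym (length-upTo N)) z<)) (cong f (at-applyUpTo id N z<))

at-∈ : ∀ w {z} → z < length w → at w z ∈ w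
at-∈ (x ∷ w) {zero}  z<       = here refl
at-∈ (x ∷ w) {suc z} (s≤s z<) = there (at-∈ w z<)

at-injective : ∀ w → Unique w → ∀ {a b} → a < length w → b < length w → at w a ≡ at w b → a ≡ b
at-injective (x ∷ w) un {zero}  {zero}  a< b< e = refl
at-injective (x ∷ w) un {zero}  {suc b} a< (s≤s b<) e = ⊥-elim (Unique-head un (subst (_∈ w) (sym e) (at-∈ w b<)))
at-injective (x ∷ w) un {suc a} {zero}  (s≤s a<) b< e = ⊥-elim (Unique-head un (subst (_∈ w) e (at-∈ w a<)))
at-injective (x ∷ w) (_ ∷ un) {suc a} {suc b} (s≤s a<) (s≤s b<) e = cong suc (at-injective w un a< b< e)

map-at : ∀ w → map (at w) (upTo (length w)) ≡ w
map-at w = go w (at w) (λ _ → refl)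
  where
  go : ∀ w (f : ℕ → ℕ) {g : ℕ → ℕ} → (∀ i → f (g i) ≡ at w i) → map f (applyUpTo g (length w)) ≡ w
  go []      f h = refl
  go (x ∷ w) f h = cong₂ _∷_ (h 0) (go w f (h ∘ suc))

-- `isBijection` tests only that every value is attained; counting turns this into the absence of
-- repetitions.
pigeonhole : ∀ (xs w : List ℕ) → Unique xs → (∀ {x} → x ∈ xs → x ∈ w) → length w ≤ length xs → xs ↭ w
pigeonhole [] [] un h le = ↭-refl
pigeonhole (x ∷ xs) w un h le with ∈-∃++ (h (here refl))
... | u , v , refl = ↭-trans (↭-prep x (pigeonhole xs (u ++ v) (AP.tail un) h′ (ℕ.≤-pred (subst (_≤ suc (length xs)) (↭-length (shift x u v)) le))))
                             (↭-sym (shift x u v))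
  where
  h′ : ∀ {y} → y ∈ xs → y ∈ u ++ v
  h′ y∈ with ∈-resp-↭ (shift x u v) (h (there y∈))
  ... | here refl = ⊥-elim (Unique-head un y∈)
  ... | there p = p

cycle-surjective : ∀ c j → ∃[ z ] cycle c z ≡ j
cycle-surjective []          j = j , refl
cycle-surjective (x ∷ [])    j = j , refl
cycle-surjective (x ∷ i ∷ w) j with cycle-surjective (i ∷ w) (transpose x i j)
... | z , e = z , trans (cong (transpose x i) e) (transpose-involutive x i j)

perm-surjective : ∀ C j → ∃[ z ] perm C z ≡ j
perm-surjective []      j = j , refl
perm-surjective (c ∷ C) j with cycle-surjective c j
... | y , e with perm-surjective C y
...   | z , e′ = z , trans (cong (cycle c) e′) e

perm-range : ∀ {C N} → concat C ↭ upTo N → ∀ {z} → z < N → perm C z < N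
perm-range {C} p z< = ∈-upTo⁻ (∈-resp-↭ p (perm-∈ C (∈-resp-↭ (↭-sym p) (∈-upTo⁺ z<))))

Perms-unique : ∀ N → Unique (Perms N)
Perms-unique N = Unique.filter⁺ (T? ∘ isBijection N) (allWords-unique N N)

Perms-bijective : ∀ N {w} → w ∈ Perms N → length w ≡ N × BijectiveOn (upTo N) (at w)
Perms-bijective N {w} w∈ with ∈-filter⁻ (T? ∘ isBijection N) {xs = allWords N N} w∈
... | w∈′ , t with allWords-sound N N w∈′
...   | refl , a = refl , bijectiveOn (λ z∈ → ∈-upTo⁺ (All.lookup a (at-∈ w (∈-upTo⁻ z∈))))
        (λ p q → at-injective w un (∈-upTo⁻ p) (∈-upTo⁻ q))
  where
  sub : ∀ {j} → j ∈ upTo (length w) → j ∈ w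
  sub {j} j∈ with T-any _ w (T-all _ (upTo (length w)) t j∈)
  ... | k , k∈ , e = subst (_∈ w) (sym (ℕ.≡ᵇ⇒≡ j k e)) k∈
  un : Unique w
  un = Unique-resp-↭ (pigeonhole (upTo (length w)) w (Unique.upTo⁺ _) sub (ℕ.≤-reflexive (sym (length-upTo (length w))))) (Unique.upTo⁺ _)

word-∈-Perms : ∀ N A → concat A ↭ upTo N → word N (perm A) ∈ Perms N
word-∈-Perms N A p = ∈-filter⁺ (T? ∘ isBijection N)
  (subst (λ k → word N (perm A) ∈ allWords k N) (trans (length-map (perm A) (upTo N)) (length-upTo N))
    (allWords-complete (word N (perm A)) N (All.map⁺ (All.tabulate (λ z∈ → perm-range {A} p (∈-upTo⁻ z∈))))))
  (all-T _ (upTo N) h)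
  where
  h : ∀ {j} → j ∈ upTo N → T (any (j ≡ᵇ_) (word N (perm A)))
  h {j} j∈ with perm-surjective A j
  ... | z , e = any-T (j ≡ᵇ_) (∈-map⁺ (perm A) z∈) (ℕ.≡⇒≡ᵇ j (perm A z) (sym e))
    where
    z∈ : z ∈ upTo N
    -- A point outside the range is fixed by `perm A`, so its image could not be j.
    z∈ with z ℕ.<? N
    ... | yes z< = ∈-upTo⁺ z<
    ... | no z≮ = ⊥-elim (z≮ (∈-upTo⁻ (subst (_∈ upTo N) (sym (trans (sym (perm-∉ A (λ q → z≮ (∈-upTo⁻ (∈-resp-↭ p q))))) e)) j∈)))

-- The bridge from a brute-force list to a recursion: a sum over all permutations becomes a sum over
-- the peelings of C, and C may be any list of cycles with these letters.
enumeration-↭ : ∀ N C → concat C ↭ upTo N → map (λ o → word N (perm (proj₁ o))) (enumH N C) ↭ Perms N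
enumeration-↭ N C p = unique-set-↭ un (Perms-unique N) to from
  where
  unC : Unique (concat C)
  unC = Unique-resp-↭ (↭-sym p) (Unique.upTo⁺ N)
  un : Unique (map (λ o → word N (perm (proj₁ o))) (enumH N C))
  un = AP.map⁺ (AP.map (λ { (z , z∈ , ne) e → ne (trans (sym (at-word N _ (∈-upTo⁻ z∈))) (trans (cong (λ w → at w z) e) (at-word N _ (∈-upTo⁻ z∈)))) })
         (Distinct.enumH-distinct (upTo N) N C unC (∈-resp-↭ p)))
  to : ∀ {w} → w ∈ map (λ o → word N (perm (proj₁ o))) (enumH N C) → w ∈ Perms N
  to w∈ with ∈-map⁻ _ w∈
  ... | (A , _) , o∈ , refl = word-∈-Perms N A (↭-trans (Valid.letters (HD-valid (enumH-sound N C o∈) unC)) p)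
  from : ∀ {w} → w ∈ Perms N → w ∈ map (λ o → word N (perm (proj₁ o))) (enumH N C)
  from {w} w∈ with Perms-bijective N w∈
  ... | refl , bij with HD-complete N C (at w) (trans (↭-length p) (length-upTo N)) unC (BijectiveOn-↭ (↭-sym p) bij)
  ...   | A , nb , jn , h , eq = subst (_∈ map (λ o → word N (perm (proj₁ o))) (enumH N C))
            (trans (map-cong-local (All.tabulate (λ z∈ → eq (∈-resp-↭ (↭-sym p) z∈)))) (map-at w))
            (∈-map⁺ (λ o → word N (perm (proj₁ o))) (enumH-complete N (trans (↭-length p) (length-upTo N)) h))

inverse-image : ∀ N (a : ℕ → ℕ) {i} → (∀ {y z} → y < N → z < N → a y ≡ a z → y ≡ z) → i < N → inverse N a (a i) ≡ i
inverse-image N a {i} inj i< with go (upTo N) (∈-upTo⁺ i<)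
  where
  go : ∀ xs → i ∈ xs → (let r = foldr (λ k r → if a k ≡ᵇ a i then k else r) 0 xs in r ∈ xs × a r ≡ a i)
  go (x ∷ xs) i∈ with a x ≡ᵇ a i in eq
  ... | true = here refl , ℕ.≡ᵇ⇒≡ (a x) (a i) (subst T (sym eq) tt)
  go (x ∷ xs) (here refl) | false = ⊥-elim (subst T eq (ℕ.≡⇒≡ᵇ (a x) (a x) refl))
  go (x ∷ xs) (there i∈) | false with go xs i∈
  ... | r∈ , e = there r∈ , e
... | r∈ , e = inj (∈-upTo⁻ r∈) i< e

-- The permutation `gamma` in cycle notation.

iota : ℕ → ℕ → List ℕ
iota a zero    = []
iota a (suc k) = a ∷ iota (suc a) k

applyUpTo-iota : ∀ (f : ℕ → ℕ) a n → (∀ i → f i ≡ a ℕ.+ i) → applyUpTo f n ≡ iota a n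
applyUpTo-iota f a zero    h = refl
applyUpTo-iota f a (suc n) h = cong₂ _∷_ (trans (h 0) (ℕ.+-identityʳ a)) (applyUpTo-iota (f ∘ suc) (suc a) n (λ i → trans (h (suc i)) (ℕ.+-suc a i)))

upTo-iota : ∀ n → upTo n ≡ iota 0 n
upTo-iota n = applyUpTo-iota id 0 n (λ _ → refl)

iota-++ : ∀ a m n → iota a (m ℕ.+ n) ≡ iota a m ++ iota (a ℕ.+ m) n
iota-++ a zero    n = cong (λ t → iota t n) (sym (ℕ.+-identityʳ a))
iota-++ a (suc m) n = cong (a ∷_) (trans (iota-++ (suc a) m n) (cong (λ t → iota (suc a) m ++ iota t n) (sym (ℕ.+-suc a m))))

length-iota : ∀ a n → length (iota a n) ≡ n
length-iota a zero    = refl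
length-iota a (suc n) = cong suc (length-iota (suc a) n)

∈-iota⁻ : ∀ a n {z} → z ∈ iota a n → a ≤ z × z < a ℕ.+ n
∈-iota⁻ a (suc n) (here refl) = ℕ.≤-refl , ℕ.m<m+n a (s≤s z≤n)
∈-iota⁻ a (suc n) {z} (there z∈) with ∈-iota⁻ (suc a) n z∈
... | p , q = ℕ.≤-trans (ℕ.n≤1+n a) p , subst (z <_) (sym (ℕ.+-suc a n)) q

cycle-iota-last : ∀ a k → cycle (iota a (suc k)) (a ℕ.+ k) ≡ a
cycle-iota-last a zero    = ℕ.+-identityʳ a
cycle-iota-last a (suc k) = trans (cong (transpose a (suc a)) (trans (cong (cycle (iota (suc a) (suc k))) (ℕ.+-suc a k)) (cycle-iota-last (suc a) k)))
  (transpose-right a (suc a))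

cycle-iota-step : ∀ a k {z} → a ≤ z → z < a ℕ.+ k → cycle (iota a (suc k)) z ≡ suc z
cycle-iota-step a zero {z} p q = ⊥-elim (ℕ.<⇒≱ q (subst (_≤ z) (sym (ℕ.+-identityʳ a)) p))
cycle-iota-step a (suc k) {z} p q with z ℕ.≟ a
... | yes refl = trans (cong (transpose a (suc a)) (cycle-∉ (iota (suc a) (suc k)) (λ z∈ → ℕ.<-irrefl refl (proj₁ (∈-iota⁻ (suc a) (suc k) z∈)))))
                       (transpose-left a (suc a))
... | no z≢a = trans (cong (transpose a (suc a)) (cycle-iota-step (suc a) k a<z (subst (z <_) (ℕ.+-suc a k) q)))
    (transpose-other a (suc a) (λ e → ℕ.<⇒≢ (ℕ.<-trans a<z (ℕ.n<1+n z)) (sym e)) (λ e → ℕ.<⇒≢ a<z (sym (ℕ.suc-injective e))))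
  where a<z = ℕ.≤∧≢⇒< p (z≢a ∘ sym)

circles : ℕ → ℕ → Cycles
circles r s = iota 0 r ∷ iota r s ∷ []

circles-letters : ∀ r s → concat (circles r s) ≡ upTo (r ℕ.+ s)
circles-letters r s = trans (cong (iota 0 r ++_) (++-identityʳ (iota r s))) (sym (trans (upTo-iota (r ℕ.+ s)) (iota-++ 0 r s)))

gamma-perm : ∀ r s {z} → z < r ℕ.+ s → gamma r s z ≡ perm (circles r s) z
gamma-perm r s {z} z< with z <ᵇ r in e₁
gamma-perm (suc r) s {z} z< | true with z ≡ᵇ r in e₂
... | true = sym (trans (cong (cycle (iota 0 (suc r))) (cycle-∉ (iota (suc r) s) z∉)) (trans (cong (cycle (iota 0 (suc r))) z≡r) (cycle-iota-last 0 r)))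
  where z≡r = ℕ.≡ᵇ⇒≡ z r (subst T (sym e₂) tt)
        z∉ : z ∉ iota (suc r) s
        z∉ q = ℕ.<⇒≱ (ℕ.<ᵇ⇒< z (suc r) (subst T (sym e₁) tt)) (proj₁ (∈-iota⁻ (suc r) s q))
... | false = sym (trans (cong (cycle (iota 0 (suc r))) (cycle-∉ (iota (suc r) s) z∉)) (cycle-iota-step 0 r z≤n (ℕ.≤∧≢⇒< (ℕ.≤-pred z<r) (λ z≡r → subst T e₂ (ℕ.≡⇒≡ᵇ z r z≡r)))))
  where z<r = ℕ.<ᵇ⇒< z (suc r) (subst T (sym e₁) tt)
        z∉ : z ∉ iota (suc r) s
        z∉ q = ℕ.<⇒≱ z<r (proj₁ (∈-iota⁻ (suc r) s q))
gamma-perm r zero {z} z< | false = ⊥-elim (subst T e₁ (ℕ.<⇒<ᵇ (subst (z <_) (ℕ.+-identityʳ r) z<)))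
gamma-perm r (suc s) {z} z< | false with suc z ≡ᵇ r ℕ.+ suc s in e₂
... | true = sym (trans (cong (cycle (iota 0 r)) (trans (cong (cycle (iota r (suc s))) z≡) (cycle-iota-last r s))) (cycle-∉ (iota 0 r) (λ q → ℕ.<-irrefl refl (proj₂ (∈-iota⁻ 0 r q)))))
  where z≡ : z ≡ r ℕ.+ s
        z≡ = ℕ.suc-injective (trans (ℕ.≡ᵇ⇒≡ (suc z) (r ℕ.+ suc s) (subst T (sym e₂) tt)) (ℕ.+-suc r s))
... | false = sym (trans (cong (cycle (iota 0 r)) (cycle-iota-step r s r≤z (ℕ.≤∧≢⇒< (ℕ.≤-pred (subst (suc z ≤_) (ℕ.+-suc r s) z<)) z≢)))
                    (cycle-∉ (iota 0 r) (λ q → ℕ.<⇒≱ (proj₂ (∈-iota⁻ 0 r q)) (ℕ.≤-trans r≤z (ℕ.n≤1+n z)))))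
  where r≤z : r ≤ z
        r≤z = ℕ.≮⇒≥ (λ q → subst T e₁ (ℕ.<⇒<ᵇ q))
        z≢ : z ≢ r ℕ.+ s
        z≢ e = subst T e₂ (ℕ.≡⇒≡ᵇ (suc z) (r ℕ.+ suc s) (trans (cong suc e) (sym (ℕ.+-suc r s))))

-- Two-coloured cycles and transitivity.

-- The step from the last letter of a cycle back to the first need not be tested: a colour that changes
-- there also changes elsewhere on the cycle.
crosses : (ℕ → Bool) → List ℕ → Bool
crosses p []          = false
crosses p (x ∷ [])    = false
crosses p (x ∷ i ∷ w) = (p x xor p i) ∨ crosses p (i ∷ w)

xor-false : ∀ {a b} → T (not (a xor b)) → a ≡ b
xor-false {false} {false} _ = refl
xor-false {true}  {true}  _ = refl

crosses-constant : ∀ p c → ¬ T (crosses p c) → ∀ {y z} → y ∈ c → z ∈ c → p y ≡ p z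
crosses-constant p c h y∈ z∈ = trans (hd c h y∈) (sym (hd c h z∈))
  where
  first : List ℕ → Bool
  first []      = false
  first (x ∷ _) = p x
  hd : ∀ c → ¬ T (crosses p c) → ∀ {y} → y ∈ c → p y ≡ first c
  hd (x ∷ c)     h (here refl) = refl
  hd (x ∷ i ∷ w) h (there y∈)  = trans (hd (i ∷ w) (λ t → h (Equivalence.from (T-∨ {p x xor p i}) (inj₂ t))) y∈)
    (sym (xor-false (not-T (λ t → h (Equivalence.from (T-∨ {p x xor p i}) (inj₁ t))))))

crosses-witness : ∀ p c → T (crosses p c) → ∃[ y ] ∃[ z ] (y ∈ c × z ∈ c × p y ≡ true × p z ≡ false)
crosses-witness p (x ∷ i ∷ w) h = step (p x) (p i) refl refl (crosses-witness p (i ∷ w)) h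
  where
  step : ∀ a b → p x ≡ a → p i ≡ b →
    (T (crosses p (i ∷ w)) → ∃[ y ] ∃[ z ] (y ∈ i ∷ w × z ∈ i ∷ w × p y ≡ true × p z ≡ false)) → T ((p x xor p i) ∨ crosses p (i ∷ w)) →
    ∃[ y ] ∃[ z ] (y ∈ x ∷ i ∷ w × z ∈ x ∷ i ∷ w × p y ≡ true × p z ≡ false)
  step true  false ex ei rec h = x , i , here refl , there (here refl) , ex , ei
  step false true  ex ei rec h = i , x , there (here refl) , here refl , ei , ex
  step true  true  ex ei rec h with rec (subst T (cong (_∨ crosses p (i ∷ w)) (cong₂ _xor_ ex ei)) h)
  ... | y , z , a , b , c , d = y , z , there a , there b , c , d
  step false false ex ei rec h with rec (subst T (cong (_∨ crosses p (i ∷ w)) (cong₂ _xor_ ex ei)) h)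
  ... | y , z , a , b , c , d = y , z , there a , there b , c , d

switch : ∀ (p : ℕ → Bool) f k i → p i ≡ true → p (iter f k i) ≡ false →
         ∃[ m ] (p (iter f m i) ≡ true × p (f (iter f m i)) ≡ false)
switch p f zero    i a b with () ← trans (sym a) b
switch p f (suc k) i a b with p (iter f k i) in e
... | true  = k , e , b
... | false = switch p f k i a e

module Transitivity (r s : ℕ) (r≥1 : 1 ≤ r) (s≥1 : 1 ≤ s) (A : Cycles) (letters : concat A ↭ upTo (r ℕ.+ s))
                    (α : ℕ → ℕ) (rep : ∀ {z} → z < r ℕ.+ s → α z ≡ perm A z) where

  N : ℕ
  N = r ℕ.+ s

  p : ℕ → Bool
  p = _<ᵇ r

  g : ℕ → ℕ
  g = gamma r s

  unA : Unique (concat A)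
  unA = Unique-resp-↭ (↭-sym letters) (Unique.upTo⁺ N)

  unC : Unique (concat (circles r s))
  unC = subst Unique (sym (circles-letters r s)) (Unique.upTo⁺ N)

  circle-range : ∀ {c z} → c ∈ circles r s → z ∈ c → z < N
  circle-range {c} {z} c∈ z∈ = ∈-upTo⁻ (subst (z ∈_) (circles-letters r s) (∈-cycles c∈ z∈))

  g-at : ∀ {c z} → c ∈ circles r s → z ∈ c → g z ≡ cycle c z
  g-at c∈ z∈ = trans (gamma-perm r s (circle-range c∈ z∈)) (perm-at (circles r s) unC c∈ z∈)

  outer : iota 0 r ∈ circles r s
  outer = here refl

  inner : iota r s ∈ circles r s
  inner = there (here refl)

  circle-of : ∀ {z} → z < N → (p z ≡ true × z ∈ iota 0 r) ⊎ (p z ≡ false × z ∈ iota r s)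
  circle-of {z} z< with ∈-++⁻ (iota 0 r) (subst (z ∈_) (trans (upTo-iota N) (iota-++ 0 r s)) (∈-upTo⁺ z<))
  ... | inj₁ q = inj₁ (T⇒≡ (ℕ.<⇒<ᵇ (proj₂ (∈-iota⁻ 0 r q))) , q)
  ... | inj₂ q = inj₂ (¬T⇒≡ (λ t → ℕ.<⇒≱ (ℕ.<ᵇ⇒< z r t) (proj₁ (∈-iota⁻ r s q))) , q)

  colour-outer : ∀ {z} → z ∈ iota 0 r → p z ≡ true
  colour-outer q = T⇒≡ (ℕ.<⇒<ᵇ (proj₂ (∈-iota⁻ 0 r q)))

  colour-inner : ∀ {z} → z ∈ iota r s → p z ≡ false
  colour-inner {z} q = ¬T⇒≡ (λ t → ℕ.<⇒≱ (ℕ.<ᵇ⇒< z r t) (proj₁ (∈-iota⁻ r s q)))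

  g-colour : ∀ {z} → z < N → p (g z) ≡ p z
  g-colour z< with circle-of z<
  ... | inj₁ (e , q) = trans (cong p (g-at outer q)) (trans (colour-outer (cycle-∈ (iota 0 r) q)) (sym e))
  ... | inj₂ (e , q) = trans (cong p (g-at inner q)) (trans (colour-inner (cycle-∈ (iota r s) q)) (sym e))

  Reach : ℕ → ℕ → Set
  Reach t j = T (reach N α g t j)

  Reach-suc : ∀ {t j} → Reach t j → Reach (suc t) j
  Reach-suc {t} {j} h = Equivalence.from (T-∨ {reach N α g t j}) (inj₁ h)

  Reach-≤ : ∀ {t t′ j} → t ≤ t′ → Reach t j → Reach t′ j
  Reach-≤ {t} {t′} {j} le h = go (ℕ.≤⇒≤′ le)
    where go : ∀ {t′} → t ℕ.≤′ t′ → Reach t′ j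
          go (ℕ.≤′-reflexive refl) = h
          go {suc t′} (ℕ.≤′-step q) = Reach-suc {t′} {j} (go q)

  Reach-α : ∀ {t i} → i < N → Reach t i → Reach (suc t) (α i)
  Reach-α {t} {i} i< h = Equivalence.from (T-∨ {reach N α g t (α i)}) (inj₂ (any-T _ (∈-upTo⁺ i<)
    (Equivalence.from T-∧ (h , Equivalence.from (T-∨ {α i ≡ᵇ α i}) (inj₁ (ℕ.≡⇒≡ᵇ (α i) (α i) refl))))))

  Reach-g : ∀ {t i} → i < N → Reach t i → Reach (suc t) (g i)
  Reach-g {t} {i} i< h = Equivalence.from (T-∨ {reach N α g t (g i)}) (inj₂ (any-T _ (∈-upTo⁺ i<)
    (Equivalence.from T-∧ (h , Equivalence.from (T-∨ {α i ≡ᵇ g i}) (inj₂ (ℕ.≡⇒≡ᵇ (g i) (g i) refl))))))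

  Reach-iter : ∀ {c i t} → c ∈ circles r s → i ∈ c → Reach t i → ∀ k → Reach (k ℕ.+ t) (iter (cycle c) k i) × iter (cycle c) k i ∈ c
  Reach-iter c∈ i∈ h zero = h , i∈
  Reach-iter {c} {i} {t} c∈ i∈ h (suc k) with Reach-iter {t = t} c∈ i∈ h k
  ... | h′ , m = subst (Reach (suc k ℕ.+ t)) (g-at c∈ m) (Reach-g {k ℕ.+ t} (circle-range c∈ m) h′) , cycle-∈ c m

  Reach-circle : ∀ {c i j t} → c ∈ circles r s → i ∈ c → j ∈ c → Reach t i → ∃[ k ] (k < length c × Reach (k ℕ.+ t) j)
  Reach-circle {c} {t = t} c∈ i∈ j∈ h with iter-reach c (Unique-cycle unC c∈) i∈ j∈
  ... | k , k< , e = k , k< , subst (Reach (k ℕ.+ t)) e (proj₁ (Reach-iter {t = t} c∈ i∈ h k))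

  0∈ : 0 ∈ iota 0 r
  0∈ = start r≥1
    where start : ∀ {r} → 1 ≤ r → 0 ∈ iota 0 r
          start {suc _} _ = here refl

  reach-outer : ∀ {j} → j ∈ iota 0 r → ∃[ k ] (k < r × Reach k j)
  reach-outer j∈ with Reach-circle {t = 0} outer 0∈ j∈ tt
  ... | k , k< , h = k , subst (k <_) (length-iota 0 r) k< , subst (λ t → Reach t _) (ℕ.+-identityʳ k) h

  -- The colours are the two circles, which `g` preserves. If no cycle of A is two-coloured, α
  -- preserves them as well and the inner point r is never reached from 0. A two-coloured cycle
  -- contains a step of α from the outer to the inner circle.
  transitive-crosses : transitive N α g ≡ any (crosses p) A
  transitive-crosses = T-ext to from
    where
    to : T (transitive N α g) → T (any (crosses p) A)
    to t with T? (any (crosses p) A)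
    ... | yes q = q
    ... | no ¬q = ⊥-elim (true≢false (trans (sym (inv N (T-all _ (upTo N) t (∈-upTo⁺ r<N)))) (¬T⇒≡ (λ t → ℕ.<-irrefl refl (ℕ.<ᵇ⇒< r r t)))))
      where
      true≢false : true ≢ false
      true≢false ()
      r<N : r < r ℕ.+ s
      r<N = ℕ.m<m+n r s≥1
      α-colour : ∀ {z} → z < N → p (α z) ≡ p z
      α-colour {z} z< with ∈-concat⁻′ A (∈-resp-↭ (↭-sym letters) (∈-upTo⁺ z<))
      ... | c , z∈ , c∈ = trans (cong p (trans (rep z<) (perm-at A unA c∈ z∈)))
              (crosses-constant p c (λ x → ¬q (any-T (crosses p) c∈ x)) (cycle-∈ c z∈) z∈)
      inv : ∀ t {j} → Reach t j → p j ≡ true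
      inv zero {j} h = trans (cong p (ℕ.≡ᵇ⇒≡ j 0 h)) (T⇒≡ (ℕ.<⇒<ᵇ r≥1))
      inv (suc t) {j} h with Equivalence.to (T-∨ {reach N α g t j}) h
      ... | inj₁ h′ = inv t h′
      ... | inj₂ h′ with T-any _ (upTo N) h′
      ...   | i , i∈ , b with Equivalence.to (T-∧ {reach N α g t i}) b
      ...     | b₁ , b₂ with Equivalence.to (T-∨ {α i ≡ᵇ j}) b₂
      ...       | inj₁ e = trans (cong p (sym (ℕ.≡ᵇ⇒≡ (α i) j e))) (trans (α-colour (∈-upTo⁻ i∈)) (inv t b₁))
      ...       | inj₂ e = trans (cong p (sym (ℕ.≡ᵇ⇒≡ (g i) j e))) (trans (g-colour (∈-upTo⁻ i∈)) (inv t b₁))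
    from : T (any (crosses p) A) → T (transitive N α g)
    from h with T-any (crosses p) A h
    ... | c , c∈ , t with crosses-witness p c t
    ...   | y , z , y∈ , z∈ , ey , ez with iter-reach c (Unique-cycle unA c∈) y∈ z∈
    ...     | k , _ , e with switch p (cycle c) k y ey (trans (cong p e) ez)
    ...       | m , et , ef = all-T _ (upTo N) (λ j∈ → reached (∈-upTo⁻ j∈))
      where
      x = iter (cycle c) m y
      x∈c : x ∈ c
      x∈c = proj₂ (iter-cong {cycle c} {cycle c} (λ _ → refl) (cycle-∈ c) y∈ m)
      x<N : x < N
      x<N = ∈-upTo⁻ (∈-resp-↭ letters (∈-cycles c∈ x∈c))
      αx≡ : α x ≡ cycle c x
      αx≡ = trans (rep x<N) (perm-at A unA c∈ x∈c)
      x∈ : x ∈ iota 0 r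
      x∈ with circle-of x<N
      ... | inj₁ (_ , q) = q
      ... | inj₂ (e′ , _) with () ← trans (sym et) e′
      αx∈ : α x ∈ iota r s
      αx∈ with circle-of {α x} (subst (_< N) (sym αx≡) (∈-upTo⁻ (∈-resp-↭ letters (∈-cycles c∈ (cycle-∈ c x∈c)))))
      ... | inj₂ (_ , q) = q
      ... | inj₁ (e′ , _) with () ← trans (sym e′) (trans (cong p αx≡) ef)
      reached : ∀ {j} → j < N → Reach N j
      reached {j} j< with circle-of j<
      ... | inj₁ (_ , q) with reach-outer q
      ...   | k , k< , h = Reach-≤ {k} {N} (ℕ.≤-trans (ℕ.<⇒≤ k<) (ℕ.m≤m+n r s)) h
      -- Fewer than r steps along the outer circle, one step of α, fewer than s steps along the
      -- inner circle: at most r + s in all.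
      reached {j} j< | inj₂ (_ , q) with reach-outer x∈
      ... | k , k< , h with Reach-circle {t = suc k} inner αx∈ q (Reach-α {k} x<N h)
      ...   | k′ , k′< , h′ = Reach-≤ {k′ ℕ.+ suc k} {N} (subst (k′ ℕ.+ suc k ≤_) (ℕ.+-comm s r)
                (ℕ.+-mono-≤ (ℕ.<⇒≤ (subst (k′ <_) (length-iota r s) k′<)) k<)) h′

-- Peelings without joins respect the colours.

NoCross : (ℕ → Bool) → Cycles → Set
NoCross p A = any (crosses p) A ≡ false

Mono : (ℕ → Bool) → Bool → List ℕ → Set
Mono p b c = ∀ {z} → z ∈ c → p z ≡ b

Mono-⊆ : ∀ {p b c d} → (∀ {z} → z ∈ d → z ∈ c) → Mono p b c → Mono p b d
Mono-⊆ f m z∈ = m (f z∈)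

xor-same : ∀ {a b} → a ≡ b → (a xor b) ≡ false
xor-same {false} refl = refl
xor-same {true}  refl = refl

∨-false : ∀ {a b} → a ≡ false → b ≡ false → a ∨ b ≡ false
∨-false refl refl = refl

mutual
  -- Closing and cutting move only to letters of the same entry of C, so without a join each cycle
  -- of A stays inside one entry.
  HD-nocross : ∀ p {C A nb jn} → HD C A nb jn → jn ≡ 0 → All (λ c → ∃[ b ] Mono p b c) C → NoCross p A
  HD-nocross p nil e ms = refl
  HD-nocross p (empty h) e (_ ∷ ms) = HD-nocross p h e ms
  HD-nocross p (root f) e ((b , m) ∷ ms) = FD-nocross p b f e m ms

  FD-nocross : ∀ p b {x u C w A nb jn} → FD x u C w A nb jn → jn ≡ 0 → Mono p b (x ∷ u) → All (λ c → ∃[ b ] Mono p b c) C →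
               NoCross p ((x ∷ w) ∷ A)
  FD-nocross p b (close h) e m ms = HD-nocross p h e ((b , Mono-⊆ there m) ∷ ms)
  FD-nocross p b {x} (cut u₁ {i} {w = w} {A} h) e m ms =
    ∨-false (∨-false (xor-same (trans (m (here refl)) (sym (m (there (∈-++⁺ʳ u₁ (here refl))))))) (proj₁ split)) (proj₂ split)
    where
    rec : NoCross p ((i ∷ w) ∷ A)
    rec = FD-nocross p b h e (Mono-⊆ (there ∘ ∈-++⁺ʳ u₁) m) ((b , Mono-⊆ (there ∘ ∈-++⁺ˡ) m) ∷ ms)
    split : crosses p (i ∷ w) ≡ false × any (crosses p) A ≡ false
    split with crosses p (i ∷ w) | rec
    ... | false | r = refl , r
  FD-nocross p b (join C₁ v₁ h) () m ms

crosses-mono : ∀ p b c → Mono p b c → crosses p c ≡ false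
crosses-mono p b c m = ¬T⇒≡ (λ t → let y , z , y∈ , z∈ , ey , ez = crosses-witness p c t in
  true≢false (trans (sym ey) (trans (m y∈) (trans (sym (m z∈)) ez))))
  where true≢false : true ≢ false
        true≢false ()

nocross-letters : ∀ p b A → Mono p b (concat A) → NoCross p A
nocross-letters p b []      m = refl
nocross-letters p b (c ∷ A) m = ∨-false (crosses-mono p b c (m ∘ ∈-++⁺ˡ)) (nocross-letters p b A (m ∘ ∈-++⁺ʳ c))

-- The length of a cycle with j letters before the root and w after it. It is accumulated so that
-- moving the root one letter on is a definitional equality.
grown : ℕ → List ℕ → ℕ
grown j []      = suc j
grown j (_ ∷ w) = grown (suc j) w

grown-length : ∀ j w → grown j w ≡ suc (j ℕ.+ length w)
grown-length j []      = cong suc (sym (ℕ.+-identityʳ j))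
grown-length j (_ ∷ w) = trans (grown-length (suc j) w) (cong suc (sym (ℕ.+-suc j (length w))))

-- Weighted sums over peelings.

module Gates (S : CommutativeSemiring 0ℓ 0ℓ) where
  open CommutativeSemiring S renaming (refl to ≈-refl; sym to ≈-sym; trans to ≈-trans)
  open Semi S

  gate : Bool → Carrier → Carrier
  gate b x = if b then x else 0#

  gate-* : ∀ b c x → gate b (c * x) ≈ c * gate b x
  gate-* true  c x = ≈-refl
  gate-* false c x = ≈-sym (zeroʳ c)

  gate-cong : ∀ b {x y} → x ≈ y → gate b x ≈ gate b y
  gate-cong true  e = e
  gate-cong false e = ≈-refl

  gate-≡ : ∀ {b b′} x → b ≡ b′ → gate b x ≈ gate b′ x
  gate-≡ x refl = ≈-refl

  Σ-filter : ∀ {A : Set} (q : A → Bool) (xs : List A) {h : A → Carrier} → Σ[ filterᵇ q xs ] h ≈ Σ[ xs ] (λ x → gate (q x) (h x))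
  Σ-filter q []       = ≈-refl
  Σ-filter q (x ∷ xs) with q x
  ... | true  = +-congˡ (Σ-filter q xs)
  ... | false = ≈-trans (Σ-filter q xs) (≈-sym (+-identityˡ _))

  Σ-cong∈ : ∀ {A : Set} (xs : List A) {h h′ : A → Carrier} → (∀ {x} → x ∈ xs → h x ≈ h′ x) → Σ[ xs ] h ≈ Σ[ xs ] h′
  Σ-cong∈ xs e = Σ-congAll (All.tabulate e)

  Σ-0∈ : ∀ {A : Set} (xs : List A) {h : A → Carrier} → (∀ {x} → x ∈ xs → h x ≈ 0#) → Σ[ xs ] h ≈ 0#
  Σ-0∈ xs e = ≈-trans (Σ-cong∈ xs e) (Σ-0 xs (λ _ → ≈-refl))

  delay : Seq → Seq
  delay h zero    = 0#
  delay h (suc n) = h n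

  -- Choosing the letter at which a word is cut amounts to a convolution, delayed by one for the
  -- chosen letter itself.
  Σ-splits : ∀ (F G : Seq) u → Σ[ splits u ] (λ (u₁ , _ , u₂) → F (length u₁) * G (length u₂)) ≈ delay (F ⊛ G) (length u)
  Σ-splits F G []      = ≈-refl
  Σ-splits F G (i ∷ u) = ≈-trans (+-congˡ (≈-trans (Σ-map _ (splits u)) (Σ-splits (tail F) G u))) (fin u)
    where
    fin : ∀ u → F 0 * G (length u) + delay (tail F ⊛ G) (length u) ≈ (F ⊛ G) (length u)
    fin []      = +-identityʳ _
    fin (_ ∷ _) = ≈-refl

  Σ-splits-const : ∀ u c → Σ[ splits u ] (λ _ → c) ≈ nat (length u) * c
  Σ-splits-const []      c = ≈-sym (zeroˡ c)
  Σ-splits-const (i ∷ u) c = ≈-trans (+-cong (≈-sym (*-identityˡ c)) (≈-trans (Σ-map _ (splits u)) (Σ-splits-const u c))) (≈-sym (distribʳ c 1# _))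

  picks-snoc : ∀ C v {h : List ℕ × Cycles → Carrier} →
    Σ[ picks (C ++ v ∷ []) ] h ≈ Σ[ picks C ] (λ (c , C′) → h (c , C′ ++ v ∷ [])) + h (v , C)
  picks-snoc []      v = ≈-trans (+-identityʳ _) (≈-sym (+-identityˡ _))
  picks-snoc (c ∷ C) v {h} = ≈-trans (+-congˡ (≈-trans (Σ-map _ (picks (C ++ v ∷ []))) (≈-trans (picks-snoc C v) (+-congʳ (≈-sym (Σ-map _ (picks C))))))) (≈-sym (+-assoc _ _ _))

module PlanarSums (S : CommutativeSemiring 0ℓ 0ℓ) (κ : ℕ → CommutativeSemiring.Carrier S) where
  open CommutativeSemiring S renaming (refl to ≈-refl; sym to ≈-sym; trans to ≈-trans)
  open Semi S
  open Gates S
  open import Algebra.Solver.Ring.NaturalCoefficients.Default S using (solve; _:=_; _:+_; _:*_; con)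
  open import Relation.Binary.Reasoning.Setoid setoid

  weightH : Cycles → Carrier
  weightH A = Πκ κ (map length A)

  weightF : ℕ → FOut → Carrier
  weightF j (w , A , _) = κ (grown j w) * weightH A

  Σ-branches : ∀ n x u C {h : FOut → Carrier} → Σ[ enumF n x u C ] h ≈
    Σ[ enumH n (u ∷ C) ] (λ o → h (closing o)) + (Σ[ cuts n u C ] (λ b → Σ[ proj₂ b ] h) + Σ[ joins n u C (picks C) ] (λ b → Σ[ proj₂ b ] h))
  Σ-branches n x u C = ≈-trans (Σ-concatMap proj₂ (branches n x u C)) (+-cong (Σ-map closing (enumH n (u ∷ C))) (Σ-++ (cuts n u C) _))

  -- `W n` is to be the weight of the peelings without joins of a circle with n letters. In `f j n`
  -- the root is letter j + 1 of its cycle of A, and n letters follow it on its circle. The summands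
  -- of `f-step` belong to closing and cutting.
  record Planar (W : Seq) (f : ℕ → Seq) : Set where
    field
      W-zero : W 0 ≈ 1#
      W-suc  : ∀ n → W (suc n) ≈ f 0 n
      f-step : ∀ j n → f j n ≈ κ (suc j) * W n + delay (W ⊛ f (suc j)) n

  module _ {W f} (pl : Planar W f) where
    open Planar pl

    PW : Cycles → Carrier
    PW C = Π (map (W ∘ length) C)

    gate₀ : HOut → Carrier
    gate₀ (A , nb , jn) = gate (jn ≡ᵇ 0) (weightH A)

    gateF₀ : ℕ → FOut → Carrier
    gateF₀ j o@(w , A , nb , jn) = gate (jn ≡ᵇ 0) (weightF j o)

    gateF₀-closing : ∀ j o → gateF₀ j (closing o) ≈ κ (suc j) * gate₀ o
    gateF₀-closing j (A , nb , jn) = gate-* (jn ≡ᵇ 0) _ _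

    joins-vanish : ∀ j n u C ps → Σ[ joins n u C ps ] (λ b → Σ[ proj₂ b ] (gateF₀ j)) ≈ 0#
    joins-vanish j zero    u C ps = ≈-refl
    joins-vanish j (suc n) u C ps = ≈-trans (Σ-concatMap _ ps) (Σ-0 ps (λ (v , C′) → ≈-trans (Σ-map _ (splits v))
      (Σ-0 (splits v) (λ (v₁ , i , v₂) → ≈-trans (Σ-map (joining i) (enumF n i (v₂ ++ v₁ ++ u) C′)) (Σ-0 (enumF n i (v₂ ++ v₁ ++ u) C′) (λ _ → ≈-refl))))))

    mutual
      -- Without joins the entries of C never interact, hence the product.
      ΣH₀ : ∀ n C → length (concat C) ≡ n → Σ[ enumH n C ] gate₀ ≈ PW C
      ΣH₀ n []            len = +-identityʳ _
      ΣH₀ n ([] ∷ C)      len = ≈-trans (Σ-map emptying (enumH n C)) (≈-trans (ΣH₀ n C len)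
        (≈-trans (≈-sym (*-identityˡ _)) (*-congʳ (≈-sym W-zero))))
      ΣH₀ (suc n) ((x ∷ u) ∷ C) len = ≈-trans (Σ-map (rooting x) (enumF n x u C))
        (≈-trans (Σ-cong (enumF n x u C) (λ (w , A , nb , jn) → gate-cong (jn ≡ᵇ 0) (*-congʳ (reflexive (cong κ (sym (grown-length 0 w)))))))
          (≈-trans (ΣF₀ 0 n x u C (ℕ.suc-injective len)) (*-congʳ (≈-sym (W-suc (length u))))))

      ΣF₀ : ∀ j n x u C → length (u ++ concat C) ≡ n → Σ[ enumF n x u C ] (gateF₀ j) ≈ f j (length u) * PW C
      ΣF₀ j n x u C len = begin
        Σ[ enumF n x u C ] (gateF₀ j)
          ≈⟨ Σ-branches n x u C ⟩
        Σ[ enumH n (u ∷ C) ] (λ o → gateF₀ j (closing o)) + (Σ[ cuts n u C ] (λ b → Σ[ proj₂ b ] (gateF₀ j)) + Σ[ joins n u C (picks C) ] (λ b → Σ[ proj₂ b ] (gateF₀ j)))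
          ≈⟨ +-cong (≈-trans (Σ-cong (enumH n (u ∷ C)) (gateF₀-closing j)) (≈-trans (Σ-*ˡ _ (enumH n (u ∷ C))) (*-congˡ (ΣH₀ n (u ∷ C) len))))
               (+-cong (Σcuts₀ j n u C len) (joins-vanish j n u C (picks C))) ⟩
        κ (suc j) * (W (length u) * PW C) + (delay (W ⊛ f (suc j)) (length u) * PW C + 0#)
          ≈⟨ solve 4 (λ k w p d → k :* (w :* p) :+ (d :* p :+ con 0) := (k :* w :+ d) :* p) ≈-refl _ _ _ _ ⟩
        (κ (suc j) * W (length u) + delay (W ⊛ f (suc j)) (length u)) * PW C
          ≈⟨ *-congʳ (f-step j (length u)) ⟨
        f j (length u) * PW C ∎

      Σcuts₀ : ∀ j n u C → length (u ++ concat C) ≡ n → Σ[ cuts n u C ] (λ b → Σ[ proj₂ b ] (gateF₀ j)) ≈ delay (W ⊛ f (suc j)) (length u) * PW C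
      Σcuts₀ j zero    []      C len = ≈-sym (zeroˡ _)
      Σcuts₀ j (suc n) u C len = ≈-trans (Σ-map _ (splits u)) (≈-trans (Σ-cong∈ (splits u) h)
        (≈-trans (Σ-*ʳ (PW C) (splits u)) (*-congʳ (Σ-splits W (f (suc j)) u))))
        where
        h : ∀ {t} → t ∈ splits u → (let (u₁ , i , u₂) = t in Σ[ map (cutting i) (enumF n i u₂ (u₁ ∷ C)) ] (gateF₀ j) ≈ (W (length u₁) * f (suc j) (length u₂)) * PW C)
        h {u₁ , i , u₂} t∈ with splits-sound u t∈
        ... | refl = ≈-trans (Σ-map (cutting i) (enumF n i u₂ (u₁ ∷ C)))
          (≈-trans (ΣF₀ (suc j) n i u₂ (u₁ ∷ C) (ℕ.suc-injective (trans (sym (↭-length (cut-letters u₁ i u₂ C))) len)))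
            (solve 3 (λ a b c → a :* (b :* c) := (b :* a) :* c) ≈-refl _ _ _))

    -- Here s letters lie on the other circle and exactly one join is to come. The summands of
    -- `g-step` are: close; cut, with the join made from the part that keeps the root or from the
    -- part cut off; join now, to any of s letters, after which s - 1 + n letters follow the new
    -- root and the rest is planar.
    record Annular (s : ℕ) (Y : Seq) (g : ℕ → Seq) : Set where
      field
        Y-zero : Y 0 ≈ 0#
        Y-suc  : ∀ n → Y (suc n) ≈ g 0 n
        g-step : ∀ j n → g j n ≈ κ (suc j) * Y n + (delay (W ⊛ g (suc j)) n + delay (Y ⊛ f (suc j)) n) + nat s * f (suc j) (ℕ.pred s ℕ.+ n)

    -- Colour the letters by p; the cycles of C have colour b, and the last cycle x₀ ∷ v₀ has the other one.
    module _ {Y g} (p : ℕ → Bool) (b : Bool) (x₀ : ℕ) (v₀ : List ℕ) (v-mono : Mono p (not b) (x₀ ∷ v₀))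
             (an : Annular (suc (length v₀)) Y g) where
      open Annular an

      v : List ℕ
      v = x₀ ∷ v₀

      -- A Leibniz sum over the entry of C that will be joined to `v`; the other entries stay
      -- planar.
      YW : Cycles → Carrier
      YW []      = 0#
      YW (c ∷ C) = Y (length c) * PW C + W (length c) * YW C

      gate₁ : HOut → Carrier
      gate₁ (A , nb , jn) = gate (any (crosses p) A ∧ (jn ≡ᵇ 1)) (weightH A)

      gateF₁ : ℕ → ℕ → FOut → Carrier
      gateF₁ x j o@(w , A , nb , jn) = gate (any (crosses p) ((x ∷ w) ∷ A) ∧ (jn ≡ᵇ 1)) (weightF j o)

      MonoC : Cycles → Set
      MonoC C = All (Mono p b) C

      monos : ∀ {C} → MonoC C → All (λ c → ∃[ b ] Mono p b c) (C ++ v ∷ [])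
      monos ms = All.++⁺ (All.map (λ m → b , m) ms) ((not b , v-mono) ∷ [])

      mono-picks : ∀ {C c C′} → MonoC C → (c , C′) ∈ picks C → Mono p b c × MonoC C′
      mono-picks {C} ms pk with picks-sound C pk
      ... | C₁ , C₂ , refl , refl with All.++⁻ C₁ ms
      ...   | ms₁ , m ∷ ms₂ = m , All.++⁺ ms₁ ms₂

      same-colour : ∀ {x i w A jn} → p x ≡ p i → any (crosses p) ((x ∷ i ∷ w) ∷ A) ∧ (jn ≡ᵇ 1) ≡ any (crosses p) ((i ∷ w) ∷ A) ∧ (jn ≡ᵇ 1)
      same-colour {w = w} {A} {jn} e = cong (λ t → ((t ∨ crosses p (_ ∷ w)) ∨ any (crosses p) A) ∧ (jn ≡ᵇ 1)) (xor-same e)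

      other-colour : ∀ {x i w A jn} → p x ≡ b → p i ≡ not b → any (crosses p) ((x ∷ i ∷ w) ∷ A) ∧ (suc jn ≡ᵇ 1) ≡ (jn ≡ᵇ 0)
      other-colour {w = w} {A} {jn} e e′ = cong (λ t → ((t ∨ crosses p (_ ∷ w)) ∨ any (crosses p) A) ∧ (jn ≡ᵇ 0)) (trans (cong₂ _xor_ e e′) (x b))
        where x : ∀ b → (b xor not b) ≡ true
              x false = refl
              x true  = refl

      mutual
        -- With `v` last, the roots met before `v` and before any join have colour b. If `v` is left
        -- over unjoined, only one colour remains and nothing is counted.
        ΣH₁ : ∀ n C → Unique (concat (C ++ v ∷ [])) → length (concat (C ++ v ∷ [])) ≡ n → MonoC C → Σ[ enumH n (C ++ v ∷ []) ] gate₁ ≈ YW C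
        ΣH₁ n [] un len ms = Σ-0∈ (enumH n (v ∷ [])) (λ {(A , nb , jn)} o∈ → gate-≡ (weightH A)
          (cong (_∧ (jn ≡ᵇ 1)) (nocross-letters p (not b) A (λ {z} z∈ → v-mono (subst (z ∈_) (++-identityʳ v) (∈-resp-↭ (Valid.letters (HD-valid (enumH-sound n (v ∷ []) o∈) un)) z∈))))))
        ΣH₁ n ([] ∷ C) un len (m ∷ ms) = ≈-trans (Σ-map emptying (enumH n (C ++ v ∷ []))) (≈-trans (ΣH₁ n C un len ms)
          (≈-sym (≈-trans (+-cong (*-congʳ Y-zero) (*-congʳ W-zero)) (solve 2 (λ a b → con 0 :* a :+ con 1 :* b := b) ≈-refl _ _))))
        ΣH₁ (suc n) ((x ∷ u) ∷ C) un len (m ∷ ms) = ≈-trans (Σ-map (rooting x) (enumF n x u (C ++ v ∷ [])))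
          (≈-trans (Σ-cong (enumF n x u (C ++ v ∷ [])) (λ (w , A , nb , jn) → gate-cong (any (crosses p) ((x ∷ w) ∷ A) ∧ (jn ≡ᵇ 1)) (*-congʳ (reflexive (cong κ (sym (grown-length 0 w)))))))
            (≈-trans (ΣF₁ 0 n x u C un (ℕ.suc-injective len) m ms)
              (+-cong (*-congʳ (≈-sym (Y-suc (length u)))) (*-congʳ (≈-sym (W-suc (length u)))))))

        ΣF₁ : ∀ j n x u C → Unique (x ∷ u ++ concat (C ++ v ∷ [])) → length (u ++ concat (C ++ v ∷ [])) ≡ n → Mono p b (x ∷ u) → MonoC C →
          Σ[ enumF n x u (C ++ v ∷ []) ] (gateF₁ x j) ≈ g j (length u) * PW C + f j (length u) * YW C
        ΣF₁ j n x u C un len m ms = begin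
          Σ[ enumF n x u (C ++ v ∷ []) ] (gateF₁ x j)
            ≈⟨ Σ-branches n x u (C ++ v ∷ []) ⟩
          Σ[ enumH n (u ∷ C ++ v ∷ []) ] (λ o → gateF₁ x j (closing o)) + (Σ[ cuts n u (C ++ v ∷ []) ] (λ b → Σ[ proj₂ b ] (gateF₁ x j)) + Σ[ joins n u (C ++ v ∷ []) (picks (C ++ v ∷ [])) ] (λ b → Σ[ proj₂ b ] (gateF₁ x j)))
            ≈⟨ +-cong (≈-trans (Σ-cong (enumH n (u ∷ C ++ v ∷ [])) (λ (A , nb , jn) → gate-* (any (crosses p) A ∧ (jn ≡ᵇ 1)) _ _)) (≈-trans (Σ-*ˡ _ (enumH n (u ∷ C ++ v ∷ []))) (*-congˡ (ΣH₁ n (u ∷ C) (AP.tail un) len (Mono-⊆ there m ∷ ms)))))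
                 (+-cong (Σcuts₁ j n x u C un len m ms) (Σjoins₁ j n x u C un len m ms)) ⟩
          κ (suc j) * (Y l * PW C + W l * YW C) +
            (((delay (W ⊛ g (suc j)) l + delay (Y ⊛ f (suc j)) l) * PW C + delay (W ⊛ f (suc j)) l * YW C) + nat (length v) * f (suc j) (length v₀ ℕ.+ l) * PW C)
            ≈⟨ solve 9 (λ k y p w q a b c d → k :* (y :* p :+ w :* q) :+ (((a :+ b) :* p :+ c :* q) :+ d :* p) := (k :* y :+ (a :+ b) :+ d) :* p :+ (k :* w :+ c) :* q)
                 ≈-refl (κ (suc j)) (Y l) (PW C) (W l) (YW C) (delay (W ⊛ g (suc j)) l) (delay (Y ⊛ f (suc j)) l) (delay (W ⊛ f (suc j)) l) (nat (length v) * f (suc j) (length v₀ ℕ.+ l)) ⟩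
          (κ (suc j) * Y l + (delay (W ⊛ g (suc j)) l + delay (Y ⊛ f (suc j)) l) + nat (length v) * f (suc j) (length v₀ ℕ.+ l)) * PW C + (κ (suc j) * W l + delay (W ⊛ f (suc j)) l) * YW C
            ≈⟨ +-cong (*-congʳ (g-step j l)) (*-congʳ (f-step j l)) ⟨
          g j l * PW C + f j l * YW C ∎
          where l = length u

        Σcuts₁ : ∀ j n x u C → Unique (x ∷ u ++ concat (C ++ v ∷ [])) → length (u ++ concat (C ++ v ∷ [])) ≡ n → Mono p b (x ∷ u) → MonoC C →
          Σ[ cuts n u (C ++ v ∷ []) ] (λ b → Σ[ proj₂ b ] (gateF₁ x j)) ≈
          (delay (W ⊛ g (suc j)) (length u) + delay (Y ⊛ f (suc j)) (length u)) * PW C + delay (W ⊛ f (suc j)) (length u) * YW C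
        Σcuts₁ j zero    x []      C un len m ms = solve 2 (λ a b → con 0 := (con 0 :+ con 0) :* a :+ con 0 :* b) ≈-refl _ _
        Σcuts₁ j (suc n) x u C un len m ms = begin
          Σ[ cuts (suc n) u (C ++ v ∷ []) ] (λ b → Σ[ proj₂ b ] (gateF₁ x j))
            ≈⟨ Σ-map _ (splits u) ⟩
          Σ[ splits u ] (λ (u₁ , i , u₂) → Σ[ map (cutting i) (enumF n i u₂ (u₁ ∷ C ++ v ∷ [])) ] (gateF₁ x j))
            ≈⟨ Σ-cong∈ (splits u) h ⟩
          Σ[ splits u ] (λ (u₁ , i , u₂) → (W (length u₁) * g (suc j) (length u₂) + Y (length u₁) * f (suc j) (length u₂)) * PW C + W (length u₁) * f (suc j) (length u₂) * YW C)
            ≈⟨ Σ-+ (splits u) ⟩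
          Σ[ splits u ] (λ (u₁ , i , u₂) → (W (length u₁) * g (suc j) (length u₂) + Y (length u₁) * f (suc j) (length u₂)) * PW C) + Σ[ splits u ] (λ (u₁ , i , u₂) → W (length u₁) * f (suc j) (length u₂) * YW C)
            ≈⟨ +-cong (≈-trans (Σ-*ʳ (PW C) (splits u)) (*-congʳ (≈-trans (Σ-+ (splits u)) (+-cong (Σ-splits W (g (suc j)) u) (Σ-splits Y (f (suc j)) u)))))
                 (≈-trans (Σ-*ʳ (YW C) (splits u)) (*-congʳ (Σ-splits W (f (suc j)) u))) ⟩
          (delay (W ⊛ g (suc j)) (length u) + delay (Y ⊛ f (suc j)) (length u)) * PW C + delay (W ⊛ f (suc j)) (length u) * YW C ∎
          where
          h : ∀ {t} → t ∈ splits u → (let (u₁ , i , u₂) = t in Σ[ map (cutting i) (enumF n i u₂ (u₁ ∷ C ++ v ∷ [])) ] (gateF₁ x j) ≈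
                (W (length u₁) * g (suc j) (length u₂) + Y (length u₁) * f (suc j) (length u₂)) * PW C + W (length u₁) * f (suc j) (length u₂) * YW C)
          h {u₁ , i , u₂} t∈ with splits-sound u t∈
          ... | refl = ≈-trans (Σ-map (cutting i) (enumF n i u₂ (u₁ ∷ C ++ v ∷ [])))
            (≈-trans (Σ-cong (enumF n i u₂ (u₁ ∷ C ++ v ∷ [])) (λ (w , A , nb , jn) → gate-≡ _ (same-colour {x} {i} {w} {A} {jn} (trans (m (here refl)) (sym (m (there (∈-++⁺ʳ u₁ (here refl)))))))))
              (≈-trans (ΣF₁ (suc j) n i u₂ (u₁ ∷ C) (Unique-resp-↭ pl↭ (AP.tail un)) (ℕ.suc-injective (trans (sym (↭-length pl↭)) len))
                         (Mono-⊆ (there ∘ ∈-++⁺ʳ u₁) m) (Mono-⊆ (there ∘ ∈-++⁺ˡ) m ∷ ms))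
                (solve 7 (λ g w p f y w′ q → g :* (w :* p) :+ f :* (y :* p :+ w :* q) := (w :* g :+ y :* f) :* p :+ w :* f :* q) ≈-refl
                  (g (suc j) (length u₂)) (W (length u₁)) (PW C) (f (suc j) (length u₂)) (Y (length u₁)) 0# (YW C))))
            where pl↭ = cut-letters u₁ i u₂ (C ++ v ∷ [])

        Σjoins₁ : ∀ j n x u C → Unique (x ∷ u ++ concat (C ++ v ∷ [])) → length (u ++ concat (C ++ v ∷ [])) ≡ n → Mono p b (x ∷ u) → MonoC C →
          Σ[ joins n u (C ++ v ∷ []) (picks (C ++ v ∷ [])) ] (λ b → Σ[ proj₂ b ] (gateF₁ x j)) ≈ nat (length v) * f (suc j) (length v₀ ℕ.+ length u) * PW C
        Σjoins₁ j zero x u C un len m ms with () ← trans (sym (↭-length (join-letters u C [] x₀ v₀ []))) len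
        Σjoins₁ j (suc n) x u C un len m ms = begin
          Σ[ joins (suc n) u (C ++ v ∷ []) (picks (C ++ v ∷ [])) ] (λ b → Σ[ proj₂ b ] (gateF₁ x j))
            ≈⟨ Σ-concatMap _ (picks (C ++ v ∷ [])) ⟩
          Σ[ picks (C ++ v ∷ []) ] (λ (c , C′) → Σ[ map (λ (v₁ , i , v₂) → i , map (joining i) (enumF n i (v₂ ++ v₁ ++ u) C′)) (splits c) ] (λ b → Σ[ proj₂ b ] (gateF₁ x j)))
            ≈⟨ picks-snoc C v ⟩
          Σ[ picks C ] (λ (c , C′) → Σ[ map (λ (v₁ , i , v₂) → i , map (joining i) (enumF n i (v₂ ++ v₁ ++ u) (C′ ++ v ∷ []))) (splits c) ] (λ b → Σ[ proj₂ b ] (gateF₁ x j)))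
            + Σ[ map (λ (v₁ , i , v₂) → i , map (joining i) (enumF n i (v₂ ++ v₁ ++ u) C)) (splits v) ] (λ b → Σ[ proj₂ b ] (gateF₁ x j))
            ≈⟨ +-cong (Σ-0∈ (picks C) (λ {(c , C′)} pk → ≈-trans (Σ-map _ (splits c)) (Σ-0∈ (splits c) (λ {t} t∈ → within pk t t∈))))
                 (≈-trans (Σ-map _ (splits v)) (Σ-cong∈ (splits v) across)) ⟩
          0# + Σ[ splits v ] (λ _ → f (suc j) (length v₀ ℕ.+ length u) * PW C)
            ≈⟨ ≈-trans (+-identityˡ _) (Σ-splits-const v _) ⟩
          nat (length v) * (f (suc j) (length v₀ ℕ.+ length u) * PW C)
            ≈⟨ *-assoc _ _ _ ⟨
          nat (length v) * f (suc j) (length v₀ ℕ.+ length u) * PW C ∎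
          where
          -- Joining two entries of the same colour spends the only join, and without another one no
          -- cycle becomes two-coloured.
          within : ∀ {c C′} → (c , C′) ∈ picks C → ∀ t → t ∈ splits c → (let (v₁ , i , v₂) = t in
            Σ[ map (joining i) (enumF n i (v₂ ++ v₁ ++ u) (C′ ++ v ∷ [])) ] (gateF₁ x j) ≈ 0#)
          within {c} {C′} pk (v₁ , i , v₂) t∈ with splits-sound c t∈ | mono-picks ms pk
          ... | refl | mc , msC = ≈-trans (Σ-map (joining i) (enumF n i (v₂ ++ v₁ ++ u) (C′ ++ v ∷ [])))
            (Σ-0∈ (enumF n i (v₂ ++ v₁ ++ u) (C′ ++ v ∷ [])) (λ {o} o∈ → vanish o o∈))
            where
            mono-i : Mono p b (i ∷ v₂ ++ v₁ ++ u)
            mono-i (here refl) = mc (∈-++⁺ʳ v₁ (here refl))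
            mono-i (there z∈) with ∈-++⁻ v₂ z∈
            ... | inj₁ q = mc (∈-++⁺ʳ v₁ (there q))
            ... | inj₂ q with ∈-++⁻ v₁ q
            ...   | inj₁ r = mc (∈-++⁺ˡ r)
            ...   | inj₂ r = m (there r)
            vanish : ∀ o → o ∈ enumF n i (v₂ ++ v₁ ++ u) (C′ ++ v ∷ []) → gateF₁ x j (joining i o) ≈ 0#
            vanish (w , A , nb , jn) o∈ = gate-≡ _ (trans (same-colour {x} {i} {w} {A} {suc jn} (trans (m (here refl)) (sym (mc (∈-++⁺ʳ v₁ (here refl))))))
              (zero-joins jn (FD-nocross p b (enumF-sound n i (v₂ ++ v₁ ++ u) (C′ ++ v ∷ []) o∈))))
              where
              zero-joins : ∀ k → (k ≡ 0 → Mono p b (i ∷ v₂ ++ v₁ ++ u) → All (λ c → ∃[ b ] Mono p b c) (C′ ++ v ∷ []) → NoCross p ((i ∷ w) ∷ A)) →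
                any (crosses p) ((i ∷ w) ∷ A) ∧ (suc k ≡ᵇ 1) ≡ false
              zero-joins zero    nc = cong (_∧ true) (nc refl mono-i (monos msC))
              zero-joins (suc k) nc with any (crosses p) ((i ∷ w) ∷ A)
              ... | true  = refl
              ... | false = refl
          -- Joining to `v` makes the current cycle two-coloured at once, so the rest is counted by
          -- `ΣF₀`, whatever its colours.
          across : ∀ {t} → t ∈ splits v → (let (v₁ , i , v₂) = t in
            Σ[ map (joining i) (enumF n i (v₂ ++ v₁ ++ u) C) ] (gateF₁ x j) ≈ f (suc j) (length v₀ ℕ.+ length u) * PW C)
          across {v₁ , i , v₂} t∈ = ≈-trans (Σ-map (joining i) (enumF n i (v₂ ++ v₁ ++ u) C))
            (≈-trans (Σ-cong (enumF n i (v₂ ++ v₁ ++ u) C) (λ (w , A , nb , jn) → gate-≡ _ (other-colour {x} {i} {w} {A} {jn} (m (here refl)) (v-mono i∈))))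
              (≈-trans (ΣF₀ (suc j) n i (v₂ ++ v₁ ++ u) C len′) (*-congʳ (reflexive (cong (f (suc j)) len″)))))
            where
            v≡ : v ≡ v₁ ++ i ∷ v₂
            v≡ = splits-sound v t∈
            i∈ : i ∈ v
            i∈ = subst (i ∈_) (sym v≡) (∈-++⁺ʳ v₁ (here refl))
            len′ : length ((v₂ ++ v₁ ++ u) ++ concat C) ≡ n
            len′ = ℕ.suc-injective (trans (sym (trans (↭-length (join-letters u C v₁ i v₂ [])) (cong (λ t → suc (length ((v₂ ++ v₁ ++ u) ++ concat t))) (++-identityʳ C))))
                     (trans (cong (λ t → length (u ++ concat (C ++ t ∷ []))) (sym v≡)) len))
            len″ : length (v₂ ++ v₁ ++ u) ≡ length v₀ ℕ.+ length u
            len″ = trans (cong length (sym (++-assoc v₂ v₁ u))) (trans (length-++ (v₂ ++ v₁)) (cong (ℕ._+ length u)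
                     (ℕ.suc-injective (trans (↭-length (++-comm (i ∷ v₂) v₁)) (cong length (sym v≡))))))

-- The annular condition for a peeling of the two circles.

module OnCircles (r s : ℕ) (r≥1 : 1 ≤ r) (s≥1 : 1 ≤ s) (C : Cycles) (letters : concat C ↭ upTo (r ℕ.+ s)) (two : length C ≡ 2) (full : empties C ≡ 0)
                 (γ : ∀ {z} → z < r ℕ.+ s → gamma r s z ≡ perm C z) where

  N : ℕ
  N = r ℕ.+ s

  unC : Unique (concat C)
  unC = Unique-resp-↭ (↭-sym letters) (Unique.upTo⁺ N)

  module _ {A nb jn} (o∈ : (A , nb , jn) ∈ enumH N C) where

    private
      module V = Valid (HD-valid (enumH-sound N C o∈) unC)
      module B = Cofactor V.cof

      lettersA : concat A ↭ upTo N
      lettersA = ↭-trans V.letters letters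

      lettersB : concat B.B ↭ upTo N
      lettersB = ↭-trans B.letters letters

      a : ℕ → ℕ
      a = at (word N (perm A))

      rep : ∀ {z} → z < N → a z ≡ perm A z
      rep = at-word N (perm A)

      cofactor-rep : ∀ {z} → z < N → inverse N a (gamma r s z) ≡ perm B.B z
      cofactor-rep {z} z< = trans (cong (inverse N a) (trans (γ z<) (trans (sym (B.factors z)) (sym (rep Bz<)))))
        (inverse-image N a (λ y< z< e → perm-injective A (trans (sym (rep y<)) (trans e (rep z<)))) Bz<)
        where Bz< = perm-range {B.B} lettersB z<

      module RA = Represented N a A lettersA V.nonEmpty rep
      module RB = Represented N (inverse N a ∘ₚ gamma r s) B.B lettersB B.nonEmpty cofactor-rep

      size-B : length B.B ≡ nb
      size-B = trans (sym (trans (cong (length B.B ℕ.+_) full) (ℕ.+-identityʳ _))) B.size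

      euler : nb ℕ.+ length A ℕ.+ 2 ℕ.* jn ≡ N ℕ.+ 2
      euler = trans V.euler (cong₂ ℕ._+_ (trans (↭-length letters) (length-upTo N)) two)

      -- By `euler` for two circles, #(α) + #(α⁻¹γ) + 2 jn = N + 2, so the count required of an
      -- annular permutation singles out jn = 1.
      genus : (numCycles N a ℕ.+ numCycles N (inverse N a ∘ₚ gamma r s) ≡ᵇ N) ≡ (jn ≡ᵇ 1)
      genus = trans (cong (_≡ᵇ N) (trans (cong₂ ℕ._+_ RA.numCycles-≡ (trans RB.numCycles-≡ size-B)) (ℕ.+-comm (length A) nb)))
        (T-ext (λ t → ℕ.≡⇒≡ᵇ jn 1 (ℕ.*-cancelˡ-≡ jn 1 2 (ℕ.+-cancelˡ-≡ N _ _ (trans (cong (ℕ._+ 2 ℕ.* jn) (sym (ℕ.≡ᵇ⇒≡ (nb ℕ.+ length A) N t))) euler))))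
               (λ t → ℕ.≡⇒≡ᵇ _ N (ℕ.+-cancelʳ-≡ 2 _ N (trans (cong (λ k → nb ℕ.+ length A ℕ.+ 2 ℕ.* k) (sym (ℕ.≡ᵇ⇒≡ jn 1 t))) euler))))

    annular-crosses : isAnnularNC r s (word N (perm A)) ≡ any (crosses (_<ᵇ r)) A ∧ (jn ≡ᵇ 1)
    annular-crosses = cong₂ _∧_ (Transitivity.transitive-crosses r s r≥1 s≥1 A lettersA a rep) genus

    annular-lengths : cycleLengths N a ↭ map length A
    annular-lengths = RA.cycleLengths-↭

-- Sums over annular non-crossing permutations.

module AnnularSum (S : CommutativeSemiring 0ℓ 0ℓ) (κ : ℕ → CommutativeSemiring.Carrier S) where
  open CommutativeSemiring S renaming (refl to ≈-refl; sym to ≈-sym; trans to ≈-trans)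
  open Semi S
  open Gates S
  open PlanarSums S κ
  open import Relation.Binary.Reasoning.Setoid setoid

  ΣSNC : ℕ → ℕ → Carrier
  ΣSNC r s = Σ[ SNC r s ] (λ α → Πκ κ (cycleLengths (r ℕ.+ s) (at α)))

  module _ {W f} (pl : Planar W f) (r s : ℕ) (r≥1 : 1 ≤ r) (s≥1 : 1 ≤ s) where

    ΣSNC-enum : ∀ C → (letters : concat C ↭ upTo (r ℕ.+ s)) → length C ≡ 2 → empties C ≡ 0 → (∀ {z} → z < r ℕ.+ s → gamma r s z ≡ perm C z) →
      ΣSNC r s ≈ Σ[ enumH (r ℕ.+ s) C ] (λ (A , nb , jn) → gate (any (crosses (_<ᵇ r)) A ∧ (jn ≡ᵇ 1)) (weightH A))
    ΣSNC-enum C letters two full γ = begin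
      ΣSNC r s
        ≈⟨ Σ-filter (isAnnularNC r s) (Perms N) ⟩
      Σ[ Perms N ] (λ α → gate (isAnnularNC r s α) (Πκ κ (cycleLengths N (at α))))
        ≈⟨ Σ-↭ (enumeration-↭ N C letters) ⟨
      Σ[ map (λ o → word N (perm (proj₁ o))) (enumH N C) ] (λ α → gate (isAnnularNC r s α) (Πκ κ (cycleLengths N (at α))))
        ≈⟨ Σ-map _ (enumH N C) ⟩
      Σ[ enumH N C ] (λ (A , nb , jn) → gate (isAnnularNC r s (word N (perm A))) (Πκ κ (cycleLengths N (at (word N (perm A))))))
        ≈⟨ Σ-cong∈ (enumH N C) (λ {(A , nb , jn)} o∈ → ≈-trans (gate-≡ _ (annular-crosses o∈)) (gate-cong (any (crosses (_<ᵇ r)) A ∧ (jn ≡ᵇ 1)) (Πκ-↭ κ (annular-lengths o∈)))) ⟩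
      Σ[ enumH N C ] (λ (A , nb , jn) → gate (any (crosses (_<ᵇ r)) A ∧ (jn ≡ᵇ 1)) (weightH A)) ∎
      where open OnCircles r s r≥1 s≥1 C letters two full γ

    private
      un : Unique (concat (circles r s))
      un = subst Unique (sym (circles-letters r s)) (Unique.upTo⁺ (r ℕ.+ s))

      outer-mono : Mono (_<ᵇ r) true (iota 0 r)
      outer-mono q = T⇒≡ (ℕ.<⇒<ᵇ (proj₂ (∈-iota⁻ 0 r q)))

      inner-mono : Mono (_<ᵇ r) false (iota r s)
      inner-mono {z} q = ¬T⇒≡ (λ t → ℕ.<⇒≱ (ℕ.<ᵇ⇒< z r t) (proj₁ (∈-iota⁻ r s q)))

      collapse : ∀ y w → y * 1# + w * 0# ≈ y
      collapse y w = ≈-trans (+-cong (*-identityʳ y) (zeroʳ w)) (+-identityʳ y)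

      iota-cons : ∀ {a n} → 1 ≤ n → ∃[ m ] iota a n ≡ a ∷ iota (suc a) m × n ≡ suc m
      iota-cons (s≤s {n = m} _) = m , refl , refl

      empties-0 : ∀ {a b m n} → 1 ≤ m → 1 ≤ n → empties (iota a m ∷ iota b n ∷ []) ≡ 0
      empties-0 (s≤s _) (s≤s _) = refl

    -- Peeling starts on the outer circle, the inner one taking the place of `v`; `ΣSNC-inner`
    -- evaluates the same sum with the roles exchanged. Each evaluation serves one of the summands
    -- 1/s and 1/r of n/(rs).
    ΣSNC-outer : ∀ {Y g} → Annular pl s Y g → ΣSNC r s ≈ Y r
    ΣSNC-outer {Y} {g} an with iota-cons {r} s≥1
    ... | m , e , refl = ≈-trans (ΣSNC-enum (circles r s) (↭-reflexive (circles-letters r s)) refl (empties-0 r≥1 s≥1) (gamma-perm r s))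
      (≈-trans (ΣH₁ pl (_<ᵇ r) true r (iota (suc r) m) inner-mono an′ (r ℕ.+ s) (iota 0 r ∷ []) un
          (trans (cong length (circles-letters r s)) (length-upTo (r ℕ.+ s))) (outer-mono ∷ []))
        (≈-trans (collapse _ _) (reflexive (cong Y (length-iota 0 r)))))
      where
      an′ : Annular pl (suc (length (iota (suc r) m))) Y g
      an′ = subst (λ t → Annular pl (suc t) Y g) (sym (length-iota (suc r) m)) an

    ΣSNC-inner : ∀ {Y g} → Annular pl r Y g → ΣSNC r s ≈ Y s
    ΣSNC-inner {Y} {g} an with iota-cons {0} r≥1
    ... | m , e , refl = ≈-trans (ΣSNC-enum C (↭-trans letters′ (↭-reflexive (circles-letters r s))) refl (empties-0 s≥1 r≥1)
          (λ {z} z< → trans (gamma-perm r s z<) (perm-↭ (↭-swap (iota 0 r) (iota r s) (↭-refl {x = []})) un z)))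
      (≈-trans (ΣH₁ pl (_<ᵇ r) false 0 (iota 1 m) outer-mono an′ (r ℕ.+ s) (iota r s ∷ []) (Unique-resp-↭ (↭-sym letters′) un)
          (trans (↭-length letters′) (trans (cong length (circles-letters r s)) (length-upTo (r ℕ.+ s)))) (inner-mono ∷ []))
        (≈-trans (collapse _ _) (reflexive (cong Y (length-iota r s)))))
      where
      C : Cycles
      C = iota r s ∷ iota 0 r ∷ []
      letters′ : concat C ↭ concat (circles r s)
      letters′ = concat-↭ (↭-swap (iota r s) (iota 0 r) (↭-refl {x = []}))
      an′ : Annular pl (suc (length (iota 1 m))) Y g
      an′ = subst (λ t → Annular pl (suc t) Y g) (sym (length-iota 1 m)) an

-- Non-crossing partitions.

-- Labels count from 0, so inc (length sz) opens a new block; larger labels do not occur in restricted growth strings.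
inc : ℕ → List ℕ → List ℕ
inc zero    []       = 1 ∷ []
inc (suc j) []       = []
inc zero    (s ∷ sz) = suc s ∷ sz
inc (suc j) (s ∷ sz) = s ∷ inc j sz

final : List ℕ → List ℕ → List ℕ
final sz []      = sz
final sz (j ∷ w) = final (inc j sz) w

nextLabel : ℕ → ℕ → ℕ
nextLabel j m = if j ≡ᵇ m then suc m else m

data RGS : ℕ → List ℕ → Set where
  []  : ∀ {m} → RGS m []
  _∷_ : ∀ {m j w} → j ≤ m → RGS (nextLabel j m) w → RGS m (j ∷ w)

rgsFrom-sound : ∀ k m {w} → w ∈ rgsFrom k m → RGS m w × length w ≡ k
rgsFrom-sound zero    m (here refl) = [] , refl
rgsFrom-sound (suc k) m w∈ with find (∈-concatMap⁻ _ {xs = upTo (suc m)} w∈)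
... | j , j∈ , w∈′ with ∈-map⁻ (j ∷_) w∈′
...   | w , w∈″ , refl with rgsFrom-sound k (nextLabel j m) w∈″
...     | r , l = ℕ.≤-pred (∈-upTo⁻ j∈) ∷ r , cong suc l

nextLabel-< : ∀ {j m} → j < m → nextLabel j m ≡ m
nextLabel-< {j} {m} j< = cong (if_then suc m else m) (¬T⇒≡ (λ t → ℕ.<⇒≢ j< (ℕ.≡ᵇ⇒≡ j m t)))

nextLabel-≡ : ∀ m → nextLabel m m ≡ suc m
nextLabel-≡ m = cong (if_then suc m else m) (T⇒≡ (ℕ.≡⇒≡ᵇ m m refl))

length-inc : ∀ j sz → j ≤ length sz → length (inc j sz) ≡ nextLabel j (length sz)
length-inc zero    []       p = refl
length-inc zero    (s ∷ sz) p = refl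
length-inc (suc j) (s ∷ sz) (s≤s p) = trans (cong suc (length-inc j sz p)) (push (j ≡ᵇ length sz))
  where push : ∀ b → suc (if b then suc (length sz) else length sz) ≡ (if b then suc (suc (length sz)) else suc (length sz))
        push true  = refl
        push false = refl

at-inc : ∀ j sz i → j ≤ length sz → at (inc j sz) i ≡ at sz i ℕ.+ (if i ≡ᵇ j then 1 else 0)
at-inc zero    []       zero    p = refl
at-inc zero    []       (suc i) p = refl
at-inc zero    (s ∷ sz) zero    p = ℕ.+-comm 1 s
at-inc zero    (s ∷ sz) (suc i) p = sym (ℕ.+-identityʳ _)
at-inc (suc j) (s ∷ sz) zero    (s≤s p) = sym (ℕ.+-identityʳ s)
at-inc (suc j) (s ∷ sz) (suc i) (s≤s p) = at-inc j sz i p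

count-∷ : ∀ (p : ℕ → Bool) x xs → count p (x ∷ xs) ≡ (if p x then 1 else 0) ℕ.+ count p xs
count-∷ p x xs with p x
... | true  = refl
... | false = refl

at-final : ∀ {sz w} → RGS (length sz) w → ∀ i → at (final sz w) i ≡ at sz i ℕ.+ count (i ≡ᵇ_) w
at-final [] i = sym (ℕ.+-identityʳ _)
at-final {sz} {j ∷ w} (j≤ ∷ r) i = trans (at-final {inc j sz} {w} (subst (λ m → RGS m w) (sym (length-inc j sz j≤)) r) i)
  (trans (cong (ℕ._+ count (i ≡ᵇ_) w) (at-inc j sz i j≤))
    (trans (ℕ.+-assoc (at sz i) _ _) (cong (at sz i ℕ.+_) (sym (count-∷ (i ≡ᵇ_) j w)))))

inc-positive : ∀ j {sz} → All (1 ≤_) sz → All (1 ≤_) (inc j sz)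
inc-positive zero    []       = s≤s z≤n ∷ []
inc-positive (suc j) []       = []
inc-positive zero    (p ∷ ps) = s≤s z≤n ∷ ps
inc-positive (suc j) (p ∷ ps) = p ∷ inc-positive j ps

final-positive : ∀ {sz} w → All (1 ≤_) sz → All (1 ≤_) (final sz w)
final-positive []      ps = ps
final-positive (j ∷ w) ps = final-positive w (inc-positive j ps)

length-inc-≤ : ∀ j sz → length (inc j sz) ≤ suc (length sz)
length-inc-≤ zero    []       = ℕ.≤-refl
length-inc-≤ (suc j) []       = z≤n
length-inc-≤ zero    (s ∷ sz) = ℕ.n≤1+n _
length-inc-≤ (suc j) (s ∷ sz) = s≤s (length-inc-≤ j sz)

length-final-≤ : ∀ sz w → length (final sz w) ≤ length sz ℕ.+ length w
length-final-≤ sz []      = ℕ.≤-reflexive (sym (ℕ.+-identityʳ _))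
length-final-≤ sz (j ∷ w) = ℕ.≤-trans (length-final-≤ (inc j sz) w)
  (ℕ.≤-trans (ℕ.+-monoˡ-≤ (length w) (length-inc-≤ j sz)) (ℕ.≤-reflexive (sym (ℕ.+-suc _ _))))

at-beyond : ∀ xs {i} → length xs ≤ i → at xs i ≡ 0
at-beyond []       p = refl
at-beyond (x ∷ xs) (s≤s p) = at-beyond xs p

count-0 : ∀ (p : ℕ → Bool) xs → ¬ T (any p xs) → count p xs ≡ 0
count-0 p []       h = refl
count-0 p (x ∷ xs) h = trans (count-∷ p x xs) (cong₂ ℕ._+_ (cong (if_then 1 else 0) (¬T⇒≡ (λ t → h (any-T p {x ∷ xs} (here refl) t))))
  (count-0 p xs (λ t → let y , y∈ , q = T-any p xs t in h (any-T p (there y∈) q))))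

count-pos : ∀ (p : ℕ → Bool) xs → T (any p xs) → 1 ≤ count p xs
count-pos p xs t with T-any p xs t
... | y , y∈ , q = go xs y∈
  where
  go : ∀ xs → y ∈ xs → 1 ≤ count p xs
  go (x ∷ xs) (here refl) = subst (1 ≤_) (sym (trans (count-∷ p x xs) (cong (λ b → (if b then 1 else 0) ℕ.+ count p xs) (T⇒≡ q)))) (s≤s z≤n)
  go (x ∷ xs) (there y∈)  = subst (1 ≤_) (sym (count-∷ p x xs)) (ℕ.≤-trans (go xs y∈) (ℕ.m≤n+m _ _))

module _ {π} (r : RGS 0 π) where
  private L = length (final [] π)

  numBlocks-final : numBlocks π ≡ L
  numBlocks-final = trans (↭-length (unique-set-↭ (Unique.filter⁺ (T? ∘ occurs) (Unique.upTo⁺ (length π))) (Unique.upTo⁺ L) to from)) (length-upTo L)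
    where
    occurs : ℕ → Bool
    occurs j = any (j ≡ᵇ_) π
    to : ∀ {j} → j ∈ filterᵇ occurs (upTo (length π)) → j ∈ upTo L
    to {j} j∈ with j ℕ.<? L
    ... | yes j<L = ∈-upTo⁺ j<L
    ... | no j≮L = ⊥-elim (ℕ.<-irrefl (sym (trans (sym (at-final r j)) (at-beyond (final [] π) (ℕ.≮⇒≥ j≮L))))
                    (count-pos (j ≡ᵇ_) π (proj₂ (∈-filter⁻ (T? ∘ occurs) {xs = upTo (length π)} j∈))))
    from : ∀ {j} → j ∈ upTo L → j ∈ filterᵇ occurs (upTo (length π))
    from {j} j∈ = ∈-filter⁺ (T? ∘ occurs) (∈-upTo⁺ (ℕ.<-≤-trans (∈-upTo⁻ j∈) (length-final-≤ [] π))) h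
      where
      h : T (occurs j)
      h with T? (occurs j)
      ... | yes t = t
      ... | no ¬t = ⊥-elim (ℕ.<-irrefl (sym (trans (at-final r j) (count-0 (j ≡ᵇ_) π ¬t)))
                      (All.lookup (final-positive π []) (at-∈ (final [] π) (∈-upTo⁻ j∈))))

  -- Counting is replaced by an accumulator that grows letter by letter, the form that inductions
  -- along words need.
  blockSizes-final : blockSizes π ≡ final [] π
  blockSizes-final = trans (cong (λ k → map (λ j → count (j ≡ᵇ_) π) (upTo k)) numBlocks-final)
    (trans (map-cong-local (All.tabulate (λ {j} _ → sym (at-final r j)))) (map-at (final [] π)))

-- The labels of blocks that can be continued without crossing, most recent first.
below : ℕ → List ℕ → Maybe (List ℕ)
below j []       = nothing
below j (l ∷ st) = if j ≡ᵇ l then just st else below j st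

mutual
  -- A stack machine: resuming a block discards the more recent ones, which no later letter can
  -- continue without a crossing.
  accepts : List ℕ → ℕ → List ℕ → Bool
  accepts st m []      = true
  accepts st m (j ∷ w) = if j ≡ᵇ m then accepts (m ∷ st) (suc m) w else resume j m w (below j st)

  resume : ℕ → ℕ → List ℕ → Maybe (List ℕ) → Bool
  resume j m w nothing   = false
  resume j m w (just st) = accepts (j ∷ st) m w

below-∈ : ∀ st₁ j st₂ → j ∉ st₁ → below j (st₁ ++ j ∷ st₂) ≡ just st₂
below-∈ []        j st₂ j∉ = cong (if_then just st₂ else below j st₂) (T⇒≡ (ℕ.≡⇒≡ᵇ j j refl))
below-∈ (l ∷ st₁) j st₂ j∉ = trans (cong (if_then just (st₁ ++ j ∷ st₂) else below j (st₁ ++ j ∷ st₂)) (¬T⇒≡ (λ t → j∉ (here (ℕ.≡ᵇ⇒≡ j l t)))))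
  (below-∈ st₁ j st₂ (j∉ ∘ there))

below-∉ : ∀ j st → j ∉ st → below j st ≡ nothing
below-∉ j []       j∉ = refl
below-∉ j (l ∷ st) j∉ = trans (cong (if_then just st else below j st) (¬T⇒≡ (λ t → j∉ (here (ℕ.≡ᵇ⇒≡ j l t))))) (below-∉ j st (j∉ ∘ there))

accepts-new : ∀ st m w → accepts st m (m ∷ w) ≡ accepts (m ∷ st) (suc m) w
accepts-new st m w = cong (if_then accepts (m ∷ st) (suc m) w else resume m m w (below m st)) (T⇒≡ (ℕ.≡⇒≡ᵇ m m refl))

accepts-old : ∀ st {m j} w → j < m → accepts st m (j ∷ w) ≡ resume j m w (below j st)
accepts-old st {m} {j} w j< = cong (if_then accepts (m ∷ st) (suc m) w else resume j m w (below j st)) (¬T⇒≡ (λ t → ℕ.<⇒≢ j< (ℕ.≡ᵇ⇒≡ j m t)))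

split-at : ∀ sz {l} → l < length sz → ∃[ p ] ∃[ q ] (sz ≡ p ++ at sz l ∷ q × inc l sz ≡ p ++ suc (at sz l) ∷ q)
split-at (s ∷ sz) {zero}  l<       = [] , sz , refl , refl
split-at (s ∷ sz) {suc l} (s≤s l<) with split-at sz l<
... | p , q , e , e′ = s ∷ p , q , cong (s ∷_) e , cong (s ∷_) e′

inc-new : ∀ sz → inc (length sz) sz ≡ sz ++ 1 ∷ []
inc-new []       = refl
inc-new (s ∷ sz) = cong (s ∷_) (inc-new sz)

at-inc-other : ∀ j sz {i} → j ≤ length sz → i ≢ j → at (inc j sz) i ≡ at sz i
at-inc-other j sz {i} j≤ i≢j = trans (at-inc j sz i j≤)
  (trans (cong (λ b → at sz i ℕ.+ (if b then 1 else 0)) (¬T⇒≡ (λ t → i≢j (ℕ.≡ᵇ⇒≡ i j t)))) (ℕ.+-identityʳ _))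

at-inc-same : ∀ j sz → j ≤ length sz → at (inc j sz) j ≡ suc (at sz j)
at-inc-same j sz j≤ = trans (at-inc j sz j j≤)
  (trans (cong (λ b → at sz j ℕ.+ (if b then 1 else 0)) (T⇒≡ (ℕ.≡⇒≡ᵇ j j refl))) (ℕ.+-comm (at sz j) 1))

-- Summation over the words accepted by the stack.

module NonCrossingSums (S : CommutativeSemiring 0ℓ 0ℓ) (κ : ℕ → CommutativeSemiring.Carrier S) where
  open CommutativeSemiring S renaming (refl to ≈-refl; sym to ≈-sym; trans to ≈-trans)
  open Semi S
  open Gates S
  open import Algebra.Solver.Ring.NaturalCoefficients.Default S using (solve; _:=_; _:+_; _:*_; con)
  open import Relation.Binary.Reasoning.Setoid setoid

  delay-⊛ : ∀ f g → delay f ⊛ g ≋ delay (f ⊛ g)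
  delay-⊛ f g zero    = zeroˡ _
  delay-⊛ f g (suc n) = ≈-trans (+-congʳ (zeroˡ _)) (+-identityˡ _)

  delay-cong : ∀ {a b} → a ≋ b → delay a ≋ delay b
  delay-cong e zero    = ≈-refl
  delay-cong e (suc n) = e n

  ⊛-delay : ∀ f g → f ⊛ delay g ≋ delay (f ⊛ g)
  ⊛-delay f g n = ≈-trans (⊛-comm f (delay g) n) (≈-trans (delay-⊛ g f n) (delay-cong (⊛-comm g f) n))

  delay-+ : ∀ a b → delay (a ⊞ b) ≋ delay a ⊞ delay b
  delay-+ a b zero    = ≈-sym (+-identityˡ _)
  delay-+ a b (suc n) = ≈-refl

  delay-* : ∀ c a → delay (λ i → c * a i) ≋ (λ i → c * delay a i)
  delay-* c a zero    = ≈-sym (zeroʳ c)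
  delay-* c a (suc n) = ≈-refl

  module _ (W : Seq) (F : ℕ → Seq) (W-zero : W 0 ≈ 1#) (W-suc : ∀ n → W (suc n) ≈ F 1 n)
           (F-step : ∀ j n → F j n ≈ κ j * W n + delay (W ⊛ F (suc j)) n) where

    -- touch ss counts the words whose first letter continues one of the open blocks, of sizes ss;
    -- after h c ss counts the words that first stay above these blocks, in a way counted by c.
    mutual
      after : Seq → List ℕ → Seq
      after c ss n = Πκ κ ss * c n + delay (c ⊛ touch ss) n

      touch : List ℕ → Seq
      touch []       n = 0#
      touch (s ∷ ss) n = after (F (suc s)) ss n + κ s * touch ss n

    -- The top block is never touched again, or resumed, or closed by resuming a deeper one.
    -- Collecting the three cases by `F-step` absorbs the top block into the counting series.
    after-∷ : ∀ s ss n → after W (s ∷ ss) n ≈ after (F s) ss n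
    after-∷ s ss n = begin
      (κ s * P) * W n + delay (W ⊛ touch (s ∷ ss)) n
        ≈⟨ +-congˡ (delay-cong (λ i → ≈-trans (⊛-distribˡ W (after (F (suc s)) ss) (λ j → κ s * touch ss j) i)
             (+-cong (⊛-distribˡ W (λ j → P * F (suc s) j) (delay (F (suc s) ⊛ touch ss)) i) (⊛scale (κ s) W (touch ss) i))) n) ⟩
      (κ s * P) * W n + delay ((W ⊛ (λ j → P * F (suc s) j) ⊞ W ⊛ delay (F (suc s) ⊛ touch ss)) ⊞ (λ i → κ s * (W ⊛ touch ss) i)) n
        ≈⟨ +-congˡ (≈-trans (delay-+ (W ⊛ (λ j → P * F (suc s) j) ⊞ W ⊛ delay (F (suc s) ⊛ touch ss)) (λ i → κ s * (W ⊛ touch ss) i) n)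
             (+-cong (delay-+ (W ⊛ (λ j → P * F (suc s) j)) (W ⊛ delay (F (suc s) ⊛ touch ss)) n) (delay-* (κ s) (W ⊛ touch ss) n))) ⟩
      (κ s * P) * W n + ((delay (W ⊛ (λ j → P * F (suc s) j)) n + delay (W ⊛ delay (F (suc s) ⊛ touch ss)) n) + κ s * delay (W ⊛ touch ss) n)
        ≈⟨ +-congˡ (+-congʳ (+-cong (≈-trans (delay-cong (⊛scale P W (F (suc s))) n) (delay-* P (W ⊛ F (suc s)) n)) (delay-cong swap n))) ⟩
      (κ s * P) * W n + ((P * delay (W ⊛ F (suc s)) n + delay (delay (W ⊛ F (suc s)) ⊛ touch ss) n) + κ s * delay (W ⊛ touch ss) n)
        ≈⟨ solve 6 (λ k p w a b c → (k :* p) :* w :+ ((p :* a :+ b) :+ k :* c) := p :* (k :* w :+ a) :+ (k :* c :+ b)) ≈-refl (κ s) P (W n) _ _ _ ⟩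
      P * (κ s * W n + delay (W ⊛ F (suc s)) n) + (κ s * delay (W ⊛ touch ss) n + delay (delay (W ⊛ F (suc s)) ⊛ touch ss) n)
        ≈⟨ +-cong (*-congˡ (≈-sym (F-step s n))) (≈-sym F-touch) ⟩
      P * F s n + delay (F s ⊛ touch ss) n ∎
      where
      P = Πκ κ ss
      swap : W ⊛ delay (F (suc s) ⊛ touch ss) ≋ delay (W ⊛ F (suc s)) ⊛ touch ss
      swap i = ≈-trans (⊛-delay W (F (suc s) ⊛ touch ss) i) (≈-trans (delay-cong (λ k → ≈-sym (⊛-assoc W (F (suc s)) (touch ss) k)) i)
                 (≈-sym (delay-⊛ (W ⊛ F (suc s)) (touch ss) i)))
      F-touch : delay (F s ⊛ touch ss) n ≈ κ s * delay (W ⊛ touch ss) n + delay (delay (W ⊛ F (suc s)) ⊛ touch ss) n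
      F-touch = ≈-trans (delay-cong (λ i → ≈-trans (⊛-cong {g = touch ss} (F-step s) (λ _ → ≈-refl) i)
          (≈-trans (⊛-distribʳ (touch ss) (λ j → κ s * W j) (delay (W ⊛ F (suc s))) i) (+-congʳ (scale⊛ (κ s) W (touch ss) i)))) n)
        (≈-trans (delay-+ (λ i → κ s * (W ⊛ touch ss) i) (delay (W ⊛ F (suc s)) ⊛ touch ss) n) (+-congʳ (delay-* (κ s) (W ⊛ touch ss) n)))

    -- By the first letter: it opens a new block or continues an open one.
    after-suc : ∀ ss n → after W ss (suc n) ≈ after W (1 ∷ ss) n + touch ss n
    after-suc ss n = begin
      P * W (suc n) + (W ⊛ touch ss) n
        ≈⟨ +-cong (*-congˡ (W-suc n)) (split n) ⟩
      P * F 1 n + (touch ss n + delay (F 1 ⊛ touch ss) n)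
        ≈⟨ solve 3 (λ a b c → a :+ (b :+ c) := (a :+ c) :+ b) ≈-refl _ _ _ ⟩
      after (F 1) ss n + touch ss n
        ≈⟨ +-congʳ (after-∷ 1 ss n) ⟨
      after W (1 ∷ ss) n + touch ss n ∎
      where
      P = Πκ κ ss
      split : ∀ n → (W ⊛ touch ss) n ≈ touch ss n + delay (F 1 ⊛ touch ss) n
      split zero    = ≈-trans (*-congʳ W-zero) (≈-trans (*-identityˡ _) (≈-sym (+-identityʳ _)))
      split (suc n) = +-cong (≈-trans (*-congʳ W-zero) (*-identityˡ _)) (⊛-cong {g = touch ss} W-suc (λ _ → ≈-refl) n)

    after-zero : ∀ ss → after W ss 0 ≈ Πκ κ ss
    after-zero ss = ≈-trans (+-identityʳ _) (≈-trans (*-congˡ W-zero) (*-identityʳ _))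

    touch-splits : ∀ (size : ℕ → ℕ) st n → touch (map size st) n ≈
      Σ[ splits st ] (λ (a , l , b) → Πκ κ (map size a) * after W (suc (size l) ∷ map size b) n)
    touch-splits size []       n = ≈-refl
    touch-splits size (l ∷ st) n = +-cong (≈-trans (≈-sym (after-∷ (suc (size l)) (map size st) n)) (≈-sym (*-identityˡ _)))
      (≈-trans (*-congˡ (touch-splits size st n)) (≈-trans (≈-sym (Σ-*ˡ _ (splits st)))
        (≈-trans (Σ-cong (splits st) (λ _ → ≈-sym (*-assoc _ _ _))) (≈-sym (Σ-map _ (splits st))))))

    -- `sz` lists the sizes of all blocks by label, `st` the labels still open, most recent first,
    -- and `cl` the sizes of the blocks that can no longer grow.
    record State (sz st cl : List ℕ) : Set where
      field
        unique : Unique st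
        bound  : ∀ {l} → l ∈ st → l < length sz
        sizes  : sz ↭ cl ++ map (at sz) st

    new-state : ∀ {sz st cl} → State sz st cl → State (inc (length sz) sz) (length sz ∷ st) cl
    new-state {sz} {st} {cl} I = record
      { unique = All.tabulate (λ l∈ e → ℕ.<⇒≢ (bound l∈) (sym e)) ∷ unique
      ; bound  = λ { (here refl) → subst (length sz <_) (sym len) ℕ.≤-refl ; (there l∈) → subst (_ <_) (sym len) (ℕ.m≤n⇒m≤1+n (bound l∈)) }
      ; sizes  = ↭-trans (↭-reflexive (inc-new sz)) (↭-trans (++-comm sz (1 ∷ [])) (↭-trans (↭-prep 1 sizes)
          (↭-trans (↭-sym (shift 1 cl (map (at sz) st))) (↭-reflexive (cong (cl ++_) (cong₂ _∷_ (sym one) (map-cong-local (All.tabulate (λ l∈ →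
            sym (at-inc-other (length sz) sz ℕ.≤-refl (ℕ.<⇒≢ (bound l∈)))))))))))) }
      where
      open State I
      len : length (inc (length sz) sz) ≡ suc (length sz)
      len = trans (length-inc (length sz) sz ℕ.≤-refl) (nextLabel-≡ (length sz))
      one : at (inc (length sz) sz) (length sz) ≡ 1
      one = trans (at-inc-same (length sz) sz ℕ.≤-refl) (cong suc (at-beyond sz ℕ.≤-refl))

    old-state : ∀ {sz a l b cl} → State sz (a ++ l ∷ b) cl → State (inc l sz) (l ∷ b) (cl ++ map (at sz) a)
    old-state {sz} {a} {l} {b} {cl} I = record
      { unique = Unique-++ʳ a unique
      ; bound  = λ l∈ → subst (_ <_) (sym len) (bound (∈-++⁺ʳ a l∈))
      ; sizes  = grow (split-at sz l<) }
      where
      open State I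
      l< : l < length sz
      l< = bound (∈-++⁺ʳ a (here refl))
      len : length (inc l sz) ≡ length sz
      len = trans (length-inc l sz (ℕ.<⇒≤ l<)) (nextLabel-< l<)
      rest : map (at (inc l sz)) b ≡ map (at sz) b
      rest = map-cong-local (All.tabulate (λ {i} i∈ → at-inc-other l sz (ℕ.<⇒≤ l<)
        (λ e → Unique-head (Unique-++ʳ a unique) (subst (_∈ b) e i∈))))
      grow : ∃[ p ] ∃[ q ] (sz ≡ p ++ at sz l ∷ q × inc l sz ≡ p ++ suc (at sz l) ∷ q) → inc l sz ↭ (cl ++ map (at sz) a) ++ map (at (inc l sz)) (l ∷ b)
      grow (p , q , e , e′) = ↭-trans (↭-reflexive e′) (↭-trans (shift _ p q) (↭-trans (↭-prep _ pq)
        (↭-trans (↭-sym (shift _ (cl ++ map (at sz) a) (map (at sz) b)))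
          (↭-reflexive (cong ((cl ++ map (at sz) a) ++_) (cong₂ _∷_ (sym (at-inc-same l sz (ℕ.<⇒≤ l<))) (sym rest)))))))
        where
        pq : p ++ q ↭ (cl ++ map (at sz) a) ++ map (at sz) b
        pq = drop-∷ (↭-trans (↭-sym (shift (at sz l) p q)) (↭-trans (↭-reflexive (sym e)) (↭-trans sizes
          (↭-trans (↭-reflexive (trans (cong (cl ++_) (map-++ (at sz) a (l ∷ b))) (sym (++-assoc cl (map (at sz) a) _))))
            (shift (at sz l) (cl ++ map (at sz) a) (map (at sz) b))))))

    ΣRGS : ∀ k {sz st cl} → State sz st cl →
      Σ[ rgsFrom k (length sz) ] (λ w → gate (accepts st (length sz) w) (Πκ κ (final sz w))) ≈ Πκ κ cl * after W (map (at sz) st) k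
    ΣRGS zero {sz} {st} {cl} I = ≈-trans (+-identityʳ _) (≈-trans (Πκ-↭ κ sizes)
      (≈-trans (Πκ-++ κ cl (map (at sz) st)) (*-congˡ (≈-sym (after-zero (map (at sz) st))))))
      where open State I
    ΣRGS (suc k) {sz} {st} {cl} I = begin
      Σ[ rgsFrom (suc k) m ] h
        ≈⟨ Σ-concatMap (λ j → map (j ∷_) (rgsFrom k (nextLabel j m))) (upTo (suc m)) ⟩
      Σ[ upTo (suc m) ] (λ j → Σ[ map (j ∷_) (rgsFrom k (nextLabel j m)) ] h)
        ≈⟨ Σ-cong (upTo (suc m)) (λ j → Σ-map (j ∷_) (rgsFrom k (nextLabel j m))) ⟩
      Σ[ upTo (suc m) ] G
        ≈⟨ Σ-↭ labels ⟩
      Σ[ m ∷ st ++ others ] G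
        ≈⟨ +-cong new (≈-trans (Σ-++ st others) (≈-trans (+-cong old (Σ-0∈ others none)) (+-identityʳ _))) ⟩
      Πκ κ cl * after W (1 ∷ ss) k + Πκ κ cl * touch ss k
        ≈⟨ ≈-trans (*-congˡ (after-suc ss k)) (distribˡ _ _ _) ⟨
      Πκ κ cl * after W ss (suc k) ∎
      where
      open State I
      m = length sz
      ss = map (at sz) st
      h : List ℕ → Carrier
      h w = gate (accepts st m w) (Πκ κ (final sz w))
      G : ℕ → Carrier
      G j = Σ[ rgsFrom k (nextLabel j m) ] (λ w → h (j ∷ w))
      isOther : ℕ → Bool
      isOther j = not (any (j ≡ᵇ_) st)
      others : List ℕ
      others = filterᵇ isOther (upTo m)
      other⁻ : ∀ {j} → j ∈ others → j < m × j ∉ st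
      other⁻ {j} j∈ with ∈-filter⁻ (T? ∘ isOther) {xs = upTo m} j∈
      ... | j< , t = ∈-upTo⁻ j< , λ q → T-not t (any-T (j ≡ᵇ_) q (ℕ.≡⇒≡ᵇ j j refl))
      -- The candidates for the next label: a new one, the open ones, and the closed ones, which
      -- `accepts` rejects.
      labels : upTo (suc m) ↭ m ∷ st ++ others
      labels = unique-set-↭ (Unique.upTo⁺ (suc m))
        (All.tabulate (λ l∈ e → ℕ.<⇒≢ (below-m l∈) (sym e)) ∷ Unique.++⁺ unique (Unique.filter⁺ (T? ∘ isOther) (Unique.upTo⁺ m)) (λ { (p , q) → proj₂ (other⁻ q) p }))
        to from
        where
        below-m : ∀ {l} → l ∈ st ++ others → l < m
        below-m l∈ with ∈-++⁻ st l∈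
        ... | inj₁ p = bound p
        ... | inj₂ q = proj₁ (other⁻ q)
        to : ∀ {j} → j ∈ upTo (suc m) → j ∈ m ∷ st ++ others
        to {j} j∈ with j ℕ.≟ m
        ... | yes e = here e
        ... | no j≢m with T? (any (j ≡ᵇ_) st)
        ...   | yes t with T-any (j ≡ᵇ_) st t
        ...     | l , l∈ , e = there (∈-++⁺ˡ (subst (_∈ st) (sym (ℕ.≡ᵇ⇒≡ j l e)) l∈))
        to {j} j∈ | no j≢m | no ¬t = there (∈-++⁺ʳ st (∈-filter⁺ (T? ∘ isOther) (∈-upTo⁺ (ℕ.≤∧≢⇒< (ℕ.≤-pred (∈-upTo⁻ j∈)) j≢m)) (not-T ¬t)))
        from : ∀ {j} → j ∈ m ∷ st ++ others → j ∈ upTo (suc m)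
        from (here refl) = ∈-upTo⁺ ℕ.≤-refl
        from (there j∈)  = ∈-upTo⁺ (ℕ.m≤n⇒m≤1+n (below-m j∈))
      step : ∀ j {st′ cl′} → j ≤ m → (∀ w → accepts st m (j ∷ w) ≡ accepts st′ (nextLabel j m) w) → State (inc j sz) st′ cl′ →
             G j ≈ Πκ κ cl′ * after W (map (at (inc j sz)) st′) k
      step j {st′} j≤ acc I′ = ≈-trans (Σ-cong (rgsFrom k (nextLabel j m)) (λ w → gate-≡ _ (acc w)))
        (≈-trans (reflexive (cong (λ m′ → Σ[ rgsFrom k m′ ] (λ w → gate (accepts st′ m′ w) (Πκ κ (final (inc j sz) w)))) (sym (length-inc j sz j≤)))) (ΣRGS k I′))
      new : G m ≈ Πκ κ cl * after W (1 ∷ ss) k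
      new = ≈-trans (step m ℕ.≤-refl (λ w → trans (accepts-new st m w) (cong (λ t → accepts (m ∷ st) t w) (sym (nextLabel-≡ m)))) (new-state I))
        (*-congˡ (reflexive (cong (λ t → after W t k) (cong₂ _∷_ (trans (at-inc-same m sz ℕ.≤-refl) (cong suc (at-beyond sz ℕ.≤-refl)))
          (map-cong-local (All.tabulate (λ l∈ → at-inc-other m sz ℕ.≤-refl (ℕ.<⇒≢ (bound l∈)))))))))
      old : Σ[ st ] G ≈ Πκ κ cl * touch ss k
      old = ≈-trans (reflexive (cong (λ t → Σ[ t ] G) (sym (splits-keys st)))) (≈-trans (Σ-map _ (splits st)) (≈-trans (Σ-cong∈ (splits st) each)
        (≈-trans (Σ-*ˡ (Πκ κ cl) (splits st)) (*-congˡ (≈-sym (touch-splits (at sz) st k))))))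
        where
        each : ∀ {t} → t ∈ splits st → (let (a , l , b) = t in G l ≈ Πκ κ cl * (Πκ κ (map (at sz) a) * after W (suc (at sz l) ∷ map (at sz) b) k))
        each {a , l , b} t∈ = ≈-trans (step l (ℕ.<⇒≤ l<) acc (old-state I′))
          (≈-trans (*-cong (Πκ-++ κ cl (map (at sz) a)) (reflexive (cong (λ t → after W t k) (cong₂ _∷_ (at-inc-same l sz (ℕ.<⇒≤ l<))
            (map-cong-local (All.tabulate (λ {i} i∈ → at-inc-other l sz (ℕ.<⇒≤ l<) (λ e → Unique-head (Unique-++ʳ a unique′) (subst (_∈ b) e i∈)))))))))
            (*-assoc _ _ _))
          where
          st≡ : st ≡ a ++ l ∷ b
          st≡ = splits-sound st t∈
          I′ : State sz (a ++ l ∷ b) cl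
          I′ = subst (λ t → State sz t cl) st≡ I
          unique′ = State.unique I′
          l< : l < m
          l< = State.bound I′ (∈-++⁺ʳ a (here refl))
          acc : ∀ w → accepts st m (l ∷ w) ≡ accepts (l ∷ b) (nextLabel l m) w
          acc w = trans (accepts-old st w l<) (trans (cong (resume l m w) (trans (cong (below l) st≡) (below-∈ a l b (λ q → Unique-disjoint a unique′ q (here refl)))))
            (cong (λ t → accepts (l ∷ b) t w) (sym (nextLabel-< l<))))
      none : ∀ {j} → j ∈ others → G j ≈ 0#
      none {j} j∈ with other⁻ j∈
      ... | j< , j∉ = Σ-0 (rgsFrom k (nextLabel j m)) (λ w → gate-≡ _ (trans (accepts-old st w j<) (cong (resume j m w) (below-∉ j st j∉))))

-- The Boolean test for crossings agrees with the stack.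

-- Placing the label l at position e would cross an earlier pair of equal labels.
record Blocked (π : List ℕ) (e l : ℕ) : Set where
  constructor blocked
  field
    {a b c} : ℕ
    a<b : a < b
    b<c : b < c
    c<e : c < e
    ac  : at π a ≡ at π c
    bl  : at π b ≡ l
    a≢l : at π a ≢ l

Blocked-suc : ∀ {π e l} → Blocked π e l → Blocked π (suc e) l
Blocked-suc (blocked p q r x y z) = blocked p q (ℕ.m≤n⇒m≤1+n r) x y z

∈-range⁺ : ∀ {a b x} → a ≤ x → x < b → x ∈ range a b
∈-range⁺ {a} {b} {x} p q = subst (_∈ range a b) (ℕ.m+[n∸m]≡n p) (∈-map⁺ (a ℕ.+_) (∈-upTo⁺ (ℕ.∸-monoˡ-< q p)))

∈-range⁻ : ∀ {a b x} → x ∈ range a b → a ≤ x × x < b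
∈-range⁻ {a} {b} x∈ with ∈-map⁻ (a ℕ.+_) x∈
... | k , k∈ , refl = ℕ.m≤m+n a k , subst (a ℕ.+ k <_) (ℕ.m+[n∸m]≡n {a} {b} a≤b) (ℕ.+-monoʳ-< a (∈-upTo⁻ k∈))
  where a≤b : a ≤ b
        a≤b = ℕ.<⇒≤ (ℕ.m∸n≢0⇒n<m (λ e → ℕ.<⇒≱ (∈-upTo⁻ k∈) (subst (_≤ k) (sym e) z≤n)))

module _ (π : List ℕ) where
  private n = length π

  crossingAt-T : ∀ {a b c e} → at π a ≡ at π c → at π b ≡ at π e → at π a ≢ at π b → T (crossingAt π a b c e)
  crossingAt-T {a} {b} p q r = Equivalence.from T-∧ (ℕ.≡⇒≡ᵇ _ _ p , Equivalence.from T-∧ (ℕ.≡⇒≡ᵇ _ _ q , not-T (λ t → r (ℕ.≡ᵇ⇒≡ (at π a) (at π b) t))))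

  isNonCrossing-unblocked : T (isNonCrossing π) → ∀ {e} → e < n → ¬ Blocked π e (at π e)
  isNonCrossing-unblocked t {e} e< (blocked {a} {b} {c} a<b b<c c<e ac bl a≢l) =
    T-not (T-all _ (range (suc c) n) (T-all _ (range (suc b) n) (T-all _ (range (suc a) n) (T-all _ (upTo n) t
      (∈-upTo⁺ (ℕ.<-trans a<b b<))) (∈-range⁺ a<b b<)) (∈-range⁺ b<c c<)) (∈-range⁺ c<e e<))
      (crossingAt-T {a} {b} {c} {e} ac bl (λ e′ → a≢l (trans e′ bl)))
    where c< = ℕ.<-trans c<e e<
          b< = ℕ.<-trans b<c c<

  unblocked-isNonCrossing : (∀ {e} → e < n → ¬ Blocked π e (at π e)) → T (isNonCrossing π)
  unblocked-isNonCrossing h = all-T _ (upTo n) (λ {a} _ → all-T _ (range (suc a) n) (λ {b} b∈ → all-T _ (range (suc b) n) (λ {c} c∈ →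
    all-T _ (range (suc c) n) (λ {e} e∈ → not-T (λ t →
      let t₁ , t₂ = Equivalence.to (T-∧ {at π a ≡ᵇ at π c}) t
          t₃ , t₄ = Equivalence.to (T-∧ {at π b ≡ᵇ at π e}) t₂
          bl = ℕ.≡ᵇ⇒≡ (at π b) (at π e) t₃
      in h (proj₂ (∈-range⁻ {suc c} e∈)) (blocked (proj₁ (∈-range⁻ {suc a} {n} b∈)) (proj₁ (∈-range⁻ {suc b} {n} c∈)) (proj₁ (∈-range⁻ {suc c} {n} e∈))
           (ℕ.≡ᵇ⇒≡ _ _ t₁) bl (λ e′ → T-not t₄ (ℕ.≡⇒≡ᵇ _ _ (trans e′ (sym bl)))))))))) 

  -- After e letters with m labels in use, the stack consists exactly of the labels that are not
  -- blocked, in decreasing order. The field `order` is the restricted growth condition: smaller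
  -- labels appear first.
  record Inv (e m : ℕ) (st : List ℕ) : Set where
    field
      occurs : ∀ {i} → i < m → ∃[ a ] (a < e × at π a ≡ i)
      labels : ∀ {a} → a < e → at π a < m
      order  : ∀ {b i} → b < e → i < at π b → ∃[ a ] (a < b × at π a ≡ i)
      sorted : AllPairs (λ x y → y < x) st
      bound  : ∀ {l} → l ∈ st → l < m
      free   : ∀ {l} → l ∈ st → ¬ Blocked π e l
      open′  : ∀ {l} → l < m → ¬ Blocked π e l → l ∈ st

  private
    <-suc : ∀ {a e} → a < suc e → a < e ⊎ a ≡ e
    <-suc p = ℕ.m≤n⇒m<n∨m≡n (ℕ.≤-pred p)

  inv-new : ∀ {e m st} → Inv e m st → at π e ≡ m → Inv (suc e) (suc m) (m ∷ st)
  inv-new {e} {m} {st} I πe = record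
    { occurs = λ i< → occ (<-suc i<)
    ; labels = λ a< → lab (<-suc a<)
    ; order  = λ b< → ord (<-suc b<)
    ; sorted = All.tabulate bound ∷ sorted
    ; bound  = λ { (here refl) → ℕ.≤-refl ; (there l∈) → ℕ.m≤n⇒m≤1+n (bound l∈) }
    ; free   = λ { (here refl) bk → fresh bk ; (there l∈) bk → free l∈ (earlier bk) }
    ; open′  = λ l< nb → op (<-suc l<) nb }
    where
    open Inv I
    occ : ∀ {i} → i < m ⊎ i ≡ m → ∃[ a ] (a < suc e × at π a ≡ i)
    occ (inj₁ i<) = let a , p , q = occurs i< in a , ℕ.m≤n⇒m≤1+n p , q
    occ (inj₂ refl) = e , ℕ.≤-refl , πe
    lab : ∀ {a} → a < e ⊎ a ≡ e → at π a < suc m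
    lab (inj₁ p) = ℕ.m≤n⇒m≤1+n (labels p)
    lab (inj₂ refl) = s≤s (ℕ.≤-reflexive πe)
    ord : ∀ {b i} → b < e ⊎ b ≡ e → i < at π b → ∃[ a ] (a < b × at π a ≡ i)
    ord (inj₁ p) i< = order p i<
    ord (inj₂ refl) i< = occurs (subst (_ <_) πe i<)
    notlast : ∀ {a} → a < e → at π a ≢ at π e
    notlast a< e′ = ℕ.<⇒≢ (labels a<) (trans e′ πe)
    earlier : ∀ {l} → Blocked π (suc e) l → Blocked π e l
    earlier (blocked p q r x y z) with <-suc r
    ... | inj₁ r′ = blocked p q r′ x y z
    ... | inj₂ refl = ⊥-elim (notlast (ℕ.<-trans p q) x)
    fresh : ¬ Blocked π (suc e) m
    fresh bk with earlier bk
    ... | blocked p q r x y z = ℕ.<⇒≢ (labels (ℕ.<-trans q r)) y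
    op : ∀ {l} → l < m ⊎ l ≡ m → ¬ Blocked π (suc e) l → l ∈ m ∷ st
    op (inj₁ l<) nb = there (open′ l< (nb ∘ Blocked-suc))
    op (inj₂ refl) nb = here refl

  -- Resuming l blocks every larger label i of the stack, since an l precedes each i by `order`. A
  -- smaller label i stays free: a pattern l i l ending here is preceded by an i, and the resulting
  -- i l i would already have blocked l.
  inv-old : ∀ {e m s₁ l s₂} → Inv e m (s₁ ++ l ∷ s₂) → at π e ≡ l → Inv (suc e) m (l ∷ s₂)
  inv-old {e} {m} {s₁} {l} {s₂} I πe = record
    { occurs = λ i< → let a , p , q = occurs i< in a , ℕ.m≤n⇒m≤1+n p , q
    ; labels = λ a< → lab (<-suc a<)
    ; order  = λ b< → ord (<-suc b<)
    ; sorted = sorted₂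
    ; bound  = bound ∘ ∈-++⁺ʳ s₁
    ; free   = fr
    ; open′  = op }
    where
    open Inv I
    sorted-++ʳ : ∀ xs {ys} → AllPairs (λ x y → y < x) (xs ++ ys) → AllPairs (λ x y → y < x) ys
    sorted-++ʳ []       s       = s
    sorted-++ʳ (_ ∷ xs) (_ ∷ s) = sorted-++ʳ xs s
    sorted₂ = sorted-++ʳ s₁ sorted
    above : ∀ xs {i} → AllPairs (λ x y → y < x) (xs ++ l ∷ s₂) → i ∈ xs → l < i
    above (x ∷ xs) (p ∷ s) (here refl) = All.lookup p (∈-++⁺ʳ xs (here refl))
    above (x ∷ xs) (p ∷ s) (there i∈) = above xs s i∈
    l<m : l < m
    l<m = bound (∈-++⁺ʳ s₁ (here refl))
    lab : ∀ {a} → a < e ⊎ a ≡ e → at π a < m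
    lab (inj₁ p) = labels p
    lab (inj₂ refl) = subst (_< m) (sym πe) l<m
    ord : ∀ {b i} → b < e ⊎ b ≡ e → i < at π b → ∃[ a ] (a < b × at π a ≡ i)
    ord (inj₁ p) i< = order p i<
    ord (inj₂ refl) i< = occurs (ℕ.<-trans (subst (_ <_) πe i<) l<m)
    fr : ∀ {i} → i ∈ l ∷ s₂ → ¬ Blocked π (suc e) i
    fr {i} i∈ (blocked p q r x y z) with <-suc r
    ... | inj₁ r′ = free (∈-++⁺ʳ s₁ i∈) (blocked p q r′ x y z)
    fr (here refl) (blocked p q r x y z) | inj₂ refl = z (trans x πe)
    fr {i} (there i∈) (blocked {a} {b} p q r x y z) | inj₂ refl with order (ℕ.<-trans p q) (subst (i <_) (sym (trans x πe)) (All.lookup (AP.head sorted₂) i∈))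
    ... | a′ , a′< , e′ = free (∈-++⁺ʳ s₁ (here refl)) (blocked a′< p q (trans e′ (sym y)) (trans x πe) (λ e″ → z (trans x (trans πe (trans (sym e″) e′)))))
    op : ∀ {i} → i < m → ¬ Blocked π (suc e) i → i ∈ l ∷ s₂
    op {i} i< nb with ∈-++⁻ s₁ (open′ i< (nb ∘ Blocked-suc))
    ... | inj₂ q = q
    ... | inj₁ q with occurs i<
    ...   | b , b< , eb with order b< (subst (l <_) (sym eb) (above s₁ sorted q))
    ...     | a , a< , ea = ⊥-elim (nb (blocked a< b< ℕ.≤-refl (trans ea (sym πe)) eb (λ e′ → ℕ.<⇒≢ (above s₁ sorted q) (trans (sym ea) e′))))

  Unblocked : ℕ → List ℕ → Set
  Unblocked e w = ∀ {e′} → e ≤ e′ → e′ < e ℕ.+ length w → ¬ Blocked π e′ (at π e′)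

  accepts-unblocked : ∀ w {e m st} → RGS m w → Inv e m st → (∀ i → at w i ≡ at π (e ℕ.+ i) ) →
    (T (accepts st m w) → Unblocked e w) × (Unblocked e w → T (accepts st m w))
  accepts-unblocked [] {e} r I s = (λ _ p q → ⊥-elim (ℕ.<⇒≱ q (subst (_≤ _) (sym (ℕ.+-identityʳ e)) p))) , λ _ → tt
  accepts-unblocked (j ∷ w) {e} {m} {st} (j≤ ∷ r) I s = go (ℕ.m≤n⇒m<n∨m≡n j≤)
    where
    πe : at π e ≡ j
    πe = trans (cong (at π) (sym (ℕ.+-identityʳ e))) (sym (s 0))
    s′ : ∀ i → at w i ≡ at π (suc e ℕ.+ i)
    s′ i = trans (s (suc i)) (cong (at π) (ℕ.+-suc e i))
    extend : ¬ Blocked π e j → Unblocked (suc e) w → Unblocked e (j ∷ w)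
    extend nb u {e′} p q with ℕ.m≤n⇒m<n∨m≡n p
    ... | inj₁ p′ = u p′ (subst (e′ <_) (ℕ.+-suc e (length w)) q)
    ... | inj₂ refl = nb ∘ subst (Blocked π e) πe
    shrink : Unblocked e (j ∷ w) → Unblocked (suc e) w
    shrink u {e′} p q = u (ℕ.<⇒≤ p) (subst (e′ <_) (sym (ℕ.+-suc e (length w))) q)
    now : Unblocked e (j ∷ w) → ¬ Blocked π e j
    now u = u ℕ.≤-refl (ℕ.m<m+n e (s≤s z≤n)) ∘ subst (Blocked π e) (sym πe)
    go : j < m ⊎ j ≡ m → (T (accepts st m (j ∷ w)) → Unblocked e (j ∷ w)) × (Unblocked e (j ∷ w) → T (accepts st m (j ∷ w)))
    go (inj₂ refl) = (λ t → extend nb (proj₁ rec (subst T (accepts-new st m w) t))) , (λ u → subst T (sym (accepts-new st m w)) (proj₂ rec (shrink u)))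
      where
      rec = accepts-unblocked w (subst (λ k → RGS k w) (nextLabel-≡ m) r) (inv-new I πe) s′
      nb : ¬ Blocked π e m
      nb (blocked p q r x y z) = ℕ.<⇒≢ (Inv.labels I (ℕ.<-trans q r)) y
    go (inj₁ j<) with T? (any (j ≡ᵇ_) st)
    ... | no ¬t = (λ t → ⊥-elim (subst T (trans (accepts-old st w j<) (cong (resume j m w) (below-∉ j st j∉))) t)) , (λ u → ⊥-elim (j∉ (Inv.open′ I j< (now u))))
      where j∉ : j ∉ st
            j∉ q = ¬t (any-T (j ≡ᵇ_) q (ℕ.≡⇒≡ᵇ j j refl))
    ... | yes t with T-any (j ≡ᵇ_) st t
    ...   | l , l∈ , e′ with ∈-∃++ (subst (_∈ st) (sym (ℕ.≡ᵇ⇒≡ j l e′)) l∈)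
    ...     | s₁ , s₂ , refl = (λ t → extend (Inv.free I (∈-++⁺ʳ s₁ (here refl))) (proj₁ rec (subst T acc t))) , (λ u → subst T (sym acc) (proj₂ rec (shrink u)))
      where
      rec = accepts-unblocked w (subst (λ k → RGS k w) (nextLabel-< j<) r) (inv-old I πe) s′
      j∉ : ∀ xs → AllPairs (λ x y → y < x) (xs ++ j ∷ s₂) → j ∉ xs
      j∉ (x ∷ xs) (p ∷ s) (here refl) = ℕ.<-irrefl refl (All.lookup p (∈-++⁺ʳ xs (here refl)))
      j∉ (x ∷ xs) (p ∷ s) (there q) = j∉ xs s q
      acc : accepts (s₁ ++ j ∷ s₂) m (j ∷ w) ≡ accepts (j ∷ s₂) m w
      acc = trans (accepts-old (s₁ ++ j ∷ s₂) w j<) (cong (resume j m w) (below-∈ s₁ j s₂ (j∉ s₁ (Inv.sorted I))))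

  isNonCrossing-accepts : RGS 0 π → isNonCrossing π ≡ accepts [] 0 π
  isNonCrossing-accepts r = T-ext (λ t → proj₂ both (λ _ q → isNonCrossing-unblocked t q)) (λ t → unblocked-isNonCrossing (λ q → proj₁ both t z≤n q))
    where
    both = accepts-unblocked π r (record { occurs = λ () ; labels = λ () ; order = λ () ; sorted = [] ; bound = λ () ; free = λ () ; open′ = λ () }) (λ _ → refl)

-- Causal recursions.

-- The values at n are computed from those at smaller n, but for other j and through a function
-- argument, so the recursion is not visibly structural. Iterating k times from an arbitrary start
-- settles all values with n < k.
module Fix {A : Set} (_~_ : A → A → Set) (default : A) (~-refl : ∀ {x} → x ~ x)
           (step : (ℕ → ℕ → A) → ℕ → ℕ → A)
           (causal : ∀ {F G} n → (∀ j i → i < n → F j i ~ G j i) → ∀ j → step F j n ~ step G j n) where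

  approx : ℕ → ℕ → ℕ → A
  approx zero    j n = default
  approx (suc k) = step (approx k)

  fix : ℕ → ℕ → A
  fix j n = approx (suc n) j n

  approx-stable : ∀ k k′ j n → n < k → n < k′ → approx k j n ~ approx k′ j n
  approx-stable (suc k) (suc k′) j n (s≤s p) (s≤s q) =
    causal n (λ j′ i i<n → approx-stable k k′ j′ i (ℕ.<-≤-trans i<n p) (ℕ.<-≤-trans i<n q)) j

  fix-step : ∀ j n → fix j n ~ step fix j n
  fix-step j n = causal n (λ j′ i i<n → approx-stable n (suc i) j′ i i<n ℕ.≤-refl) j

-- The degree 0 and degree 1 recursions solved combinatorially.

module Families (S : CommutativeSemiring 0ℓ 0ℓ) (κ : ℕ → CommutativeSemiring.Carrier S) where
  open CommutativeSemiring S renaming (refl to ≈-refl; sym to ≈-sym; trans to ≈-trans)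
  open Semi S
  open Gates S
  open PlanarSums S κ
  open NonCrossingSums S κ
  open AnnularSum S κ
  open import Algebra.Solver.Ring.NaturalCoefficients.Default S using (solve; _:=_; _:+_; _:*_; con)
  open import Relation.Binary.Reasoning.Setoid setoid

  delay-cong< : ∀ {a b} n → (∀ i → i < n → a i ≈ b i) → delay a n ≈ delay b n
  delay-cong< zero    h = ≈-refl
  delay-cong< (suc n) h = h n ℕ.≤-refl

  -- diag G is the sum of the series y^s G s.
  diag : (ℕ → Seq) → Seq
  diag G zero    = G 0 0
  diag G (suc N) = G 0 (suc N) + diag (λ s → G (suc s)) N

  diag-cong : ∀ {G H : ℕ → Seq} → (∀ s → G s ≋ H s) → diag G ≋ diag H
  diag-cong h zero    = h 0 0
  diag-cong h (suc N) = +-cong (h 0 (suc N)) (diag-cong (λ s → h (suc s)) N)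

  diag-+ : ∀ G H → diag (λ s → G s ⊞ H s) ≋ diag G ⊞ diag H
  diag-+ G H zero    = ≈-refl
  diag-+ G H (suc N) = ≈-trans (+-congˡ (diag-+ (λ s → G (suc s)) (λ s → H (suc s)) N))
    (solve 4 (λ a b c d → (a :+ b) :+ (c :+ d) := (a :+ c) :+ (b :+ d)) ≈-refl _ _ _ _)

  diag-* : ∀ c G → diag (λ s n → c * G s n) ≋ (λ N → c * diag G N)
  diag-* c G zero    = ≈-refl
  diag-* c G (suc N) = ≈-trans (+-congˡ (diag-* c (λ s → G (suc s)) N)) (≈-sym (distribˡ _ _ _))

  diag-delay : ∀ G → diag (λ s → delay (G s)) ≋ delay (diag G)
  diag-delay G zero          = ≈-refl
  diag-delay G (suc zero)    = +-identityʳ _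
  diag-delay G (suc (suc N)) = +-congˡ (diag-delay (λ s → G (suc s)) (suc N))

  diag-⊛ : ∀ G h → diag (λ s → G s ⊛ h) ≋ diag G ⊛ h
  diag-⊛ G h zero    = ≈-refl
  diag-⊛ G h (suc N) = ≈-trans (+-congˡ (diag-⊛ (λ s → G (suc s)) h N)) (≈-trans (+-assoc _ _ _)
    (+-congˡ (≈-sym (⊛-distribʳ h (tail (G 0)) (diag (λ s → G (suc s))) N))))

  diag-⊛ˡ : ∀ h G → diag (λ s → h ⊛ G s) ≋ h ⊛ diag G
  diag-⊛ˡ h G N = ≈-trans (diag-cong (λ s → ⊛-comm h (G s)) N) (≈-trans (diag-⊛ G h N) (⊛-comm (diag G) h N))

  diag-const : ∀ h N → diag (λ s n → h (s ℕ.+ n)) N ≈ nat (suc N) * h N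
  diag-const h zero    = solve 1 (λ a → a := (con 1 :+ con 0) :* a) ≈-refl _
  diag-const h (suc N) = ≈-trans (+-congˡ (diag-const (tail h) N))
    (solve 2 (λ a n → a :+ (con 1 :+ n) :* a := (con 1 :+ (con 1 :+ n)) :* a) ≈-refl _ _)

  diag-Σ : ∀ G N → diag G N ≈ Σ[ upTo (suc N) ] (λ s → G s (N ℕ.∸ s))
  diag-Σ G N = go G N id (λ _ → refl)
    where
    go : ∀ G N (h : ℕ → ℕ) {k} → (∀ i → h i ≡ k ℕ.+ i) → diag G N ≈ Σ[ applyUpTo h (suc N) ] (λ s → G (s ℕ.∸ k) (N ℕ.∸ (s ℕ.∸ k)))
    go G zero h {k} e = ≈-trans (reflexive (cong (λ t → G t 0) (sym (z k h e)))) (≈-trans (≈-sym (+-identityʳ _))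
        (+-congʳ (reflexive (cong (G (h 0 ℕ.∸ k)) (sym (ℕ.0∸n≡0 (h 0 ℕ.∸ k)))))))
      where z : ∀ k (h : ℕ → ℕ) → (∀ i → h i ≡ k ℕ.+ i) → h 0 ℕ.∸ k ≡ 0
            z k h e = trans (cong (ℕ._∸ k) (e 0)) (ℕ.m+n∸m≡n k 0)
    go G (suc N) h {k} e = +-cong (reflexive (cong (λ t → G t (suc N ℕ.∸ t)) (sym (trans (cong (ℕ._∸ k) (e 0)) (ℕ.m+n∸m≡n k 0)))))
      (≈-trans (go (λ s → G (suc s)) N (h ∘ suc) {suc k} (λ i → trans (e (suc i)) (ℕ.+-suc k i)))
        (Σ-cong∈ (applyUpTo (h ∘ suc) (suc N)) (λ {s} s∈ → let i , _ , q = ∈-applyUpTo⁻ (h ∘ suc) s∈ in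
          reflexive (trans (cong (λ t → G (suc (t ℕ.∸ suc k)) (N ℕ.∸ (t ℕ.∸ suc k))) (t≡ i q))
            (trans (cong (λ t → G (suc t) (N ℕ.∸ t)) (ℕ.m+n∸m≡n (suc k) i))
              (sym (trans (cong (λ t → G (t ℕ.∸ k) (suc N ℕ.∸ (t ℕ.∸ k))) (t≡ i q))
                (cong (λ t → G t (suc N ℕ.∸ t)) (trans (cong (ℕ._∸ k) (sym (ℕ.+-suc k i))) (ℕ.m+n∸m≡n k (suc i)))))))))))
      where t≡ : ∀ {s} i → s ≡ h (suc i) → s ≡ suc k ℕ.+ i
            t≡ i q = trans q (trans (e (suc i)) (ℕ.+-suc k i))

  module _ (U : ℕ → Seq) (U-zero : U 0 0 ≈ 1#) (U-κ : ∀ j → U (suc j) 0 ≈ κ (suc j)) (U-step : ∀ j n → U j (suc n) ≈ (U 0 ⊛ U (suc j)) n) where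

    private
      W = U 0
      f : ℕ → Seq
      f j = W ⊛ U (suc j)

    U-split : ∀ j → U (suc j) ≋ const (κ (suc j)) ⊞ delay (f (suc j))
    U-split j zero    = ≈-trans (U-κ j) (≈-sym (+-identityʳ _))
    U-split j (suc n) = ≈-trans (U-step (suc j) n) (≈-sym (+-identityˡ _))

    ⊛const : ∀ h c n → (h ⊛ const c) n ≈ c * h n
    ⊛const h c n = ≈-trans (⊛-comm h (const c) n) (const⊛ c h n)

    -- The recursion for `U` stops only when no letter is left, whereas `Planar` may close a cycle
    -- with a planar remainder. Splitting off the constant term of `U (suc j)` passes from one form
    -- to the other.
    f-step : ∀ j n → f j n ≈ κ (suc j) * W n + delay (W ⊛ f (suc j)) n
    f-step j n = ≈-trans (⊛-cong {W} {W} (λ _ → ≈-refl) (U-split j) n) (≈-trans (⊛-distribˡ W (const (κ (suc j))) (delay (f (suc j))) n)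
      (+-cong (⊛const W (κ (suc j)) n) (⊛-delay W (f (suc j)) n)))

    planar : Planar W f
    planar = record { W-zero = U-zero ; W-suc = U-step 0 ; f-step = f-step }

    ΣNC : ∀ n → Σ[ NCPartitions n ] (λ π → Πκ κ (blockSizes π)) ≈ W n
    ΣNC n = begin
      Σ[ NCPartitions n ] (λ π → Πκ κ (blockSizes π))
        ≈⟨ Σ-filter isNonCrossing (SetPartitions n) ⟩
      Σ[ SetPartitions n ] (λ π → gate (isNonCrossing π) (Πκ κ (blockSizes π)))
        ≈⟨ Σ-cong∈ (SetPartitions n) (λ {π} π∈ → let r = proj₁ (rgsFrom-sound n 0 π∈) in
             ≈-trans (gate-≡ _ (isNonCrossing-accepts π r)) (gate-cong (accepts [] 0 π) (reflexive (cong (Πκ κ) (blockSizes-final r))))) ⟩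
      Σ[ SetPartitions n ] (λ π → gate (accepts [] 0 π) (Πκ κ (final [] π)))
        ≈⟨ ΣRGS W F U-zero (U-step 0) F-step n {[]} {[]} {[]} (record { unique = [] ; bound = λ () ; sizes = ↭-refl }) ⟩
      1# * (1# * W n + delay (W ⊛ (λ _ → 0#)) n)
        ≈⟨ *-congˡ (+-congˡ (z n)) ⟩
      1# * (1# * W n + 0#)
        ≈⟨ solve 1 (λ w → con 1 :* (con 1 :* w :+ con 0) := w) ≈-refl _ ⟩
      W n ∎
      where
      F : ℕ → Seq
      -- No block has size 0; this value makes `F-step` hold at every index.
      F zero    n = κ 0 * W n + delay (W ⊛ f 0) n
      F (suc j) = f j
      F-step : ∀ j n → F j n ≈ κ j * W n + delay (W ⊛ F (suc j)) n
      F-step zero    n = ≈-refl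
      F-step (suc j) n = f-step j n
      z : ∀ n → delay (W ⊛ (λ _ → 0#)) n ≈ 0#
      z zero    = ≈-refl
      z (suc n) = CommutativeSemiring.zeroʳ series W n

    module AnnularFamily (s : ℕ) where
      advance : (ℕ → Seq) → Seq
      advance g = delay (g 0)

      step : (ℕ → Seq) → ℕ → Seq
      step g j n = κ (suc j) * advance g n + (delay (W ⊛ g (suc j)) n + delay (advance g ⊛ f (suc j)) n) + nat s * f (suc j) (ℕ.pred s ℕ.+ n)

      causal : ∀ {g h} n → (∀ j i → i < n → g j i ≈ h j i) → ∀ j → step g j n ≈ step h j n
      causal {g} {h} n e j = +-congʳ (+-cong (*-congˡ (delay-cong< n (λ i i< → e 0 i i<)))
        (+-cong (delay-cong< n (λ i i< → ⊛-cong≤ {W} {W} i (λ _ _ → ≈-refl) (λ k k≤ → e (suc j) k (ℕ.≤-<-trans k≤ i<))))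
          (delay-cong< n (λ i i< → ⊛-cong≤ {advance g} {advance h} {f (suc j)} {f (suc j)} i (λ k k≤ → delay-cong< k (λ l l< → e 0 l (ℕ.<-trans l< (ℕ.≤-<-trans k≤ i<)))) (λ _ _ → ≈-refl)))))

      open Fix _≈_ 0# ≈-refl step causal renaming (fix to g; fix-step to g-step) public

      Y : Seq
      Y = delay (g 0)

      annular : Annular planar s Y g
      annular = record { Y-zero = ≈-refl ; Y-suc = λ n → ≈-refl ; g-step = g-step }

    module _ (inv : ℕ → Carrier) (inv-nat : ∀ s → inv (suc s) * nat (suc s) ≈ 1#)
             (ν : ℕ → Carrier) (ν-nat : ∀ n → nat n + ν n ≈ 0#)
             (X : ℕ → Seq) (X-zero : ∀ j → X j 0 ≈ 0#)
             (X-step : ∀ j n → X j (suc n) ≈ ((X 0 ⊛ U (suc j)) n + (W ⊛ X (suc j)) n) + ν n * U (suc j) n) where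

      private
        module AF s = AnnularFamily (suc s)
        y : Seq
        y = diag (λ s n → inv (suc s) * AF.Y s n)
        γ : ℕ → Seq
        γ j = diag (λ s n → inv (suc s) * AF.g s j n)
        V : ℕ → Seq
        V j n = ν n * U j n
        D̂ : Seq → Seq
        D̂ h n = nat (suc n) * h n

      -- The weighted sum of the annular families: the coefficient at N is the sum of Y_s(N - s) / s.
      Ȳ : Seq
      Ȳ = delay y

      y-delay : y ≋ delay (γ 0)
      y-delay N = ≈-trans (diag-cong (λ s n → ≈-sym (delay-* (inv (suc s)) (AF.g s 0) n)) N) (diag-delay (λ s n → inv (suc s) * AF.g s 0 n) N)

      -- The weight 1/s cancels the s choices of the joined letter. For a fixed total the joined
      -- circles then contribute the same coefficient N + 1 times, which is `D̂`.
      γ-step : ∀ j N → γ j N ≈ κ (suc j) * y N + (delay (W ⊛ γ (suc j)) N + delay (y ⊛ f (suc j)) N) + D̂ (f (suc j)) N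
      γ-step j N = begin
        γ j N
          ≈⟨ diag-cong (λ s n → ≈-trans (*-congˡ (AF.g-step s j n))
               (≈-trans (solve 6 (λ i k a b c d → i :* (k :* a :+ (b :+ c) :+ d) := k :* (i :* a) :+ (i :* b :+ i :* c) :+ i :* d) ≈-refl
                  (inv (suc s)) (κ (suc j)) (AF.Y s n) (delay (W ⊛ AF.g s (suc j)) n) (delay (AF.Y s ⊛ f (suc j)) n) (nat (suc s) * f (suc j) (s ℕ.+ n)))
                 (+-cong (+-congˡ (+-cong (pullˡ s n) (pullʳ s n)))
                   (≈-trans (≈-sym (*-assoc _ _ _)) (≈-trans (*-congʳ (inv-nat s)) (*-identityˡ _)))))) N ⟩
        diag (λ s n → κ (suc j) * (inv (suc s) * AF.Y s n) + (delay (W ⊛ G s) n + delay (Ys s ⊛ f (suc j)) n) + f (suc j) (s ℕ.+ n)) N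
          ≈⟨ diag-+ (λ s n → κ (suc j) * (inv (suc s) * AF.Y s n) + (delay (W ⊛ G s) n + delay (Ys s ⊛ f (suc j)) n)) (λ s n → f (suc j) (s ℕ.+ n)) N ⟩
        diag (λ s n → κ (suc j) * (inv (suc s) * AF.Y s n) + (delay (W ⊛ G s) n + delay (Ys s ⊛ f (suc j)) n)) N + diag (λ s n → f (suc j) (s ℕ.+ n)) N
          ≈⟨ +-cong (≈-trans (diag-+ (λ s n → κ (suc j) * Ys s n) (λ s n → delay (W ⊛ G s) n + delay (Ys s ⊛ f (suc j)) n) N)
               (+-cong (diag-* (κ (suc j)) Ys N) (≈-trans (diag-+ (λ s → delay (W ⊛ G s)) (λ s → delay (Ys s ⊛ f (suc j))) N)
                 (+-cong (≈-trans (diag-delay (λ s → W ⊛ G s) N) (delay-cong (diag-⊛ˡ W G) N))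
                   (≈-trans (diag-delay (λ s → Ys s ⊛ f (suc j)) N) (delay-cong (diag-⊛ Ys (f (suc j))) N)))))) (diag-const (f (suc j)) N) ⟩
        κ (suc j) * y N + (delay (W ⊛ γ (suc j)) N + delay (y ⊛ f (suc j)) N) + D̂ (f (suc j)) N ∎
        where
        G Ys : ℕ → Seq
        G s n = inv (suc s) * AF.g s (suc j) n
        Ys s n = inv (suc s) * AF.Y s n
        pullˡ : ∀ s n → inv (suc s) * delay (W ⊛ AF.g s (suc j)) n ≈ delay (W ⊛ G s) n
        pullˡ s n = ≈-trans (≈-sym (delay-* (inv (suc s)) (W ⊛ AF.g s (suc j)) n)) (delay-cong (λ i → ≈-sym (⊛scale (inv (suc s)) W (AF.g s (suc j)) i)) n)
        pullʳ : ∀ s n → inv (suc s) * delay (AF.Y s ⊛ f (suc j)) n ≈ delay (Ys s ⊛ f (suc j)) n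
        pullʳ s n = ≈-trans (≈-sym (delay-* (inv (suc s)) (AF.Y s ⊛ f (suc j)) n)) (delay-cong (λ i → ≈-sym (scale⊛ (inv (suc s)) (AF.Y s) (f (suc j)) i)) n)

      private
        A : Seq
        A = Ȳ ⊞ X 0
        Z : ℕ → Seq
        Z j = X 0 ⊛ U j ⊞ W ⊛ X j
        B : ℕ → Seq
        B j = delay (γ j) ⊞ Z (suc j)

      A-zero : A 0 ≈ 0#
      A-zero = ≈-trans (+-congˡ (X-zero 0)) (+-identityˡ _)

      A-suc : ∀ N → A (suc N) ≈ B 0 N + V 1 N
      A-suc N = ≈-trans (+-cong (y-delay N) (X-step 0 N)) (≈-sym (+-assoc _ _ _))

      G-step : ∀ j N → delay (γ j) N ≈ κ (suc j) * Ȳ N + (delay (W ⊛ delay (γ (suc j))) N + delay (Ȳ ⊛ f (suc j)) N) + delay (D̂ (f (suc j))) N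
      G-step j zero    = solve 1 (λ k → con 0 := k :* con 0 :+ (con 0 :+ con 0) :+ con 0) ≈-refl (κ (suc j))
      G-step j (suc N) = ≈-trans (γ-step j N) (+-congʳ (+-congˡ (+-cong (≈-sym (⊛-delay W (γ (suc j)) N)) (≈-sym (delay-⊛ y (f (suc j)) N)))))

      X-delay : ∀ j → X j ≋ delay (Z (suc j) ⊞ V (suc j))
      X-delay j zero    = X-zero j
      X-delay j (suc n) = X-step j n

      Z-step : ∀ j N → Z (suc j) N ≈ κ (suc j) * X 0 N + (delay (W ⊛ Z (suc (suc j))) N + delay (X 0 ⊛ f (suc j)) N) + delay (W ⊛ V (suc (suc j))) N
      Z-step j N = begin
        (X 0 ⊛ U (suc j)) N + (W ⊛ X (suc j)) N
          ≈⟨ +-cong (≈-trans (⊛-cong {X 0} {X 0} (λ _ → ≈-refl) (U-split j) N) (⊛-distribˡ (X 0) (const (κ (suc j))) (delay (f (suc j))) N))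
               (≈-trans (⊛-cong {W} {W} (λ _ → ≈-refl) (X-delay (suc j)) N) (⊛-delay W (Z (suc (suc j)) ⊞ V (suc (suc j))) N)) ⟩
        ((X 0 ⊛ const (κ (suc j))) N + (X 0 ⊛ delay (f (suc j))) N) + delay (W ⊛ (Z (suc (suc j)) ⊞ V (suc (suc j)))) N
          ≈⟨ +-cong (+-cong (⊛const (X 0) (κ (suc j)) N) (⊛-delay (X 0) (f (suc j)) N))
               (≈-trans (delay-cong (⊛-distribˡ W (Z (suc (suc j))) (V (suc (suc j)))) N) (delay-+ (W ⊛ Z (suc (suc j))) (W ⊛ V (suc (suc j))) N)) ⟩
        (κ (suc j) * X 0 N + delay (X 0 ⊛ f (suc j)) N) + (delay (W ⊛ Z (suc (suc j))) N + delay (W ⊛ V (suc (suc j))) N)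
          ≈⟨ solve 4 (λ a b c d → (a :+ b) :+ (c :+ d) := a :+ (c :+ b) :+ d) ≈-refl _ _ _ _ ⟩
        κ (suc j) * X 0 N + (delay (W ⊛ Z (suc (suc j))) N + delay (X 0 ⊛ f (suc j)) N) + delay (W ⊛ V (suc (suc j))) N ∎

      B-step : ∀ j N → B j N ≈ κ (suc j) * A N + (delay (W ⊛ (B (suc j) ⊞ V (suc (suc j)))) N + delay (A ⊛ f (suc j)) N) + delay (D̂ (f (suc j))) N
      B-step j N = begin
        delay (γ j) N + Z (suc j) N
          ≈⟨ +-cong (G-step j N) (Z-step j N) ⟩
        (κ (suc j) * Ȳ N + (delay (W ⊛ delay (γ (suc j))) N + delay (Ȳ ⊛ f (suc j)) N) + delay (D̂ (f (suc j))) N) +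
          (κ (suc j) * X 0 N + (delay (W ⊛ Z (suc (suc j))) N + delay (X 0 ⊛ f (suc j)) N) + delay (W ⊛ V (suc (suc j))) N)
          ≈⟨ solve 9 (λ k a b c d e g h i → (k :* a :+ (b :+ c) :+ d) :+ (k :* e :+ (g :+ h) :+ i) := k :* (a :+ e) :+ (((b :+ g) :+ i) :+ (c :+ h)) :+ d) ≈-refl
               (κ (suc j)) (Ȳ N) (delay (W ⊛ delay (γ (suc j))) N) (delay (Ȳ ⊛ f (suc j)) N) (delay (D̂ (f (suc j))) N) (X 0 N)
               (delay (W ⊛ Z (suc (suc j))) N) (delay (X 0 ⊛ f (suc j)) N) (delay (W ⊛ V (suc (suc j))) N) ⟩
        κ (suc j) * A N + (((delay (W ⊛ delay (γ (suc j))) N + delay (W ⊛ Z (suc (suc j))) N) + delay (W ⊛ V (suc (suc j))) N) + (delay (Ȳ ⊛ f (suc j)) N + delay (X 0 ⊛ f (suc j)) N)) + delay (D̂ (f (suc j))) N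
          ≈⟨ +-congʳ (+-congˡ (+-cong
               (≈-sym (≈-trans (delay-cong (⊛-distribˡ W (B (suc j)) (V (suc (suc j)))) N) (≈-trans (delay-+ (W ⊛ B (suc j)) (W ⊛ V (suc (suc j))) N)
                  (+-congʳ (≈-trans (delay-cong (⊛-distribˡ W (delay (γ (suc j))) (Z (suc (suc j)))) N) (delay-+ (W ⊛ delay (γ (suc j))) (W ⊛ Z (suc (suc j))) N))))))
               (≈-sym (≈-trans (delay-cong (⊛-distribʳ (f (suc j)) Ȳ (X 0)) N) (delay-+ (Ȳ ⊛ f (suc j)) (X 0 ⊛ f (suc j)) N))))) ⟩
        κ (suc j) * A N + (delay (W ⊛ (B (suc j) ⊞ V (suc (suc j)))) N + delay (A ⊛ f (suc j)) N) + delay (D̂ (f (suc j))) N ∎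

      cancel : ∀ j n → B j n ≈ θ (U (suc j)) n → (B j ⊞ V (suc j)) n ≈ 0#
      cancel j n e = ≈-trans (+-congʳ e) (≈-trans (≈-sym (distribʳ _ _ _)) (≈-trans (*-congʳ (ν-nat n)) (zeroˡ _)))

      θU : ∀ j N → θ (U (suc j)) N ≈ delay (D̂ (f (suc j))) N
      θU j zero    = zeroˡ _
      θU j (suc N) = *-congˡ (U-step (suc j) N)

      -- Two claims are carried together: `A` vanishes, and `B j` equals `θ (U (suc j))`. Once the
      -- lower terms are gone, `B-step` leaves only the contribution n f(n-1) of the joins, which is
      -- n U(n) by `U-step`; this cancels the term `V` that the correction - e n puts into the next
      -- coefficient of `A`.
      invariant : ∀ N n → n < N → A n ≈ 0# × (∀ j → B j n ≈ θ (U (suc j)) n)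
      invariant (suc N) n (s≤s n≤N) = a n n≤N , b
        where
        a : ∀ m → m ≤ N → A m ≈ 0#
        a zero    m≤ = A-zero
        a (suc m) m≤ = ≈-trans (A-suc m) (cancel 0 m (proj₂ (invariant N m m≤) 0))
        b : ∀ j → B j n ≈ θ (U (suc j)) n
        b j = begin
          B j n ≈⟨ B-step j n ⟩
          κ (suc j) * A n + (delay (W ⊛ (B (suc j) ⊞ V (suc (suc j)))) n + delay (A ⊛ f (suc j)) n) + delay (D̂ (f (suc j))) n
            ≈⟨ +-congʳ (+-cong (≈-trans (*-congˡ (a n n≤N)) (zeroʳ _)) (+-cong
                 (≈-trans (delay-cong< n (λ i i< → ≈-trans (⊛-cong≤ {W} {W} {B (suc j) ⊞ V (suc (suc j))} {λ _ → 0#} i (λ _ _ → ≈-refl)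
                    (λ k k≤ → cancel (suc j) k (proj₂ (invariant N k (ℕ.<-≤-trans (ℕ.≤-<-trans k≤ i<) n≤N)) (suc j)))) (CommutativeSemiring.zeroʳ series W i))) (z n))
                 (≈-trans (delay-cong< n (λ i i< → ≈-trans (⊛-cong≤ {A} {λ _ → 0#} {f (suc j)} {f (suc j)} i
                    (λ k k≤ → a k (ℕ.≤-trans (ℕ.<⇒≤ (ℕ.≤-<-trans k≤ i<)) n≤N)) (λ _ _ → ≈-refl)) (CommutativeSemiring.zeroˡ series (f (suc j)) i))) (z n)))) ⟩
          0# + (0# + 0#) + delay (D̂ (f (suc j))) n
            ≈⟨ solve 1 (λ a → con 0 :+ (con 0 :+ con 0) :+ a := a) ≈-refl _ ⟩
          delay (D̂ (f (suc j))) n ≈⟨ θU j n ⟨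
          θ (U (suc j)) n ∎
          where
          z : ∀ n → delay (λ _ → 0#) n ≈ 0#
          z zero    = ≈-refl
          z (suc n) = ≈-refl

      Ȳ+X≈0 : ∀ N → Ȳ N + X 0 N ≈ 0#
      Ȳ+X≈0 N = proj₁ (invariant (suc N) N ℕ.≤-refl)

-- Moments and cumulants.

divN-cong : ∀ {a b m n} → a ℤ.* ℤ.+ suc n ≡ b ℤ.* ℤ.+ suc m → divN a (suc m) ≡ divN b (suc n)
divN-cong {a} {b} {m} {n} e = ℚ.fromℚᵘ-cong {mkℚᵘ a m} {mkℚᵘ b n} (*≡* e)

divN-* : ∀ a b m n → divN (a ℤ.* b) (m ℕ.* n) ≡ divN a m ℚ.* divN b n
divN-* a b zero    n       = sym (ℚ.*-zeroˡ (divN b n))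
divN-* a b (suc m) zero    = trans (cong (divN (a ℤ.* b)) (ℕ.*-zeroʳ (suc m))) (sym (ℚ.*-zeroʳ (divN a (suc m))))
divN-* a b (suc m) (suc n) = ℚ.toℚᵘ-injective (begin
  ℚ.toℚᵘ (ℚ.fromℚᵘ (mkℚᵘ (a ℤ.* b) (n ℕ.+ m ℕ.* suc n)))       ≈⟨ ℚ.toℚᵘ-fromℚᵘ _ ⟩
  mkℚᵘ a m ℚᵘ.* mkℚᵘ b n                                       ≈⟨ ℚᵘ.*-cong (ℚ.toℚᵘ-fromℚᵘ (mkℚᵘ a m)) (ℚ.toℚᵘ-fromℚᵘ (mkℚᵘ b n)) ⟨
  ℚ.toℚᵘ (divN a (suc m)) ℚᵘ.* ℚ.toℚᵘ (divN b (suc n))         ≈⟨ ℚ.toℚᵘ-homo-* (divN a (suc m)) (divN b (suc n)) ⟨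
  ℚ.toℚᵘ (divN a (suc m) ℚ.* divN b (suc n))                   ∎)
  where open ℚᵘ.≃-Reasoning

divN-+1 : ∀ a b → divN (a ℤ.+ b) 1 ≡ divN a 1 ℚ.+ divN b 1
divN-+1 a b = ℚ.toℚᵘ-injective (begin
  ℚ.toℚᵘ (ℚ.fromℚᵘ (mkℚᵘ (a ℤ.+ b) 0))             ≈⟨ ℚ.toℚᵘ-fromℚᵘ _ ⟩
  mkℚᵘ (a ℤ.+ b) 0                                 ≈⟨ *≡* (cong (ℤ._* ℤ.+ 1) (cong₂ ℤ._+_ (sym (ℤ.*-identityʳ a)) (sym (ℤ.*-identityʳ b)))) ⟩
  mkℚᵘ a 0 ℚᵘ.+ mkℚᵘ b 0                           ≈⟨ ℚᵘ.+-cong (ℚ.toℚᵘ-fromℚᵘ (mkℚᵘ a 0)) (ℚ.toℚᵘ-fromℚᵘ (mkℚᵘ b 0)) ⟨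
  ℚ.toℚᵘ (divN a 1) ℚᵘ.+ ℚ.toℚᵘ (divN b 1)         ≈⟨ ℚ.toℚᵘ-homo-+ (divN a 1) (divN b 1) ⟨
  ℚ.toℚᵘ (divN a 1 ℚ.+ divN b 1)                   ∎)
  where open ℚᵘ.≃-Reasoning

divN-self : ∀ m → divN (ℤ.+ suc m) (suc m) ≡ ℚ.1ℚ
divN-self m = divN-cong {ℤ.+ suc m} {ℤ.+ 1} {m} {0} (ℤ.*-comm (ℤ.+ suc m) (ℤ.+ 1))

module Rationals (R : CommutativeRing 0ℓ 0ℓ) (ι : ℚ → CommutativeRing.Carrier R)
                 (hom : IsRingHomomorphism +-*-rawRing (CommutativeRing.rawRing R) ι) where
  open CommutativeRing R renaming (refl to ≈-refl; sym to ≈-sym; trans to ≈-trans)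
  open Semi commutativeSemiring
  open IsRingHomomorphism hom

  ι-≡ : ∀ {p q} → p ≡ q → ι p ≈ ι q
  ι-≡ e = reflexive (cong ι e)

  ι-divN-* : ∀ a b m n → ι (divN (a ℤ.* b) (m ℕ.* n)) ≈ ι (divN a m) * ι (divN b n)
  ι-divN-* a b m n = ≈-trans (ι-≡ (divN-* a b m n)) (*-homo _ _)

  ι-int : ℤ → Carrier
  ι-int z = ι (divN z 1)

  ι-int-* : ∀ a b → ι-int (a ℤ.* b) ≈ ι-int a * ι-int b
  ι-int-* a b = ι-divN-* a b 1 1

  ι-int-nat : ∀ n → ι-int (ℤ.+ n) ≈ nat n
  ι-int-nat zero    = 0#-homo
  ι-int-nat (suc n) = ≈-trans (ι-≡ (divN-+1 (ℤ.+ 1) (ℤ.+ n))) (≈-trans (+-homo _ _) (+-cong 1#-homo (ι-int-nat n)))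

  ι-int-neg : ∀ z → ι-int z + ι-int (ℤ.- z) ≈ 0#
  ι-int-neg z = ≈-trans (≈-sym (+-homo _ _)) (≈-trans (ι-≡ (trans (sym (divN-+1 z (ℤ.- z))) (cong (λ t → divN t 1) (ℤ.+-inverseʳ z)))) 0#-homo)

  recip : ℕ → Carrier
  recip m = ι (divN (ℤ.+ 1) m)

  ι-divN : ∀ z m → ι (divN z m) ≈ ι-int z * recip m
  ι-divN z m = ≈-trans (ι-≡ (cong₂ divN (sym (ℤ.*-identityʳ z)) (sym (ℕ.*-identityˡ m)))) (ι-divN-* z (ℤ.+ 1) 1 m)

  recip-* : ∀ m n → recip (m ℕ.* n) ≈ recip m * recip n
  recip-* m n = ι-divN-* (ℤ.+ 1) (ℤ.+ 1) m n

  recip-1 : recip 1 ≈ 1#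
  recip-1 = 1#-homo

  recip-nat : ∀ m → recip (suc m) * nat (suc m) ≈ 1#
  recip-nat m = ≈-trans (*-comm _ _) (≈-trans (*-congʳ (≈-sym (ι-int-nat (suc m))))
    (≈-trans (≈-sym (ι-divN (ℤ.+ suc m) (suc m))) (≈-trans (ι-≡ (divN-self m)) 1#-homo)))

  recip-unit : ∀ {m} → 1 ≤ m → recip m * nat m ≈ 1#
  recip-unit (s≤s {n = m} _) = recip-nat m

  neg-unique : ∀ {x y} → x + y ≈ 0# → y ≈ - x
  neg-unique {x} {y} e = ≈-trans (≈-sym (+-identityˡ y)) (≈-trans (+-congʳ (≈-sym (-‿inverseˡ x))) (≈-trans (+-assoc _ _ _) (≈-trans (+-congˡ e) (+-identityʳ _))))

-- Sums over set partitions as derivatives of a logarithm.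

module SeriesRing (R : CommutativeRing 0ℓ 0ℓ) where
  open CommutativeRing R renaming (refl to ≈-refl; sym to ≈-sym; trans to ≈-trans)
  open Semi commutativeSemiring
  open import Relation.Binary.Reasoning.Setoid setoid
  private module Ser = CommutativeSemiring series
  open import Algebra.Solver.Ring.NaturalCoefficients.Default series using (solve; _:=_; _:+_; _:*_; con)
  open import Algebra.Solver.Ring.NaturalCoefficients.Default commutativeSemiring
    using () renaming (solve to solveR; _:=_ to _:≈_; _:+_ to _:⊕_; _:*_ to _:⊗_; con to conR)

  module Inverse (V : Seq) (V-zero : V 0 ≈ 1#) where

    step : (ℕ → Seq) → ℕ → Seq
    step F j zero    = 1#
    step F j (suc n) = - (tail V ⊛ F 0) n

    causal : ∀ {F G : ℕ → Seq} n → (∀ j i → i < n → F j i ≈ G j i) → ∀ j → step F j n ≈ step G j n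
    causal zero    e j = ≈-refl
    causal (suc n) e j = -‿cong (⊛-cong≤ {tail V} {tail V} n (λ _ _ → ≈-refl) (λ i i≤n → e 0 i (s≤s i≤n)))

    open Fix {Carrier} _≈_ 0# ≈-refl step causal

    inverse-series : Seq
    inverse-series = fix 0

    inverse-zero : inverse-series 0 ≈ 1#
    inverse-zero = ≈-refl

    ⊛-inverse : V ⊛ inverse-series ≋ const 1#
    ⊛-inverse zero    = ≈-trans (*-congʳ V-zero) (*-identityˡ _)
    ⊛-inverse (suc n) = ≈-trans (+-congʳ (≈-trans (*-cong V-zero (fix-step 0 (suc n))) (*-identityˡ _))) (-‿inverseˡ _)

    private I = inverse-series

    D-one : ∀ n → D (const 1#) n ≈ 0#
    D-one n = zeroʳ _

    D-inverse : D I ⊞ D V ⊛ (I ⊛ I) ≋ (λ _ → 0#)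
    D-inverse = Ser.trans (Ser.+-congʳ {D V ⊛ (I ⊛ I)} (Ser.trans (Ser.sym (Ser.*-identityˡ (D I))) (Ser.*-congʳ {D I} (Ser.sym ⊛-inverse))))
      (Ser.trans (solve 4 (λ v i dv di → (v :* i) :* di :+ dv :* (i :* i) := i :* (dv :* i :+ v :* di)) Ser.refl V I (D V) (D I))
        (Ser.trans (Ser.*-congˡ {I} (Ser.trans (Ser.sym (D-⊛ V I)) (Ser.trans (λ n → *-congˡ (⊛-inverse (suc n))) D-one))) (Ser.zeroʳ I)))

    power : ℕ → Seq
    power zero    = const 1#
    power (suc l) = I ⊛ power l

    power-zero : ∀ l → power l 0 ≈ 1#
    power-zero zero    = ≈-refl
    power-zero (suc l) = ≈-trans (*-cong inverse-zero (power-zero l)) (*-identityˡ _)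

    -- The rule (V^(-l))' = - l V' V^(-l-1), stated as a vanishing sum so that the semiring solver
    -- can be used.
    D-power : ∀ l → D (power l) ⊞ const (nat l) ⊛ (D V ⊛ power (suc l)) ≋ (λ _ → 0#)
    D-power zero    = Ser.trans (Ser.+-cong D-one (λ n → ≈-trans (const⊛ 0# (D V ⊛ power 1) n) (zeroˡ _))) (Ser.+-identityˡ _)
    D-power (suc l) = Ser.trans (Ser.+-cong (D-⊛ I (power l)) (Ser.*-congʳ {D V ⊛ power (suc (suc l))} const-suc))
      (Ser.trans (solve 6 (λ di p i dp dv n → (di :* p :+ i :* dp) :+ (con 1 :+ n) :* (dv :* (i :* (i :* p))) :=
                    (di :+ dv :* (i :* i)) :* p :+ i :* (dp :+ n :* (dv :* (i :* p)))) Ser.refl (D I) (power l) I (D (power l)) (D V) (const (nat l)))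
        (Ser.trans (Ser.+-cong (Ser.trans (Ser.*-congʳ {power l} D-inverse) (Ser.zeroˡ (power l))) (Ser.trans (Ser.*-congˡ {I} (D-power l)) (Ser.zeroʳ I)))
          (Ser.+-identityˡ _)))
      where
      const-suc : const (nat (suc l)) ≋ const 1# ⊞ const (nat l)
      const-suc zero    = ≈-refl
      const-suc (suc n) = ≈-sym (+-identityˡ 0#)

    ⊛-cancel : ∀ {f g} N → (∀ n → n ≤ N → (f ⊛ V) n ≈ (g ⊛ V) n) → f N ≈ g N
    ⊛-cancel {f} {g} N h = begin
      f N                ≈⟨ undo f N ⟨
      ((f ⊛ V) ⊛ I) N    ≈⟨ ⊛-cong≤ {f ⊛ V} {g ⊛ V} {I} {I} N h (λ _ _ → ≈-refl) ⟩
      ((g ⊛ V) ⊛ I) N    ≈⟨ undo g N ⟩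
      g N                ∎
      where
      undo : ∀ f → (f ⊛ V) ⊛ I ≋ f
      undo f = Ser.trans (Ser.*-assoc f V I) (Ser.trans (Ser.*-congˡ {f} ⊛-inverse) (Ser.*-identityʳ f))

    -- Exponential generating functions: sign l is (-1)^l (l-1)!, so that the series sign l * I^l are,
    -- up to constants, the iterated derivatives of -log at V.
    module Exponential (sign : ℕ → Carrier) (sign-suc : ∀ l → sign (suc (suc l)) + nat (suc l) * sign (suc l) ≈ 0#)
                       (v : ℕ → Carrier) (v-V : ∀ s → nat (factorial s) * V s ≈ v s) where

      outer : ℕ → Seq
      outer l n = sign l * power l n

      D-outer : ∀ l → D (outer (suc l)) ≋ D V ⊛ outer (suc (suc l))
      D-outer l n = +-cancelʳ (sign (suc l) * (nat (suc l) * P n)) _ _ (≈-trans lhs (≈-sym rhs))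
        where
        open import Algebra.Properties.Group +-group using () renaming (∙-cancelʳ to +-cancelʳ)
        P : Seq
        P = D V ⊛ power (suc (suc l))
        lhs : D (outer (suc l)) n + sign (suc l) * (nat (suc l) * P n) ≈ 0#
        lhs = begin
          nat (suc n) * (sign (suc l) * power (suc l) (suc n)) + sign (suc l) * (nat (suc l) * P n)
            ≈⟨ solveR 4 (λ a s b c → a :⊗ (s :⊗ b) :⊕ s :⊗ c :≈ s :⊗ (a :⊗ b :⊕ c)) ≈-refl (nat (suc n)) (sign (suc l)) (power (suc l) (suc n)) (nat (suc l) * P n) ⟩
          sign (suc l) * (D (power (suc l)) n + nat (suc l) * P n)
            ≈⟨ *-congˡ (≈-trans (+-congˡ (≈-sym (const⊛ (nat (suc l)) P n))) (D-power (suc l) n)) ⟩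
          sign (suc l) * 0# ≈⟨ zeroʳ _ ⟩
          0# ∎
        rhs : (D V ⊛ outer (suc (suc l))) n + sign (suc l) * (nat (suc l) * P n) ≈ 0#
        rhs = begin
          (D V ⊛ outer (suc (suc l))) n + sign (suc l) * (nat (suc l) * P n)
            ≈⟨ +-congʳ (⊛scale (sign (suc (suc l))) (D V) (power (suc (suc l))) n) ⟩
          sign (suc (suc l)) * P n + sign (suc l) * (nat (suc l) * P n)
            ≈⟨ solveR 4 (λ a s b p → a :⊗ p :⊕ s :⊗ (b :⊗ p) :≈ (a :⊕ b :⊗ s) :⊗ p) ≈-refl (sign (suc (suc l))) (sign (suc l)) (nat (suc l)) (P n) ⟩
          (sign (suc (suc l)) + nat (suc l) * sign (suc l)) * P n
            ≈⟨ *-congʳ (sign-suc l) ⟩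
          0# * P n ≈⟨ zeroˡ _ ⟩
          0# ∎

      D^ : ℕ → Seq → Seq
      D^ zero    f = f
      D^ (suc s) f = D (D^ s f)

      D^-value : ∀ s k → nat (factorial k) * D^ s V k ≈ nat (factorial (s ℕ.+ k)) * V (s ℕ.+ k)
      D^-value zero    k = ≈-refl
      D^-value (suc s) k = begin
        nat (factorial k) * (nat (suc k) * D^ s V (suc k))   ≈⟨ ≈-trans (≈-sym (*-assoc _ _ _)) (*-congʳ (≈-trans (*-comm _ _) (≈-sym (nat-* (suc k) (factorial k))))) ⟩
        nat (factorial (suc k)) * D^ s V (suc k)             ≈⟨ D^-value s (suc k) ⟩
        nat (factorial (s ℕ.+ suc k)) * V (s ℕ.+ suc k)      ≈⟨ reflexive (cong (λ t → nat (factorial t) * V t) (ℕ.+-suc s k)) ⟩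
        nat (factorial (suc s ℕ.+ k)) * V (suc s ℕ.+ k)      ∎

      D^-zero : ∀ s → D^ s V 0 ≈ v s
      D^-zero s = ≈-trans (≈-sym (≈-trans (*-congʳ (+-identityʳ 1#)) (*-identityˡ _))) (≈-trans (D^-value s 0) (≈-trans (reflexive (cong (λ t → nat (factorial t) * V t) (ℕ.+-identityʳ s))) (v-V s)))

      blocks : List ℕ → Seq → Seq
      blocks []       T = T
      blocks (s ∷ sz) T = D^ s V ⊛ blocks sz T

      blocks-cong : ∀ sz {T T′} → T ≋ T′ → blocks sz T ≋ blocks sz T′
      blocks-cong []       h = h
      blocks-cong (s ∷ sz) h = Ser.*-congˡ {D^ s V} (blocks-cong sz h)

      blocks-snoc : ∀ sz T → blocks (sz ++ 1 ∷ []) T ≋ blocks sz (D V ⊛ T)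
      blocks-snoc []       T = Ser.refl
      blocks-snoc (s ∷ sz) T = Ser.*-congˡ {D^ s V} (blocks-snoc sz T)

      blocks-zero : ∀ sz T → blocks sz T 0 ≈ Πκ v sz * T 0
      blocks-zero []       T = ≈-sym (*-identityˡ _)
      blocks-zero (s ∷ sz) T = ≈-trans (*-cong (D^-zero s) (blocks-zero sz T)) (≈-sym (*-assoc _ _ _))

      Σ-⊛ : ∀ (f : Seq) {A : Set} (xs : List A) (g : A → Seq) n → Σ[ xs ] (λ x → (f ⊛ g x) n) ≈ (f ⊛ (λ i → Σ[ xs ] (λ x → g x i))) n
      Σ-⊛ f []       g n = ≈-sym (Ser.zeroʳ f n)
      Σ-⊛ f (x ∷ xs) g n = ≈-trans (+-congˡ (Σ-⊛ f xs g n)) (≈-sym (⊛-distribˡ f (g x) (λ i → Σ[ xs ] (λ y → g y i)) n))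

      -- The Leibniz rule: differentiating the factor of a block adds a letter to this block.
      Σ-inc : ∀ sz T n → Σ[ upTo (length sz) ] (λ j → blocks (inc j sz) T n) + blocks sz (D T) n ≈ D (blocks sz T) n
      Σ-inc []       T n = +-identityˡ _
      Σ-inc (s ∷ sz) T n = begin
        Σ[ upTo (suc (length sz)) ] (λ j → blocks (inc j (s ∷ sz)) T n) + blocks (s ∷ sz) (D T) n
          ≈⟨ +-congʳ (≈-trans (Σ-upTo-suc (length sz)) (+-congˡ (Σ-⊛ (D^ s V) (upTo (length sz)) (λ j → blocks (inc j sz) T) n))) ⟩
        ((D (D^ s V) ⊛ blocks sz T) n + (D^ s V ⊛ Q) n) + (D^ s V ⊛ blocks sz (D T)) n
          ≈⟨ ≈-trans (+-assoc _ _ _) (+-congˡ (≈-sym (⊛-distribˡ (D^ s V) Q (blocks sz (D T)) n))) ⟩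
        (D (D^ s V) ⊛ blocks sz T) n + (D^ s V ⊛ (Q ⊞ blocks sz (D T))) n
          ≈⟨ +-congˡ (Ser.*-congˡ {D^ s V} (Σ-inc sz T) n) ⟩
        (D (D^ s V) ⊛ blocks sz T) n + (D^ s V ⊛ D (blocks sz T)) n
          ≈⟨ D-⊛ (D^ s V) (blocks sz T) n ⟨
        D (blocks (s ∷ sz) T) n ∎
        where Q : Seq
              Q i = Σ[ upTo (length sz) ] (λ j → blocks (inc j sz) T i)

      -- Faà di Bruno's formula read along words: each letter is one differentiation, which enlarges
      -- a block or, acting on `outer`, opens a new one. A first block is present from the start
      -- because (l - 1)! satisfies its recursion only from l = 1 on.
      ΣRGS-exponential : ∀ k s sz → Σ[ rgsFrom k (suc (length sz)) ] (λ w → sign (length (final (s ∷ sz) w)) * Πκ v (final (s ∷ sz) w)) ≈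
        nat (factorial k) * blocks (s ∷ sz) (outer (suc (length sz))) k
      ΣRGS-exponential zero s sz = begin
        sign l * Πκ v (s ∷ sz) + 0#
          ≈⟨ solveR 2 (λ a b → a :⊗ b :⊕ conR 0 :≈ b :⊗ (a :⊗ conR 1)) ≈-refl (sign l) (Πκ v (s ∷ sz)) ⟩
        Πκ v (s ∷ sz) * (sign l * 1#)
          ≈⟨ *-congˡ (*-congˡ (≈-sym (power-zero l))) ⟩
        Πκ v (s ∷ sz) * outer l 0
          ≈⟨ blocks-zero (s ∷ sz) (outer l) ⟨
        blocks (s ∷ sz) (outer l) 0
          ≈⟨ ≈-trans (*-congʳ (+-identityʳ 1#)) (*-identityˡ _) ⟨
        nat 1 * blocks (s ∷ sz) (outer l) 0 ∎
        where l = suc (length sz)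
      ΣRGS-exponential (suc k) s sz = begin
        Σ[ rgsFrom (suc k) l ] h
          ≈⟨ Σ-concatMap (λ j → map (j ∷_) (rgsFrom k (nextLabel j l))) (upTo (suc l)) ⟩
        Σ[ upTo (suc l) ] (λ j → Σ[ map (j ∷_) (rgsFrom k (nextLabel j l)) ] h)
          ≈⟨ Σ-upTo-last l ⟩
        Σ[ upTo l ] (λ j → Σ[ map (j ∷_) (rgsFrom k (nextLabel j l)) ] h) + Σ[ map (l ∷_) (rgsFrom k (nextLabel l l)) ] h
          ≈⟨ +-cong (≈-trans (Σ-congAll (All.tabulate (λ j∈ → old (∈-upTo⁻ j∈)))) (Σ-*ˡ (nat (factorial k)) (upTo l))) new ⟩
        nat (factorial k) * Σ[ upTo l ] (λ j → blocks (inc j (s ∷ sz)) (outer l) k) + nat (factorial k) * blocks (s ∷ sz) (D (outer l)) k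
          ≈⟨ ≈-trans (≈-sym (distribˡ _ _ _)) (*-congˡ (Σ-inc (s ∷ sz) (outer l) k)) ⟩
        nat (factorial k) * D (blocks (s ∷ sz) (outer l)) k
          ≈⟨ ≈-trans (≈-sym (*-assoc _ _ _)) (*-congʳ (≈-trans (*-comm _ _) (≈-sym (nat-* (suc k) (factorial k))))) ⟩
        nat (factorial (suc k)) * blocks (s ∷ sz) (outer l) (suc k) ∎
        where
        l = suc (length sz)
        h : List ℕ → Carrier
        h w = sign (length (final (s ∷ sz) w)) * Πκ v (final (s ∷ sz) w)
        extend : ∀ sz′ → length sz′ ≡ suc (ℕ.pred (length sz′)) → Σ[ rgsFrom k (length sz′) ] (λ w → sign (length (final sz′ w)) * Πκ v (final sz′ w)) ≈
          nat (factorial k) * blocks sz′ (outer (length sz′)) k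
        extend (s′ ∷ sz′) _ = ΣRGS-exponential k s′ sz′
        step′ : ∀ j → j ≤ l → Σ[ map (j ∷_) (rgsFrom k (nextLabel j l)) ] h ≈ nat (factorial k) * blocks (inc j (s ∷ sz)) (outer (nextLabel j l)) k
        step′ j j≤ = ≈-trans (Σ-map (j ∷_) (rgsFrom k (nextLabel j l)))
          (≈-trans (reflexive (cong (λ t → Σ[ rgsFrom k t ] (h ∘ (j ∷_))) (sym len)))
            (≈-trans (extend (inc j (s ∷ sz)) (positive j)) (*-congˡ (reflexive (cong (λ t → blocks (inc j (s ∷ sz)) (outer t) k) len)))))
          where
          len : length (inc j (s ∷ sz)) ≡ nextLabel j l
          len = length-inc j (s ∷ sz) j≤
          positive : ∀ j → length (inc j (s ∷ sz)) ≡ suc (ℕ.pred (length (inc j (s ∷ sz))))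
          positive zero    = refl
          positive (suc j) = refl
        old : ∀ {j} → j < l → Σ[ map (j ∷_) (rgsFrom k (nextLabel j l)) ] h ≈ nat (factorial k) * blocks (inc j (s ∷ sz)) (outer l) k
        old {j} j< = ≈-trans (step′ j (ℕ.<⇒≤ j<)) (*-congˡ (reflexive (cong (λ t → blocks (inc j (s ∷ sz)) (outer t) k) (nextLabel-< j<))))
        new : Σ[ map (l ∷_) (rgsFrom k (nextLabel l l)) ] h ≈ nat (factorial k) * blocks (s ∷ sz) (D (outer l)) k
        new = ≈-trans (step′ l ℕ.≤-refl) (*-congˡ (≈-trans (reflexive (cong₂ (λ t t′ → blocks t (outer t′) k) (inc-new (s ∷ sz)) (nextLabel-≡ l)))
          (≈-trans (blocks-snoc (s ∷ sz) (outer (suc l)) k) (blocks-cong (s ∷ sz) (Ser.sym (D-outer (length sz))) k))))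

      ΣPartitions : ∀ k → Σ[ SetPartitions (suc k) ] (λ π → sign (length (final [] π)) * Πκ v (final [] π)) ≈ nat (factorial k) * (sign 1 * (D V ⊛ I) k)
      ΣPartitions k = ≈-trans (Σ-concatMap (λ j → map (j ∷_) (rgsFrom k (nextLabel j 0))) (upTo 1)) (≈-trans (+-identityʳ _)
        (≈-trans (Σ-map (0 ∷_) (rgsFrom k 1)) (≈-trans (ΣRGS-exponential k 1 [])
          (*-congˡ (≈-trans (⊛scale (sign 1) (D V) (power 1) k) (*-congˡ (Ser.*-congˡ {D V} (Ser.*-identityʳ I) k)))))))

-- Newton's identities, cumulants as logarithmic coefficients, and the moment recursion.

module Finite (R : CommutativeRing 0ℓ 0ℓ) (ι : ℚ → CommutativeRing.Carrier R)
              (hom : IsRingHomomorphism +-*-rawRing (CommutativeRing.rawRing R) ι) where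
  open Vector using ([]; _∷_)
  open CommutativeRing R renaming (refl to ≈-refl; sym to ≈-sym; trans to ≈-trans)
  open Semi commutativeSemiring
  open Rationals R ι hom
  open SeriesRing R
  open Poly R ι
  open import Algebra.Properties.Ring ring using (-‿distribˡ-*; -‿distribʳ-*; -1*x≈-x)
  open import Relation.Binary.Reasoning.Setoid setoid
  private module Ser = CommutativeSemiring series
  open import Algebra.Solver.Ring.NaturalCoefficients.Default series
    using () renaming (solve to solveS; _:=_ to _:≈_; _:+_ to _:⊕_; _:*_ to _:⊗_; con to conS)
  open import Algebra.Solver.Ring.NaturalCoefficients.Default commutativeSemiring using (solve; _:=_; _:+_; _:*_; con)

  powerSum : ∀ {d} → Vec Carrier d → Seq
  powerSum xs n = Vector.foldr _ (λ x r → powR x n + r) 0# xs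

  -- The coefficients of p(x) = Π (x - λ) in decreasing order, as a product of the series 1 - λ y.
  linear : Carrier → Seq
  linear x zero          = 1#
  linear x (suc zero)    = - x
  linear x (suc (suc n)) = 0#

  signed : ∀ {d} → Vec Carrier d → Seq
  signed []       = const 1#
  signed (x ∷ xs) = signed xs ⊛ linear x

  tail-linear : ∀ x → tail (linear x) ≋ const (- x)
  tail-linear x zero    = ≈-refl
  tail-linear x (suc n) = ≈-refl

  geometric-linear : ∀ x → powR x ⊛ linear x ≋ const 1#
  geometric-linear x n = ≈-trans (⊛-comm (powR x) (linear x) n) (h n)
    where
    h : linear x ⊛ powR x ≋ const 1#
    h zero    = *-identityˡ _
    h (suc n) = ≈-trans (+-cong (*-identityˡ _) (≈-trans (⊛-cong {g = powR x} (tail-linear x) (λ _ → ≈-refl) n) (const⊛ (- x) (powR x) n)))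
      (≈-trans (≈-sym (distribʳ _ _ _)) (≈-trans (*-congʳ (-‿inverseʳ x)) (zeroˡ _)))

  θ-linear : ∀ x → const 1# ⊞ θ (linear x) ≋ linear x
  θ-linear x zero          = solve 0 (con 1 :+ con 0 :* con 1 := con 1) ≈-refl
  θ-linear x (suc zero)    = ≈-trans (+-identityˡ _) (≈-trans (*-congʳ (+-identityʳ 1#)) (*-identityˡ _))
  θ-linear x (suc (suc n)) = ≈-trans (+-identityˡ _) (zeroʳ _)

  -- One root at a time: the geometric series times 1 - x y is 1, and 1 + θ(1 - x y) = 1 - x y, so
  -- each root adds one copy of the product by the Leibniz rule for θ.
  newton : ∀ {d} (xs : Vec Carrier d) → powerSum xs ⊛ signed xs ⊞ θ (signed xs) ≋ const (nat d) ⊛ signed xs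
  newton [] n = ≈-trans (+-cong (Ser.zeroˡ (const 1#) n) (z n)) (≈-trans (+-identityˡ _) (≈-sym (≈-trans (const⊛ 0# (const 1#) n) (zeroˡ _))))
    where z : ∀ n → nat n * const 1# n ≈ 0#
          z zero    = zeroˡ _
          z (suc n) = zeroʳ _
  newton {suc d} (x ∷ xs) = Ser.trans (Ser.+-congˡ {(powR x ⊞ P) ⊛ (B ⊛ L)} (θ-⊛ B L))
    (Ser.trans (solveS 6 (λ g p b l tb tl → (g :⊕ p) :⊗ (b :⊗ l) :⊕ (tb :⊗ l :⊕ b :⊗ tl) :≈ b :⊗ (g :⊗ l :⊕ tl) :⊕ (p :⊗ b :⊕ tb) :⊗ l) Ser.refl (powR x) P B L (θ B) (θ L))
      (Ser.trans (Ser.+-cong (Ser.*-congˡ {B} (Ser.trans (Ser.+-congʳ {θ L} (geometric-linear x)) (θ-linear x))) (Ser.*-congʳ {L} (newton xs)))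
        (Ser.trans (solveS 3 (λ b l k → b :⊗ l :⊕ (k :⊗ b) :⊗ l :≈ (conS 1 :⊕ k) :⊗ (b :⊗ l)) Ser.refl B L (const (nat d)))
          (Ser.*-congʳ {B ⊛ L} const-suc))))
    where
    P = powerSum xs
    B = signed xs
    L = linear x
    const-suc : const 1# ⊞ const (nat d) ≋ const (nat (suc d))
    const-suc zero    = ≈-refl
    const-suc (suc n) = +-identityˡ 0#

  σ : Carrier
  σ = - 1#

  esym-zero : ∀ {d} (xs : Vec Carrier d) → esym xs 0 ≈ 1#
  esym-zero []      = ≈-refl
  esym-zero (_ ∷ _) = ≈-refl

  signed-coeff : ∀ {d} (xs : Vec Carrier d) n → signed xs n ≈ powR σ n * coeff xs n
  signed-coeff [] zero    = ≈-sym (*-identityˡ _)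
  signed-coeff [] (suc n) = ≈-sym (zeroʳ _)
  signed-coeff (x ∷ xs) zero    = *-congʳ (≈-trans (signed-coeff xs 0) (≈-trans (*-identityˡ _) (esym-zero xs)))
  signed-coeff (x ∷ xs) (suc n) = begin
    (signed xs ⊛ linear x) (suc n)
      ≈⟨ ⊛-comm (signed xs) (linear x) (suc n) ⟩
    1# * signed xs (suc n) + (tail (linear x) ⊛ signed xs) n
      ≈⟨ +-cong (*-identityˡ _) (≈-trans (⊛-cong {g = signed xs} (tail-linear x) (λ _ → ≈-refl) n) (const⊛ (- x) (signed xs) n)) ⟩
    signed xs (suc n) + - x * signed xs n
      ≈⟨ +-cong (signed-coeff xs (suc n)) (*-cong (≈-sym (-1*x≈-x x)) (signed-coeff xs n)) ⟩
    (σ * powR σ n) * esym xs (suc n) + (σ * x) * (powR σ n * esym xs n)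
      ≈⟨ solve 5 (λ s p a x b → (s :* p) :* a :+ (s :* x) :* (p :* b) := (s :* p) :* (a :+ x :* b)) ≈-refl σ (powR σ n) (esym xs (suc n)) x (esym xs n) ⟩
    powR σ (suc n) * esym (x ∷ xs) (suc n) ∎

  module _ {d : ℕ} (1≤d : 1 ≤ d) (λs : Vec Carrier d) where

    e ε t : Carrier
    e = recip d
    ε = - e
    t = - nat d

    e-nat : e * nat d ≈ 1#
    e-nat = recip-unit 1≤d

    t-ε : t * ε ≈ 1#
    t-ε = ≈-trans (≈-sym (-‿distribˡ-* _ _)) (≈-trans (-‿cong (≈-sym (-‿distribʳ-* _ _))) (≈-trans (-‿involutive _) (≈-trans (*-comm _ _) e-nat)))
      where open import Algebra.Properties.Group +-group using () renaming (⁻¹-involutive to -‿involutive)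

    a : ℕ → Carrier
    a = coeff λs

    V : Seq
    V n = recip (falling d n) * a n

    V-zero : V 0 ≈ 1#
    V-zero = ≈-trans (*-cong recip-1 (esym-zero λs)) (*-identityˡ _)

    v : ℕ → Carrier
    v n = ι (divN (ℤ.+ factorial n) (falling d n)) * a n

    v-V : ∀ n → nat (factorial n) * V n ≈ v n
    v-V n = ≈-trans (≈-sym (*-assoc _ _ _)) (*-congʳ (≈-trans (*-congʳ (≈-sym (ι-int-nat (factorial n)))) (≈-sym (ι-divN _ (falling d n)))))

    sign : ℕ → Carrier
    sign l = ι-int ((ℤ.- (ℤ.+ 1)) ℤ.^ l) * ι-int (ℤ.+ factorial (l ℕ.∸ 1))

    ι-σ : ι-int (ℤ.- (ℤ.+ 1)) ≈ σ
    ι-σ = neg-unique (≈-trans (+-congʳ (≈-sym (recip-1))) (ι-int-neg (ℤ.+ 1)))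

    sign-suc : ∀ l → sign (suc (suc l)) + nat (suc l) * sign (suc l) ≈ 0#
    sign-suc l = begin
      ι-int ((ℤ.- (ℤ.+ 1)) ℤ.^ suc (suc l)) * ι-int (ℤ.+ factorial (suc l)) + nat (suc l) * (s * ι-int (ℤ.+ factorial l))
        ≈⟨ +-cong (*-cong (≈-trans (ι-int-* (ℤ.- (ℤ.+ 1)) ((ℤ.- (ℤ.+ 1)) ℤ.^ suc l)) (*-congʳ ι-σ)) (≈-trans (ι-int-nat (factorial (suc l))) (nat-* (suc l) (factorial l)))) (*-congˡ (*-congˡ (ι-int-nat (factorial l)))) ⟩
      (σ * s) * (nat (suc l) * nat (factorial l)) + nat (suc l) * (s * nat (factorial l))
        ≈⟨ solve 4 (λ g s n f → (g :* s) :* (n :* f) :+ n :* (s :* f) := (g :+ con 1) :* (n :* (s :* f))) ≈-refl σ s (nat (suc l)) (nat (factorial l)) ⟩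
      (σ + 1#) * (nat (suc l) * (s * nat (factorial l)))
        ≈⟨ ≈-trans (*-congʳ (-‿inverseˡ 1#)) (zeroˡ _) ⟩
      0# ∎
      where s = ι-int ((ℤ.- (ℤ.+ 1)) ℤ.^ suc l)

    open Inverse V V-zero
    open Exponential sign sign-suc v v-V

    L : Seq
    L = D V ⊛ inverse-series

    L-V : L ⊛ V ≋ D V
    L-V = Ser.trans (solveS 3 (λ dv i v → (dv :⊗ i) :⊗ v :≈ (v :⊗ i) :⊗ dv) Ser.refl (D V) inverse-series V)
      (Ser.trans (Ser.*-congʳ {D V} ⊛-inverse) (Ser.*-identityˡ (D V)))

    sizes-product : ∀ bs → (ι-int (ℤ.+ foldr ℕ._*_ 1 (map factorial bs)) * recip (foldr ℕ._*_ 1 (map (falling d) bs))) * prodR (map a bs) ≈ Πκ v bs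
    sizes-product []       = ≈-trans (*-cong (*-cong recip-1 recip-1) ≈-refl) (≈-trans (*-identityʳ _) (*-identityʳ _))
    sizes-product (b ∷ bs) = begin
      (ι-int (ℤ.+ (factorial b ℕ.* F)) * recip (falling d b ℕ.* G)) * (a b * A)
        ≈⟨ *-congʳ (*-cong (≈-trans (ι-int-nat (factorial b ℕ.* F)) (≈-trans (nat-* (factorial b) F) (*-congˡ (≈-sym (ι-int-nat F))))) (recip-* (falling d b) G)) ⟩
      ((nat (factorial b) * ι-int (ℤ.+ F)) * (recip (falling d b) * recip G)) * (a b * A)
        ≈⟨ solve 6 (λ f F r R a A → ((f :* F) :* (r :* R)) :* (a :* A) := (f :* (r :* a)) :* ((F :* R) :* A)) ≈-refl _ _ _ _ _ _ ⟩
      (nat (factorial b) * V b) * ((ι-int (ℤ.+ F) * recip G) * A)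
        ≈⟨ *-cong (v-V b) (sizes-product bs) ⟩
      v b * Πκ v bs ∎
      where F = foldr ℕ._*_ 1 (map factorial bs)
            G = foldr ℕ._*_ 1 (map (falling d) bs)
            A = prodR (map a bs)

    ι-t : ι-int (ℤ.- (ℤ.+ d)) ≈ t
    ι-t = neg-unique (≈-trans (+-congʳ (≈-sym (ι-int-nat d))) (ι-int-neg (ℤ.+ d)))

    ι-power : ∀ n → ι-int ((ℤ.- (ℤ.+ d)) ℤ.^ n) ≈ powR t n
    ι-power zero    = recip-1
    ι-power (suc n) = ≈-trans (ι-int-* (ℤ.- (ℤ.+ d)) ((ℤ.- (ℤ.+ d)) ℤ.^ n)) (*-cong ι-t (ι-power n))

    cumulant-term : ∀ k π → ι (cumCoef d (suc k) π) * coeffπ λs π ≈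
      (powR t (suc k) * (e * recip (factorial k))) * (sign (numBlocks π) * Πκ v (blockSizes π))
    cumulant-term k π = begin
      ι (divN (A ℤ.* B ℤ.* C ℤ.* E) (d ℕ.* factorial k ℕ.* G)) * P
        ≈⟨ *-congʳ (ι-divN (A ℤ.* B ℤ.* C ℤ.* E) (d ℕ.* factorial k ℕ.* G)) ⟩
      (ι-int (A ℤ.* B ℤ.* C ℤ.* E) * recip (d ℕ.* factorial k ℕ.* G)) * P
        ≈⟨ *-congʳ (*-cong (≈-trans (ι-int-* (A ℤ.* B ℤ.* C) E) (*-congʳ (≈-trans (ι-int-* (A ℤ.* B) C) (*-congʳ (≈-trans (ι-int-* A B) (*-congʳ (ι-power (suc k))))))))
             (≈-trans (recip-* (d ℕ.* factorial k) G) (*-congʳ (recip-* d (factorial k))))) ⟩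
      ((((powR t (suc k) * ι-int B) * ι-int C) * ι-int E) * ((e * recip (factorial k)) * recip G)) * P
        ≈⟨ solve 7 (λ t b c e r g p → ((((t :* b) :* c) :* e) :* (r :* g)) :* p := (t :* r) :* ((b :* e) :* ((c :* g) :* p))) ≈-refl
             (powR t (suc k)) (ι-int B) (ι-int C) (ι-int E) (e * recip (factorial k)) (recip G) P ⟩
      (powR t (suc k) * (e * recip (factorial k))) * ((ι-int B * ι-int E) * ((ι-int C * recip G) * P))
        ≈⟨ *-congˡ (*-congˡ (sizes-product (blockSizes π))) ⟩
      (powR t (suc k) * (e * recip (factorial k))) * (sign (numBlocks π) * Πκ v (blockSizes π)) ∎
      where
      A B C E : ℤ
      A = (ℤ.- (ℤ.+ d)) ℤ.^ suc k
      B = (ℤ.- (ℤ.+ 1)) ℤ.^ numBlocks π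
      C = ℤ.+ foldr ℕ._*_ 1 (map factorial (blockSizes π))
      E = ℤ.+ factorial (numBlocks π ℕ.∸ 1)
      G = foldr ℕ._*_ 1 (map (falling d) (blockSizes π))
      P = coeffπ λs π

    factorial-pos : ∀ k → recip (factorial k) * nat (factorial k) ≈ 1#
    factorial-pos k = recip-unit (pos k)
      where
      pos : ∀ k → 1 ≤ factorial k
      pos zero    = s≤s z≤n
      pos (suc k) = ℕ.≤-trans (pos k) (ℕ.m≤m+n (factorial k) (k ℕ.* factorial k))

    -- The factor (-d)^(k+1) / (d k!) meets k! from the exponential series and -1 from the
    -- logarithm; since (-d)(-1)/d = 1, only (-d)^k survives.
    cumulant-series : ∀ k → cumulant λs (suc k) ≈ powR t k * L k
    cumulant-series k = begin
      cumulant λs (suc k)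
        ≈⟨ Σ-congAll (All.tabulate (λ {π} π∈ → let r = proj₁ (rgsFrom-sound (suc k) 0 π∈) in ≈-trans (cumulant-term k π)
             (*-congˡ (reflexive (cong₂ (λ l bs → sign l * Πκ v bs) (numBlocks-final r) (blockSizes-final r)))))) ⟩
      Σ[ SetPartitions (suc k) ] (λ π → (powR t (suc k) * (e * recip (factorial k))) * (sign (length (final [] π)) * Πκ v (final [] π)))
        ≈⟨ ≈-trans (Σ-*ˡ _ (SetPartitions (suc k))) (*-congˡ (ΣPartitions k)) ⟩
      (powR t (suc k) * (e * recip (factorial k))) * (nat (factorial k) * (sign 1 * L k))
        ≈⟨ *-congˡ (*-congˡ (*-congʳ (≈-trans (*-cong (≈-trans (ι-int-* (ℤ.- (ℤ.+ 1)) (ℤ.+ 1)) (≈-trans (*-cong ι-σ recip-1) (*-identityʳ _))) recip-1) (*-identityʳ _)))) ⟩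
      ((t * powR t k) * (e * recip (factorial k))) * (nat (factorial k) * (σ * L k))
        ≈⟨ solve 7 (λ t p e r n s l → ((t :* p) :* (e :* r)) :* (n :* (s :* l)) := ((r :* n) :* (t :* (s :* e))) :* (p :* l)) ≈-refl t (powR t k) e (recip (factorial k)) (nat (factorial k)) σ (L k) ⟩
      ((recip (factorial k) * nat (factorial k)) * (t * (σ * e))) * (powR t k * L k)
        ≈⟨ *-congʳ (*-cong (factorial-pos k) (≈-trans (*-congˡ (-1*x≈-x e)) t-ε)) ⟩
      (1# * 1#) * (powR t k * L k)
        ≈⟨ ≈-trans (*-congʳ (*-identityˡ 1#)) (*-identityˡ _) ⟩
      powR t k * L k ∎

    κ⁺ h : Seq
    κ⁺ zero    = 1#
    κ⁺ (suc k) = cumulant λs (suc k)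
    h n = powR t n * V n

    powR-⊛ : ∀ f g n → ((λ i → powR t i * f i) ⊛ (λ i → powR t i * g i)) n ≈ powR t n * (f ⊛ g) n
    powR-⊛ f g zero    = solve 2 (λ a b → (con 1 :* a) :* (con 1 :* b) := con 1 :* (a :* b)) ≈-refl _ _
    powR-⊛ f g (suc n) = begin
      (1# * f 0) * ((t * powR t n) * g (suc n)) + ((λ i → (t * powR t i) * f (suc i)) ⊛ (λ i → powR t i * g i)) n
        ≈⟨ +-congˡ (≈-trans (⊛-cong {g = λ i → powR t i * g i} (λ i → *-assoc t (powR t i) (f (suc i))) (λ _ → ≈-refl) n)
             (≈-trans (scale⊛ t (λ i → powR t i * tail f i) (λ i → powR t i * g i) n) (*-congˡ (powR-⊛ (tail f) g n)))) ⟩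
      (1# * f 0) * ((t * powR t n) * g (suc n)) + t * (powR t n * (tail f ⊛ g) n)
        ≈⟨ solve 5 (λ a t p b c → (con 1 :* a) :* ((t :* p) :* b) :+ t :* (p :* c) := (t :* p) :* (a :* b :+ c)) ≈-refl _ _ _ _ _ ⟩
      (t * powR t n) * (f 0 * g (suc n) + (tail f ⊛ g) n) ∎

    -- The logarithmic derivative of h is -d times the generating series of the cumulants.
    κ-h : ∀ n → (κ⁺ ⊛ h) n ≈ (1# + ε * nat n) * h n
    κ-h zero    = *-congʳ (≈-sym (≈-trans (+-congˡ (zeroʳ ε)) (+-identityʳ 1#)))
    κ-h (suc n) = begin
      1# * h (suc n) + (tail κ⁺ ⊛ h) n
        ≈⟨ +-congˡ (≈-trans (⊛-cong {g = h} cumulant-series (λ _ → ≈-refl) n) (≈-trans (powR-⊛ L V n) (*-congˡ (L-V n)))) ⟩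
      1# * h (suc n) + powR t n * (nat (suc n) * V (suc n))
        ≈⟨ +-congˡ (≈-trans (≈-sym (*-identityˡ _)) (*-congʳ (≈-sym t-ε))) ⟩
      1# * h (suc n) + (t * ε) * (powR t n * (nat (suc n) * V (suc n)))
        ≈⟨ solve 6 (λ x t ε p n v → con 1 :* x :+ (t :* ε) :* (p :* (n :* v)) := con 1 :* x :+ (ε :* n) :* ((t :* p) :* v)) ≈-refl (h (suc n)) t ε (powR t n) (nat (suc n)) (V (suc n)) ⟩
      1# * h (suc n) + (ε * nat (suc n)) * h (suc n)
        ≈⟨ distribʳ _ _ _ ⟨
      (1# + ε * nat (suc n)) * h (suc n) ∎

    -- In closed form, (d)_n / d^n.
    c : Seq
    c zero    = 1#
    c (suc n) = (1# + ε * nat n) * c n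

    b : Seq
    b = signed λs

    -- For n ≤ d the factors d - i with i < n are invertible. Beyond d the left side is 0, and with
    -- it the passage from `b` to `h` breaks down.
    falling-pos : ∀ n → n ≤ d → (c n * powR t n) * recip (falling d n) ≈ powR σ n
    falling-pos zero    n≤ = ≈-trans (*-cong (*-identityˡ _) recip-1) (*-identityˡ _)
    falling-pos (suc n) n< = begin
      (((1# + ε * nat n) * c n) * (t * powR t n)) * recip ((d ℕ.∸ n) ℕ.* falling d n)
        ≈⟨ *-congˡ (recip-* (d ℕ.∸ n) (falling d n)) ⟩
      (((1# + ε * nat n) * c n) * (t * powR t n)) * (recip (d ℕ.∸ n) * recip (falling d n))
        ≈⟨ solve 7 (λ ε n c t p r f → (((con 1 :+ ε :* n) :* c) :* (t :* p)) :* (r :* f) := ((t :+ (t :* ε) :* n) :* r) :* ((c :* p) :* f)) ≈-refl ε (nat n) (c n) t (powR t n) (recip (d ℕ.∸ n)) (recip (falling d n)) ⟩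
      ((t + (t * ε) * nat n) * recip (d ℕ.∸ n)) * ((c n * powR t n) * recip (falling d n))
        ≈⟨ *-cong (≈-trans (*-congʳ (≈-trans (+-congˡ (≈-trans (*-congʳ t-ε) (*-identityˡ _))) gap)) unit) (falling-pos n (ℕ.<⇒≤ n<)) ⟩
      σ * powR σ n ∎
      where
      gap : t + nat n ≈ - nat (d ℕ.∸ n)
      gap = neg-unique (begin
        nat (d ℕ.∸ n) + (t + nat n)   ≈⟨ solve 3 (λ a b c → a :+ (b :+ c) := (a :+ c) :+ b) ≈-refl _ _ _ ⟩
        (nat (d ℕ.∸ n) + nat n) + t   ≈⟨ +-congʳ (≈-trans (≈-sym (nat-+ (d ℕ.∸ n) n)) (reflexive (cong nat (ℕ.m∸n+n≡m (ℕ.<⇒≤ n<))))) ⟩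
        nat d + t                     ≈⟨ -‿inverseʳ _ ⟩
        0#                            ∎)
      unit : - nat (d ℕ.∸ n) * recip (d ℕ.∸ n) ≈ σ
      unit = ≈-trans (≈-sym (-‿distribˡ-* _ _)) (-‿cong (≈-trans (*-comm _ _) (recip-unit (ℕ.m<n⇒0<n∸m n<))))

    b-c-h : ∀ n → n ≤ d → b n ≈ c n * h n
    b-c-h n n≤ = ≈-trans (signed-coeff λs n) (≈-trans (*-congʳ (≈-sym (falling-pos n n≤)))
      (solve 4 (λ c p r a → ((c :* p) :* r) :* a := c :* (p :* (r :* a))) ≈-refl _ _ _ _))

    moment-b : ∀ n → (moment λs ⊛ b) n ≈ b n + ε * θ b n
    moment-b n = ≈-trans (scale⊛ e (powerSum λs) b n) (begin
      e * (powerSum λs ⊛ b) n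
        ≈⟨ ≈-trans (+-congˡ (≈-trans (≈-sym (distribʳ (θ b n) e ε)) (≈-trans (*-congʳ (-‿inverseʳ e)) (zeroˡ _)))) (+-identityʳ _) ⟨
      e * (powerSum λs ⊛ b) n + (e * θ b n + ε * θ b n)
        ≈⟨ solve 4 (λ e p t x → e :* p :+ (e :* t :+ x) := e :* (p :+ t) :+ x) ≈-refl e _ (θ b n) (ε * θ b n) ⟩
      e * ((powerSum λs ⊛ b) n + θ b n) + ε * θ b n
        ≈⟨ +-congʳ (*-congˡ (≈-trans (newton λs n) (const⊛ (nat d) b n))) ⟩
      e * (nat d * b n) + ε * θ b n
        ≈⟨ +-congʳ (≈-trans (≈-sym (*-assoc _ _ _)) (≈-trans (*-congʳ e-nat) (*-identityˡ _))) ⟩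
      b n + ε * θ b n ∎)

    module _ (F : ℕ → Seq) (F-zero : ∀ j → F j 0 ≈ κ⁺ j)
             (F-step : ∀ j n → F j (suc n) ≈ (F 0 ⊛ F (suc j)) n + (ε * nat n) * F (suc j) n) where

      from : ℕ → Seq
      from j i = κ⁺ (i ℕ.+ j)

      Identity : ℕ → Set
      Identity n = ∀ j → (F j ⊛ b) n ≈ c n * (from j ⊛ h) n

      F₀-b : ∀ n → n ≤ d → Identity n → (F 0 ⊛ b) n ≈ b n + ε * θ b n
      F₀-b n n≤ I = begin
        (F 0 ⊛ b) n                       ≈⟨ I 0 ⟩
        c n * (from 0 ⊛ h) n              ≈⟨ *-congˡ (≈-trans (⊛-cong {g = h} (λ i → reflexive (cong κ⁺ (ℕ.+-identityʳ i))) (λ _ → ≈-refl) n) (κ-h n)) ⟩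
        c n * ((1# + ε * nat n) * h n)    ≈⟨ solve 4 (λ c e n h → c :* ((con 1 :+ e :* n) :* h) := c :* h :+ e :* (n :* (c :* h))) ≈-refl (c n) ε (nat n) (h n) ⟩
        c n * h n + ε * (nat n * (c n * h n))  ≈⟨ +-cong (b-c-h n n≤) (*-congˡ (*-congˡ (b-c-h n n≤))) ⟨
        b n + ε * θ b n ∎

      -- N is the bound of a strong induction: the step to n + 1 multiplies by `F 0 ⊛ b` and so
      -- needs `F₀-b` at every i ≤ n.
      identity : ∀ N n → n ≤ N → N ≤ d → Identity n
      identity N zero n≤N N≤d j = begin
        F j 0 * b 0        ≈⟨ *-cong (F-zero j) (b-c-h 0 z≤n) ⟩
        κ⁺ j * (1# * h 0)  ≈⟨ solve 2 (λ a b → a :* (con 1 :* b) := con 1 :* (a :* b)) ≈-refl _ _ ⟩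
        1# * (κ⁺ j * h 0)  ∎
      identity (suc N) (suc n) (s≤s n≤N) N<d j = begin
        F j 0 * b (suc n) + (tail (F j) ⊛ b) n
          ≈⟨ +-cong (*-cong (F-zero j) (b-c-h (suc n) (ℕ.≤-trans (s≤s n≤N) N<d))) rest ⟩
        κ⁺ j * (c (suc n) * h (suc n)) + c (suc n) * (from (suc j) ⊛ h) n
          ≈⟨ solve 4 (λ k c h x → k :* (c :* h) :+ c :* x := c :* (k :* h :+ x)) ≈-refl _ _ _ _ ⟩
        c (suc n) * (κ⁺ j * h (suc n) + (from (suc j) ⊛ h) n)
          ≈⟨ *-congˡ (+-congˡ (⊛-cong {g = h} (λ i → reflexive (cong κ⁺ (ℕ.+-suc i j))) (λ _ → ≈-refl) n)) ⟩
        c (suc n) * (from j ⊛ h) (suc n) ∎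
        where
        N≤d = ℕ.<⇒≤ N<d
        G = F (suc j)
        rest : (tail (F j) ⊛ b) n ≈ c (suc n) * (from (suc j) ⊛ h) n
        rest = begin
          (tail (F j) ⊛ b) n
            ≈⟨ ⊛-cong {g = b} (λ i → ≈-trans (F-step j i) (+-congˡ (*-assoc _ _ _))) (λ _ → ≈-refl) n ⟩
          ((F 0 ⊛ G ⊞ (λ i → ε * θ G i)) ⊛ b) n
            ≈⟨ ≈-trans (⊛-distribʳ b (F 0 ⊛ G) (λ i → ε * θ G i) n) (+-cong (solveS 3 (λ f g b → (f :⊗ g) :⊗ b :≈ g :⊗ (f :⊗ b)) Ser.refl (F 0) G b n) (scale⊛ ε (θ G) b n)) ⟩
          (G ⊛ (F 0 ⊛ b)) n + ε * (θ G ⊛ b) n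
            -- Replacing `F 0 ⊛ b` by b + ε θ b makes the quadratic recursion linear; with the
            -- correction term, θ then acts on the whole product G b.
            ≈⟨ +-congʳ (⊛-cong≤ {G} {G} n (λ _ _ → ≈-refl) (λ i i≤n → F₀-b i (ℕ.≤-trans i≤n (ℕ.≤-trans n≤N N≤d)) (identity N i (ℕ.≤-trans i≤n n≤N) N≤d))) ⟩
          (G ⊛ (b ⊞ (λ i → ε * θ b i))) n + ε * (θ G ⊛ b) n
            ≈⟨ +-congʳ (≈-trans (⊛-distribˡ G b (λ i → ε * θ b i) n) (+-congˡ (⊛scale ε G (θ b) n))) ⟩
          ((G ⊛ b) n + ε * (G ⊛ θ b) n) + ε * (θ G ⊛ b) n
            ≈⟨ solve 4 (λ a e x y → (a :+ e :* x) :+ e :* y := a :+ e :* (y :+ x)) ≈-refl _ _ _ _ ⟩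
          (G ⊛ b) n + ε * ((θ G ⊛ b) n + (G ⊛ θ b) n)
            ≈⟨ +-congˡ (*-congˡ (θ-⊛ G b n)) ⟨
          (G ⊛ b) n + ε * (nat n * (G ⊛ b) n)
            ≈⟨ solve 3 (λ a e n → a :+ e :* (n :* a) := (con 1 :+ e :* n) :* a) ≈-refl _ _ _ ⟩
          (1# + ε * nat n) * (G ⊛ b) n
            ≈⟨ *-congˡ (identity N n n≤N N≤d (suc j)) ⟩
          (1# + ε * nat n) * (c n * (from (suc j) ⊛ h) n)
            ≈⟨ *-assoc _ _ _ ⟨
          c (suc n) * (from (suc j) ⊛ h) n ∎

      moment-recursion : ∀ n → n ≤ d → moment λs n ≈ F 0 n
      moment-recursion n n≤d = Inverse.⊛-cancel b (≈-trans (signed-coeff λs 0) (≈-trans (*-identityˡ _) (esym-zero λs))) n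
        (λ i i≤n → ≈-trans (moment-b i) (≈-sym (F₀-b i (ℕ.≤-trans i≤n n≤d) (identity d i (ℕ.≤-trans i≤n n≤d) ℕ.≤-refl))))

-- Expansion in powers of 1/d.

-- Formal expressions: (q , k , c) stands for the term q e^k κ_c, where κ_c is the product of the κ_i over i in c.
Term Expr : Set
Term = ℚ × ℕ × List ℕ
Expr = List Term

_·_ : Term → Term → Term
(q , k , c) · (q′ , k′ , c′) = q ℚ.* q′ , k ℕ.+ k′ , c ++ c′

_⊗_ : Expr → Expr → Expr
P ⊗ Q = concatMap (λ t → map (t ·_) Q) P

convolve : (ℕ → Expr) → (ℕ → Expr) → ℕ → Expr
convolve f g zero    = f 0 ⊗ g 0
convolve f g (suc n) = f 0 ⊗ g (suc n) ++ convolve (f ∘ suc) g n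

kappa : ℕ → Expr
kappa zero    = (ℚ.1ℚ , 0 , []) ∷ []
kappa (suc j) = (ℚ.1ℚ , 0 , suc j ∷ []) ∷ []

lower : ℕ → Term → Term
lower n (q , k , c) = divN (ℤ.- (ℤ.+ n)) 1 ℚ.* q , suc k , c

-- For n = 0 the coefficient -n is zero. Leaving the term out, instead of keeping it with
-- coefficient 0, is what keeps the formal degree below n.
correction : ℕ → Expr → Expr
correction zero    P = []
correction (suc n) P = map (lower (suc n)) P

recur : (ℕ → ℕ → Expr) → ℕ → ℕ → Expr
recur F j zero    = kappa j
recur F j (suc n) = convolve (F 0) (F (suc j)) n ++ correction n (F (suc j) n)

convolve-cong : ∀ {f f′ g g′} n → (∀ i → i ≤ n → f i ≡ f′ i) → (∀ i → i ≤ n → g i ≡ g′ i) → convolve f g n ≡ convolve f′ g′ n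
convolve-cong zero    p q = cong₂ _⊗_ (p 0 z≤n) (q 0 z≤n)
convolve-cong (suc n) p q = cong₂ _++_ (cong₂ _⊗_ (p 0 z≤n) (q (suc n) ℕ.≤-refl))
  (convolve-cong n (λ i i≤ → p (suc i) (s≤s i≤)) (λ i i≤ → q i (ℕ.m≤n⇒m≤1+n i≤)))

recur-causal : ∀ {F G} n → (∀ j i → i < n → F j i ≡ G j i) → ∀ j → recur F j n ≡ recur G j n
recur-causal zero    e j = refl
recur-causal (suc n) e j = cong₂ _++_ (convolve-cong n (λ i i≤ → e 0 i (s≤s i≤)) (λ i i≤ → e (suc j) i (s≤s i≤)))
  (cong (correction n) (e (suc j) n ℕ.≤-refl))

open Fix {Expr} _≡_ [] refl recur recur-causal using (approx) renaming (fix to Φ; fix-step to Φ-step)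

-- Weight and positivity say that the indices of a term form a composition of m, hence the block
-- sizes of a partition.
record Bounded (m p : ℕ) (t : Term) : Set where
  constructor bounded
  field
    degree   : proj₁ (proj₂ t) ≤ p
    weight   : sum (proj₂ (proj₂ t)) ≡ m
    positive : All (1 ≤_) (proj₂ (proj₂ t))

⊗-bounded : ∀ {m p m′ p′ P Q} → All (Bounded m p) P → All (Bounded m′ p′) Q → All (Bounded (m ℕ.+ m′) (p ℕ.+ p′)) (P ⊗ Q)
⊗-bounded []       bQ = []
⊗-bounded {P = (_ , _ , c) ∷ P} (bounded d w s ∷ bP) bQ =
  All.++⁺ (All.map⁺ (All.map (λ {t} (bounded d′ w′ s′) → bounded (ℕ.+-mono-≤ d d′) (trans (sum-++ c (proj₂ (proj₂ t))) (cong₂ ℕ._+_ w w′)) (All.++⁺ s s′)) bQ))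
          (⊗-bounded bP bQ)

Bounded-≡ : ∀ {m m′ p p′ P} → m ≡ m′ → p ≤ p′ → All (Bounded m p) P → All (Bounded m′ p′) P
Bounded-≡ refl le = All.map (λ (bounded d w s) → bounded (ℕ.≤-trans d le) w s)

-- The offset x accounts for the tails of the left factor on which `convolve` recurses.
convolve-bounded : ∀ x y {f g} → (∀ i → All (Bounded (x ℕ.+ i) (x ℕ.+ i)) (f i)) → (∀ i → All (Bounded (y ℕ.+ i) i) (g i)) →
                   ∀ n → All (Bounded (x ℕ.+ (y ℕ.+ n)) (x ℕ.+ n)) (convolve f g n)
convolve-bounded x y bf bg zero    = Bounded-≡ (cong (ℕ._+ (y ℕ.+ 0)) (ℕ.+-identityʳ x)) (ℕ.≤-reflexive (ℕ.+-identityʳ _)) (⊗-bounded (bf 0) (bg 0))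
convolve-bounded x y bf bg (suc n) = All.++⁺
  (Bounded-≡ (cong (ℕ._+ (y ℕ.+ suc n)) (ℕ.+-identityʳ x)) (ℕ.≤-reflexive (cong (ℕ._+ suc n) (ℕ.+-identityʳ x))) (⊗-bounded (bf 0) (bg (suc n))))
  (Bounded-≡ (trans (sym (ℕ.+-suc x (y ℕ.+ n))) (cong (x ℕ.+_) (sym (ℕ.+-suc y n)))) (ℕ.≤-reflexive (sym (ℕ.+-suc x n)))
    (convolve-bounded (suc x) y (λ i → Bounded-≡ (ℕ.+-suc x i) (ℕ.≤-reflexive (ℕ.+-suc x i)) (bf (suc i))) bg n))

approx-bounded : ∀ k j n → All (Bounded (j ℕ.+ n) (ℕ.pred n)) (approx k j n)
approx-bounded zero    j n = []
approx-bounded (suc k) zero    zero = bounded z≤n refl [] ∷ []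
approx-bounded (suc k) (suc j) zero = bounded z≤n refl (s≤s z≤n ∷ []) ∷ []
approx-bounded (suc k) j (suc n) = All.++⁺
  (Bounded-≡ (sym (ℕ.+-suc j n)) ℕ.≤-refl (convolve-bounded 0 (suc j) (λ i → Bounded-≡ refl ℕ.pred[n]≤n (approx-bounded k 0 i))
     (λ i → Bounded-≡ refl ℕ.pred[n]≤n (approx-bounded k (suc j) i)) n))
  (corr n (approx-bounded k (suc j) n))
  where
  corr : ∀ n {P} → All (Bounded (suc j ℕ.+ n) (ℕ.pred n)) P → All (Bounded (j ℕ.+ suc n) n) (correction n P)
  corr zero    b = []
  corr (suc n) b = All.map⁺ (All.map (λ (bounded d w s) → bounded (s≤s d) (trans w (sym (ℕ.+-suc j (suc n)))) s) b)

-- A canonical set partition with prescribed block sizes, into consecutive intervals; it turns a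
-- product of cumulants over a list of indices into some κ_σ.
intervals : ℕ → List ℕ → List ℕ
intervals m []       = []
intervals m (c ∷ cs) = replicate c m ++ intervals (suc m) cs

extend-rgs : ∀ {k j m w} → j ≤ m → w ∈ rgsFrom k (nextLabel j m) → j ∷ w ∈ rgsFrom (suc k) m
extend-rgs {k} {j} {m} j≤ w∈ = ∈-concatMap⁺ (λ j → map (j ∷_) (rgsFrom k (nextLabel j m))) (lose (∈-upTo⁺ (s≤s j≤)) (∈-map⁺ (j ∷_) w∈))

intervals-∈ : ∀ m {cs} → All (1 ≤_) cs → intervals m cs ∈ rgsFrom (sum cs) m
intervals-∈ m []                       = here refl
intervals-∈ m {suc c ∷ cs} (_ ∷ ps) = extend-rgs {c ℕ.+ sum cs} {m} {m} ℕ.≤-refl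
  (subst (λ t → replicate c m ++ intervals (suc m) cs ∈ rgsFrom (c ℕ.+ sum cs) t) (sym (nextLabel-≡ m)) (repeat c))
  where
  repeat : ∀ c → replicate c m ++ intervals (suc m) cs ∈ rgsFrom (c ℕ.+ sum cs) (suc m)
  repeat zero    = intervals-∈ (suc m) ps
  repeat (suc c) = extend-rgs {c ℕ.+ sum cs} {m} {suc m} (ℕ.n≤1+n m)
    (subst (λ t → replicate c m ++ intervals (suc m) cs ∈ rgsFrom (c ℕ.+ sum cs) t) (sym (nextLabel-< ℕ.≤-refl)) (repeat c))

inc-last : ∀ sz s → inc (length sz) (sz ++ s ∷ []) ≡ sz ++ suc s ∷ []
inc-last []       s = refl
inc-last (_ ∷ sz) s = cong (_ ∷_) (inc-last sz s)

final-replicate : ∀ sz s c w → final (sz ++ s ∷ []) (replicate c (length sz) ++ w) ≡ final (sz ++ s ℕ.+ c ∷ []) w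
final-replicate sz s zero    w = cong (λ t → final (sz ++ t ∷ []) w) (sym (ℕ.+-identityʳ s))
final-replicate sz s (suc c) w = trans (cong (λ t → final t (replicate c (length sz) ++ w)) (inc-last sz s))
  (trans (final-replicate sz (suc s) c w) (cong (λ t → final (sz ++ t ∷ []) w) (sym (ℕ.+-suc s c))))

final-intervals : ∀ sz {cs} → All (1 ≤_) cs → final sz (intervals (length sz) cs) ≡ sz ++ cs
final-intervals sz []                        = sym (++-identityʳ sz)
final-intervals sz {suc c ∷ cs} (_ ∷ ps) = trans (cong (λ t → final t (replicate c (length sz) ++ intervals (suc (length sz)) cs)) (inc-new sz))
  (trans (final-replicate sz 1 c _) (trans (cong (λ t → final (sz ++ suc c ∷ []) (intervals t cs)) (sym (trans (length-++ sz) (ℕ.+-comm (length sz) 1))))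
    (trans (final-intervals (sz ++ suc c ∷ []) ps) (++-assoc sz (suc c ∷ []) cs))))

rgsFrom-unique : ∀ k m → Unique (rgsFrom k m)
rgsFrom-unique zero    m = [] ∷ []
rgsFrom-unique (suc k) m = Unique-prefixes (upTo (suc m)) (Unique.upTo⁺ (suc m)) (λ j → rgsFrom-unique k (nextLabel j m))

isIntervals : List ℕ → List ℕ → Bool
isIntervals c σ = ⌊ ≡-dec ℕ._≟_ σ (intervals 0 c) ⌋

-- Each term of degree k is charged to its interval partition, and all other partitions get 0. Only
-- the formal family enters, so the value is independent of the ring, of d and of the roots.
errorCoefficient : ℕ → ℕ → List ℕ → ℚ
errorCoefficient n k σ = foldr ℚ._+_ ℚ.0ℚ (map (λ (q , k′ , c) → if (k′ ≡ᵇ k) ∧ isIntervals c σ then q else ℚ.0ℚ) (Φ 0 n))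

-- Evaluating the formal terms and their coefficients in e.

module Evaluation (R : CommutativeRing 0ℓ 0ℓ) (ι : ℚ → CommutativeRing.Carrier R)
                  (hom : IsRingHomomorphism +-*-rawRing (CommutativeRing.rawRing R) ι)
                  (κ : ℕ → CommutativeRing.Carrier R) (e : CommutativeRing.Carrier R) where
  open CommutativeRing R renaming (refl to ≈-refl; sym to ≈-sym; trans to ≈-trans)
  open Semi commutativeSemiring
  open Gates commutativeSemiring
  open Rationals R ι hom
  open IsRingHomomorphism hom using (*-homo; +-homo; 0#-homo; 1#-homo)
  open Poly R ι using (powR)
  open import Relation.Binary.Reasoning.Setoid setoid
  open import Algebra.Solver.Ring.NaturalCoefficients.Default commutativeSemiring using (solve; _:=_; _:+_; _:*_; con)

  Σ-delta : ∀ {A : Set} (eq : A → Bool) {L : List A} {x} {h : A → Carrier} → Unique L → x ∈ L → T (eq x) → (∀ {y} → T (eq y) → y ≡ x) →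
            Σ[ L ] (λ y → gate (eq y) (h y)) ≈ h x
  Σ-delta eq {_ ∷ L} {h = h} (p ∷ un) (here refl) t only = ≈-trans (+-cong (gate-≡ (h _) (T⇒≡ t))
    (Σ-0∈ L (λ {y} y∈ → gate-≡ (h y) (¬T⇒≡ (λ t′ → All.lookup p y∈ (sym (only t′))))))) (+-identityʳ _)
  Σ-delta eq {z ∷ L} {h = h} (p ∷ un) (there x∈) t only = ≈-trans (+-cong (gate-≡ (h z) (¬T⇒≡ (λ t′ → All.lookup p x∈ (only t′))))
    (Σ-delta eq un x∈ t only)) (+-identityˡ _)

  Σ-⊗ : ∀ P Q {w : Term → Carrier} → Σ[ P ⊗ Q ] w ≈ Σ[ P ] (λ t → Σ[ Q ] (λ t′ → w (t · t′)))
  Σ-⊗ P Q = ≈-trans (Σ-concatMap (λ t → map (t ·_) Q) P) (Σ-cong P (λ t → Σ-map (t ·_) Q))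

  Σ-product : ∀ P Q {u v : Term → Carrier} → Σ[ P ] (λ t → Σ[ Q ] (λ t′ → u t * v t′)) ≈ Σ[ P ] u * Σ[ Q ] v
  Σ-product P Q = ≈-trans (Σ-cong P (λ t → Σ-*ˡ _ Q)) (Σ-*ʳ _ P)

  monomial : Term → Carrier
  monomial (q , k , c) = ι q * Πκ κ c

  monomial-· : ∀ t t′ → monomial (t · t′) ≈ monomial t * monomial t′
  monomial-· (q , _ , c) (q′ , _ , c′) = ≈-trans (*-cong (*-homo q q′) (Πκ-++ κ c c′))
    (solve 4 (λ a b c d → (a :* b) :* (c :* d) := (a :* c) :* (b :* d)) ≈-refl _ _ _ _)

  powR-+ : ∀ x m n → powR x (m ℕ.+ n) ≈ powR x m * powR x n
  powR-+ x zero    n = ≈-sym (*-identityˡ _)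
  powR-+ x (suc m) n = ≈-trans (*-congˡ (powR-+ x m n)) (≈-sym (*-assoc _ _ _))

  value coef₀ coef₁ : Term → Carrier
  value t = powR e (proj₁ (proj₂ t)) * monomial t
  coef₀ t = gate (proj₁ (proj₂ t) ≡ᵇ 0) (monomial t)
  coef₁ t = gate (proj₁ (proj₂ t) ≡ᵇ 1) (monomial t)

  value-· : ∀ t t′ → value (t · t′) ≈ value t * value t′
  value-· t@(_ , k , _) t′@(_ , k′ , _) = ≈-trans (*-cong (powR-+ e k k′) (monomial-· t t′))
    (solve 4 (λ a b c d → (a :* b) :* (c :* d) := (a :* c) :* (b :* d)) ≈-refl _ _ _ _)

  coef₀-· : ∀ t t′ → coef₀ (t · t′) ≈ coef₀ t * coef₀ t′
  coef₀-· t@(_ , zero  , _) t′@(_ , zero  , _) = monomial-· t t′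
  coef₀-· t@(_ , zero  , _) t′@(_ , suc _ , _) = ≈-sym (zeroʳ _)
  coef₀-· t@(_ , suc _ , _) t′                 = ≈-sym (zeroˡ _)

  coef₁-· : ∀ t t′ → coef₁ (t · t′) ≈ coef₁ t * coef₀ t′ + coef₀ t * coef₁ t′
  coef₁-· t@(_ , zero , _) t′@(_ , zero , _)             = ≈-sym (≈-trans (+-cong (zeroˡ _) (zeroʳ _)) (+-identityˡ _))
  coef₁-· t@(_ , zero , _) t′@(_ , suc zero , _)         = ≈-trans (monomial-· t t′) (≈-sym (≈-trans (+-congʳ (zeroˡ _)) (+-identityˡ _)))
  coef₁-· t@(_ , zero , _) t′@(_ , suc (suc _) , _)      = ≈-sym (≈-trans (+-cong (zeroˡ _) (zeroʳ _)) (+-identityˡ _))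
  coef₁-· t@(_ , suc zero , _) t′@(_ , zero , _)         = ≈-trans (monomial-· t t′) (≈-sym (≈-trans (+-congˡ (zeroˡ _)) (+-identityʳ _)))
  coef₁-· t@(_ , suc zero , _) t′@(_ , suc _ , _)        = ≈-sym (≈-trans (+-cong (zeroʳ _) (zeroˡ _)) (+-identityˡ _))
  coef₁-· t@(_ , suc (suc _) , _) t′                     = ≈-sym (≈-trans (+-cong (zeroˡ _) (zeroˡ _)) (+-identityˡ _))

  multiplicative : ∀ {w : Term → Carrier} → (∀ t t′ → w (t · t′) ≈ w t * w t′) → ∀ f g n →
    Σ[ convolve f g n ] w ≈ ((λ i → Σ[ f i ] w) ⊛ (λ i → Σ[ g i ] w)) n
  multiplicative {w} h f g n = go f n
    where
    prod : ∀ P Q → Σ[ P ⊗ Q ] w ≈ Σ[ P ] w * Σ[ Q ] w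
    prod P Q = ≈-trans (Σ-⊗ P Q) (≈-trans (Σ-cong P (λ t → Σ-cong Q (h t))) (Σ-product P Q))
    go : ∀ f n → Σ[ convolve f g n ] w ≈ ((λ i → Σ[ f i ] w) ⊛ (λ i → Σ[ g i ] w)) n
    go f zero    = prod (f 0) (g 0)
    go f (suc n) = ≈-trans (Σ-++ (f 0 ⊗ g (suc n)) _) (+-cong (prod (f 0) (g (suc n))) (go (f ∘ suc) n))

  -- The linear coefficient is a derivation over the constant one, which makes the recursion for `X`
  -- the linearisation of that for `U`.
  derivation : ∀ f g n → Σ[ convolve f g n ] coef₁ ≈ ((λ i → Σ[ f i ] coef₁) ⊛ (λ i → Σ[ g i ] coef₀)) n + ((λ i → Σ[ f i ] coef₀) ⊛ (λ i → Σ[ g i ] coef₁)) n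
  derivation f g n = go f n
    where
    prod : ∀ P Q → Σ[ P ⊗ Q ] coef₁ ≈ Σ[ P ] coef₁ * Σ[ Q ] coef₀ + Σ[ P ] coef₀ * Σ[ Q ] coef₁
    prod P Q = ≈-trans (Σ-⊗ P Q) (≈-trans (Σ-cong P (λ t → ≈-trans (Σ-cong Q (coef₁-· t)) (Σ-+ Q))) (≈-trans (Σ-+ P) (+-cong (Σ-product P Q) (Σ-product P Q))))
    go : ∀ f n → Σ[ convolve f g n ] coef₁ ≈ ((λ i → Σ[ f i ] coef₁) ⊛ (λ i → Σ[ g i ] coef₀)) n + ((λ i → Σ[ f i ] coef₀) ⊛ (λ i → Σ[ g i ] coef₁)) n
    go f zero    = prod (f 0) (g 0)
    go f (suc n) = ≈-trans (Σ-++ (f 0 ⊗ g (suc n)) _) (≈-trans (+-cong (prod (f 0) (g (suc n))) (go (f ∘ suc) n))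
      (solve 4 (λ a b c d → (a :+ b) :+ (c :+ d) := (a :+ c) :+ (b :+ d)) ≈-refl _ _ _ _))

  ν : ℕ → Carrier
  ν n = ι-int (ℤ.- (ℤ.+ n))

  ν-nat : ∀ n → nat n + ν n ≈ 0#
  ν-nat n = ≈-trans (+-congʳ (≈-sym (ι-int-nat n))) (ι-int-neg (ℤ.+ n))

  ν-zero : ν 0 ≈ 0#
  ν-zero = 0#-homo

  lower-monomial : ∀ n t → monomial (lower n t) ≈ ν n * monomial t
  lower-monomial n (q , k , c) = ≈-trans (*-congʳ (*-homo _ q)) (*-assoc _ _ _)

  correction-Σ : ∀ n P {w u : Term → Carrier} x → (∀ t → w (lower n t) ≈ (ν n * x) * u t) → Σ[ correction n P ] w ≈ (ν n * x) * Σ[ P ] u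
  correction-Σ zero    P x h = ≈-sym (≈-trans (*-congʳ (≈-trans (*-congʳ ν-zero) (zeroˡ x))) (zeroˡ _))
  correction-Σ (suc n) P x h = ≈-trans (Σ-map (lower (suc n)) P) (≈-trans (Σ-cong P h) (Σ-*ˡ _ P))

  F U X : ℕ → Seq
  F j n = Σ[ Φ j n ] value
  U j n = Σ[ Φ j n ] coef₀
  X j n = Σ[ Φ j n ] coef₁

  Σ-step : ∀ j n {w : Term → Carrier} → Σ[ Φ j (suc n) ] w ≈ Σ[ convolve (Φ 0) (Φ (suc j)) n ] w + Σ[ correction n (Φ (suc j) n) ] w
  Σ-step j n {w} = ≈-trans (reflexive (cong (λ P → Σ[ P ] w) (Φ-step j (suc n)))) (Σ-++ (convolve (Φ 0) (Φ (suc j)) n) _)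

  one : ι ℚ.1ℚ ≈ 1#
  one = 1#-homo

  U-zero : U 0 0 ≈ 1#
  U-zero = ≈-trans (+-identityʳ _) (≈-trans (*-identityʳ _) one)

  U-κ : ∀ j → U (suc j) 0 ≈ κ (suc j)
  U-κ j = ≈-trans (+-identityʳ _) (≈-trans (*-cong one (*-identityʳ _)) (*-identityˡ _))

  U-step : ∀ j n → U j (suc n) ≈ (U 0 ⊛ U (suc j)) n
  U-step j n = ≈-trans (Σ-step j n) (≈-trans (+-cong (multiplicative coef₀-· (Φ 0) (Φ (suc j)) n) (vanish n)) (+-identityʳ _))
    where vanish : ∀ n {P} → Σ[ correction n P ] coef₀ ≈ 0#
          vanish zero    = ≈-refl
          vanish (suc n) {P} = ≈-trans (Σ-map (lower (suc n)) P) (Σ-0 P (λ _ → ≈-refl))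

  X-zero : ∀ j → X j 0 ≈ 0#
  X-zero zero    = +-identityˡ _
  X-zero (suc j) = +-identityˡ _

  X-step : ∀ j n → X j (suc n) ≈ ((X 0 ⊛ U (suc j)) n + (U 0 ⊛ X (suc j)) n) + ν n * U (suc j) n
  X-step j n = ≈-trans (Σ-step j n) (+-cong (derivation (Φ 0) (Φ (suc j)) n)
    (≈-trans (correction-Σ n (Φ (suc j) n) 1# h) (*-congʳ (*-identityʳ _))))
    where h : ∀ t → coef₁ (lower n t) ≈ (ν n * 1#) * coef₀ t
          h t@(q , zero  , c) = ≈-trans (lower-monomial n t) (*-congʳ (≈-sym (*-identityʳ _)))
          h t@(q , suc k , c) = ≈-sym (zeroʳ _)

  F-zero : ∀ j → F (suc j) 0 ≈ κ (suc j)
  F-zero j = ≈-trans (+-identityʳ _) (≈-trans (*-identityˡ _) (≈-trans (*-cong one (*-identityʳ _)) (*-identityˡ _)))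

  F-one : F 0 0 ≈ 1#
  F-one = ≈-trans (+-identityʳ _) (≈-trans (*-identityˡ _) (≈-trans (*-identityʳ _) one))

  F-step : ∀ j n → F j (suc n) ≈ (F 0 ⊛ F (suc j)) n + (ν n * e) * F (suc j) n
  F-step j n = ≈-trans (Σ-step j n) (+-cong (multiplicative value-· (Φ 0) (Φ (suc j)) n) (correction-Σ n (Φ (suc j) n) e h))
    where h : ∀ t → value (lower n t) ≈ (ν n * e) * value t
          h t@(q , k , c) = ≈-trans (*-congˡ (lower-monomial n t)) (solve 4 (λ a b c d → (a :* b) :* (c :* d) := (c :* a) :* (b :* d)) ≈-refl e (powR e k) (ν n) (monomial t))

  coef : ℕ → Expr → Carrier
  coef k P = Σ[ P ] (λ t → gate (proj₁ (proj₂ t) ≡ᵇ k) (monomial t))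

  value-coef : ∀ K P → All (λ t → proj₁ (proj₂ t) < K) P → Σ[ P ] value ≈ Σ[ upTo K ] (λ k → powR e k * coef k P)
  value-coef K P b = ≈-sym (begin
    Σ[ upTo K ] (λ k → powR e k * coef k P)
      ≈⟨ Σ-cong (upTo K) (λ k → ≈-sym (Σ-*ˡ (powR e k) P)) ⟩
    Σ[ upTo K ] (λ k → Σ[ P ] (λ t → powR e k * gate (proj₁ (proj₂ t) ≡ᵇ k) (monomial t)))
      ≈⟨ Σ-swap (upTo K) P ⟩
    Σ[ P ] (λ t → Σ[ upTo K ] (λ k → powR e k * gate (proj₁ (proj₂ t) ≡ᵇ k) (monomial t)))
      ≈⟨ Σ-congAll (All.map (λ {t} k< → ≈-trans (Σ-cong (upTo K) (λ k → ≈-sym (gate-* (proj₁ (proj₂ t) ≡ᵇ k) (powR e k) (monomial t))))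
           (Σ-delta (proj₁ (proj₂ t) ≡ᵇ_) (Unique.upTo⁺ K) (∈-upTo⁺ k<) (ℕ.≡⇒≡ᵇ (proj₁ (proj₂ t)) _ refl) (λ {y} q → sym (ℕ.≡ᵇ⇒≡ (proj₁ (proj₂ t)) y q)))) b) ⟩
    Σ[ P ] value ∎)

  ι-sum : ∀ {A : Set} (xs : List A) (g : A → ℚ) → ι (foldr ℚ._+_ ℚ.0ℚ (map g xs)) ≈ Σ[ xs ] (λ x → ι (g x))
  ι-sum []       g = 0#-homo
  ι-sum (x ∷ xs) g = ≈-trans (+-homo _ _) (+-congˡ (ι-sum xs g))

  -- Every term of `Φ 0 n` has weight n, so its interval partition occurs exactly once among the
  -- partitions of n.
  coef-partitions : ∀ n k → Σ[ SetPartitions n ] (λ σ → ι (errorCoefficient n k σ) * Πκ κ (blockSizes σ)) ≈ coef k (Φ 0 n)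
  coef-partitions n k = begin
    Σ[ SetPartitions n ] (λ σ → ι (errorCoefficient n k σ) * Πκ κ (blockSizes σ))
      ≈⟨ Σ-cong (SetPartitions n) (λ σ → ≈-trans (*-congʳ (ι-sum (Φ 0 n) _)) (≈-sym (Σ-*ʳ (Πκ κ (blockSizes σ)) (Φ 0 n)))) ⟩
    Σ[ SetPartitions n ] (λ σ → Σ[ Φ 0 n ] (λ (q , k′ , c) → ι (if (k′ ≡ᵇ k) ∧ isIntervals c σ then q else ℚ.0ℚ) * Πκ κ (blockSizes σ)))
      ≈⟨ Σ-swap (SetPartitions n) (Φ 0 n) ⟩
    Σ[ Φ 0 n ] (λ (q , k′ , c) → Σ[ SetPartitions n ] (λ σ → ι (if (k′ ≡ᵇ k) ∧ isIntervals c σ then q else ℚ.0ℚ) * Πκ κ (blockSizes σ)))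
      ≈⟨ Σ-congAll (All.map (λ {t} → each t) (approx-bounded (suc n) 0 n)) ⟩
    coef k (Φ 0 n) ∎
    where
    each : ∀ t → Bounded n (ℕ.pred n) t → (let (q , k′ , c) = t in
      Σ[ SetPartitions n ] (λ σ → ι (if (k′ ≡ᵇ k) ∧ isIntervals c σ then q else ℚ.0ℚ) * Πκ κ (blockSizes σ)) ≈ gate (k′ ≡ᵇ k) (ι q * Πκ κ c))
    each (q , k′ , c) (bounded _ w pos) with k′ ≡ᵇ k
    ... | false = Σ-0 (SetPartitions n) (λ σ → ≈-trans (*-congʳ 0#-homo) (zeroˡ _))
    ... | true  = begin
      Σ[ SetPartitions n ] (λ σ → ι (if isIntervals c σ then q else ℚ.0ℚ) * Πκ κ (blockSizes σ))
        ≈⟨ Σ-cong (SetPartitions n) (λ σ → pull (isIntervals c σ) (Πκ κ (blockSizes σ))) ⟩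
      Σ[ SetPartitions n ] (λ σ → gate (isIntervals c σ) (ι q * Πκ κ (blockSizes σ)))
        ≈⟨ Σ-delta (isIntervals c) (rgsFrom-unique n 0) π∈ (fromWitness refl) (λ t → toWitness t) ⟩
      ι q * Πκ κ (blockSizes π)
        ≈⟨ *-congˡ (reflexive (cong (Πκ κ) (trans (blockSizes-final (proj₁ (rgsFrom-sound n 0 π∈))) (final-intervals [] pos)))) ⟩
      ι q * Πκ κ c ∎
      where
      π = intervals 0 c
      π∈ : π ∈ SetPartitions n
      π∈ = subst (λ m → π ∈ rgsFrom m 0) w (intervals-∈ 0 pos)
      pull : ∀ b x → ι (if b then q else ℚ.0ℚ) * x ≈ gate b (ι q * x)
      pull true  x = ≈-refl
      pull false x = ≈-trans (*-congʳ 0#-homo) (zeroˡ x)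

-- The expansion of the moment.

module Assembly (R : CommutativeRing 0ℓ 0ℓ) (ι : ℚ → CommutativeRing.Carrier R)
                (hom : IsRingHomomorphism +-*-rawRing (CommutativeRing.rawRing R) ι)
                {d : ℕ} (1≤d : 1 ≤ d) (λs : Vec (CommutativeRing.Carrier R) d) where
  open CommutativeRing R renaming (refl to ≈-refl; sym to ≈-sym; trans to ≈-trans)
  open Poly R ι
  open Semi commutativeSemiring
  open Gates commutativeSemiring
  open Rationals R ι hom
  open import Algebra.Properties.Ring ring using (-‿distribˡ-*)
  open import Relation.Binary.Reasoning.Setoid setoid
  open import Algebra.Solver.Ring.NaturalCoefficients.Default commutativeSemiring using (solve; _:=_; _:+_; _:*_; con)

  e : Carrier
  e = recip d

  κ : ℕ → Carrier
  κ = cumulant λs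

  open Evaluation R ι hom κ e
  open AnnularSum commutativeSemiring κ
  open Families commutativeSemiring κ

  private
    module A s = AnnularFamily U U-zero U-κ U-step s
    Ybar : Seq
    Ybar = Ȳ U U-zero U-κ U-step recip recip-nat ν ν-nat X X-zero X-step

  ν-e : ∀ n → ν n * e ≈ - e * nat n
  ν-e n = ≈-trans (*-congʳ (neg-unique (ν-nat n))) (≈-trans (≈-sym (-‿distribˡ-* _ _)) (≈-trans (-‿cong (*-comm _ _)) (-‿distribˡ-* _ _)))

  moment-Φ : ∀ n → n ≤ d → moment λs n ≈ F 0 n
  moment-Φ n n≤d = Finite.moment-recursion R ι hom 1≤d λs F (λ { zero → F-one ; (suc j) → F-zero j })
    (λ j m → ≈-trans (F-step j m) (+-congˡ (*-congʳ (ν-e m)))) n n≤d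

  module _ {n r : ℕ} (r∈ : r ∈ range 1 n) where
    private
      1≤r : 1 ≤ r
      1≤r = proj₁ (∈-range⁻ {1} {n} r∈)
      r<n : r < n
      r<n = proj₂ (∈-range⁻ {1} {n} r∈)
      s : ℕ
      s = n ℕ.∸ r
      1≤s : 1 ≤ s
      1≤s = ℕ.m<n⇒0<n∸m r<n

    -- n/(rs) = 1/r + 1/s, and the two terms call for peeling different circles.
    weighted-SNC : nat n * (recip (r ℕ.* s) * ΣSNC r s) ≈ recip r * A.Y r s + recip s * A.Y s r
    weighted-SNC = begin
      nat n * (recip (r ℕ.* s) * ΣSNC r s)
        ≈⟨ *-cong (≈-trans (reflexive (cong nat (sym (ℕ.m+[n∸m]≡n (ℕ.<⇒≤ r<n))))) (nat-+ r s)) (*-congʳ (recip-* r s)) ⟩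
      (nat r + nat s) * ((recip r * recip s) * ΣSNC r s)
        ≈⟨ solve 5 (λ a b x y v → (a :+ b) :* ((x :* y) :* v) := (y :* b) :* (x :* v) :+ (x :* a) :* (y :* v)) ≈-refl _ _ _ _ _ ⟩
      (recip s * nat s) * (recip r * ΣSNC r s) + (recip r * nat r) * (recip s * ΣSNC r s)
        ≈⟨ +-cong (≈-trans (*-congʳ (recip-unit 1≤s)) (*-identityˡ _)) (≈-trans (*-congʳ (recip-unit 1≤r)) (*-identityˡ _)) ⟩
      recip r * ΣSNC r s + recip s * ΣSNC r s
        ≈⟨ +-cong (*-congˡ (ΣSNC-inner pl r s 1≤r 1≤s (A.annular r))) (*-congˡ (ΣSNC-outer pl r s 1≤r 1≤s (A.annular s))) ⟩
      recip r * A.Y r s + recip s * A.Y s r ∎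
      where pl = planar U U-zero U-κ U-step

  Σ-Ybar : ∀ n → Σ[ range 1 n ] (λ r → recip r * A.Y r (n ℕ.∸ r)) ≈ Ybar n
  Σ-Ybar zero    = ≈-refl
  Σ-Ybar (suc N) = begin
    Σ[ map suc (upTo N) ] (λ r → recip r * A.Y r (suc N ℕ.∸ r))
      ≈⟨ Σ-map suc (upTo N) ⟩
    Σ[ upTo N ] (λ s → recip (suc s) * A.Y (suc s) (N ℕ.∸ s))
      -- The range stops at r < n, while the diagonal sum includes r = n; that term vanishes because
      -- nothing can be joined from an empty circle.
      ≈⟨ ≈-trans (+-congˡ (≈-trans (*-congˡ (reflexive (cong (A.Y (suc N)) (ℕ.n∸n≡0 N)))) (zeroʳ _))) (+-identityʳ _) ⟨
    Σ[ upTo N ] (λ s → recip (suc s) * A.Y (suc s) (N ℕ.∸ s)) + recip (suc N) * A.Y (suc N) (N ℕ.∸ N)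
      ≈⟨ Σ-upTo-last N ⟨
    Σ[ upTo (suc N) ] (λ s → recip (suc s) * A.Y (suc s) (N ℕ.∸ s))
      ≈⟨ diag-Σ (λ s i → recip (suc s) * A.Y (suc s) i) N ⟨
    Ybar (suc N) ∎

  range-reversal : ∀ n → map (n ℕ.∸_) (range 1 n) ↭ range 1 n
  range-reversal n = unique-set-↭ (AP.map⁺ (distinct (range 1 n) (unique-range n) id)) (unique-range n) to from
    where
    unique-range : ∀ n → Unique (range 1 n)
    unique-range n = Unique.map⁺ ℕ.suc-injective (Unique.upTo⁺ _)
    distinct : ∀ xs → Unique xs → (∀ {x} → x ∈ xs → x ∈ range 1 n) → AllPairs (λ x y → n ℕ.∸ x ≢ n ℕ.∸ y) xs
    distinct [] un sub = []
    distinct (x ∷ xs) (p ∷ un) sub = All.tabulate (λ {y} y∈ e → All.lookup p y∈ (ℕ.∸-cancelˡ-≡ (≤n (sub (here refl))) (≤n (sub (there y∈))) e)) ∷ distinct xs un (sub ∘ there)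
      where ≤n : ∀ {x} → x ∈ range 1 n → x ≤ n
            ≤n x∈ = ℕ.<⇒≤ (proj₂ (∈-range⁻ {1} {n} x∈))
    flip : ∀ {x} → x ∈ range 1 n → n ℕ.∸ x ∈ range 1 n
    flip {x} x∈ with ∈-range⁻ {1} {n} x∈
    ... | p , q = ∈-range⁺ {1} (ℕ.m<n⇒0<n∸m q) (ℕ.∸-monoʳ-< {n} {x} {0} p (ℕ.<⇒≤ q))
    to : ∀ {x} → x ∈ map (n ℕ.∸_) (range 1 n) → x ∈ range 1 n
    to x∈ with ∈-map⁻ (n ℕ.∸_) x∈
    ... | y , y∈ , refl = flip y∈
    from : ∀ {x} → x ∈ range 1 n → x ∈ map (n ℕ.∸_) (range 1 n)
    from {x} x∈ = subst (_∈ map (n ℕ.∸_) (range 1 n)) (ℕ.m∸[m∸n]≡n (ℕ.<⇒≤ (proj₂ (∈-range⁻ {1} {n} x∈)))) (∈-map⁺ (n ℕ.∸_) (flip x∈))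

  -- Reversing r to n - r identifies the two sums coming from 1/r and 1/s; the resulting factor 2 is
  -- the one in n/(2d).
  Σ-weighted : ∀ n → nat n * Σ[ range 1 n ] (λ r → recip (r ℕ.* (n ℕ.∸ r)) * ΣSNC r (n ℕ.∸ r)) ≈ Ybar n + Ybar n
  Σ-weighted n = begin
    nat n * Σ[ range 1 n ] (λ r → recip (r ℕ.* (n ℕ.∸ r)) * ΣSNC r (n ℕ.∸ r))
      ≈⟨ Σ-*ˡ (nat n) (range 1 n) ⟨
    Σ[ range 1 n ] (λ r → nat n * (recip (r ℕ.* (n ℕ.∸ r)) * ΣSNC r (n ℕ.∸ r)))
      ≈⟨ Σ-cong∈ (range 1 n) weighted-SNC ⟩
    Σ[ range 1 n ] (λ r → h r + recip (n ℕ.∸ r) * A.Y (n ℕ.∸ r) r)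
      ≈⟨ Σ-+ (range 1 n) ⟩
    Σ[ range 1 n ] h + Σ[ range 1 n ] (λ r → recip (n ℕ.∸ r) * A.Y (n ℕ.∸ r) r)
      ≈⟨ +-congˡ (Σ-cong∈ (range 1 n) (λ {r} r∈ → *-congˡ (reflexive (cong (A.Y (n ℕ.∸ r)) (sym (ℕ.m∸[m∸n]≡n (ℕ.<⇒≤ (proj₂ (∈-range⁻ {1} {n} r∈))))))))) ⟩
    Σ[ range 1 n ] h + Σ[ range 1 n ] (λ r → h (n ℕ.∸ r))
      ≈⟨ +-congˡ (≈-trans (≈-sym (Σ-map (n ℕ.∸_) (range 1 n))) (Σ-↭ (range-reversal n))) ⟩
    Σ[ range 1 n ] h + Σ[ range 1 n ] h
      ≈⟨ +-cong (Σ-Ybar n) (Σ-Ybar n) ⟩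
    Ybar n + Ybar n ∎
    where h : ℕ → Carrier
          h r = recip r * A.Y r (n ℕ.∸ r)

  mainTerm-X : ∀ n → mainTerm λs n ≈ e * X 0 n
  mainTerm-X n = ≈-trans (neg-unique (≈-trans (+-comm _ _) main+Ybar)) (≈-sym (neg-unique Ybar+X))
    where
    S : Carrier
    S = Σ[ range 1 n ] (λ r → recip (r ℕ.* (n ℕ.∸ r)) * ΣSNC r (n ℕ.∸ r))
    Ybar+X : e * Ybar n + e * X 0 n ≈ 0#
    Ybar+X = ≈-trans (≈-sym (distribˡ _ _ _)) (≈-trans (*-congˡ (Ȳ+X≈0 U U-zero U-κ U-step recip recip-nat ν ν-nat X X-zero X-step n)) (zeroʳ e))
    main+Ybar : mainTerm λs n + e * Ybar n ≈ 0#
    main+Ybar = begin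
      mainTerm λs n + e * Ybar n
        ≈⟨ +-cong (*-cong (≈-trans (ι-divN (ℤ.- (ℤ.+ n)) (2 ℕ.* d)) (*-congˡ (recip-* 2 d))) (Σ-cong (range 1 n) (λ r → Σ-*ˡ _ (SNC r (n ℕ.∸ r))))) half ⟩
      (ν n * (recip 2 * e)) * S + (recip 2 * e) * (nat n * S)
        ≈⟨ solve 4 (λ v r n s → (v :* r) :* s :+ r :* (n :* s) := (n :+ v) :* (r :* s)) ≈-refl _ _ _ _ ⟩
      (nat n + ν n) * ((recip 2 * e) * S)
        ≈⟨ ≈-trans (*-congʳ (ν-nat n)) (zeroˡ _) ⟩
      0# ∎
      where
      half : e * Ybar n ≈ (recip 2 * e) * (nat n * S)
      half = ≈-sym (begin
        (recip 2 * e) * (nat n * S)            ≈⟨ *-congˡ (Σ-weighted n) ⟩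
        (recip 2 * e) * (Ybar n + Ybar n)      ≈⟨ solve 3 (λ r e y → (r :* e) :* (y :+ y) := (r :* (con 1 :+ (con 1 :+ con 0))) :* (e :* y)) ≈-refl (recip 2) e (Ybar n) ⟩
        (recip 2 * nat 2) * (e * Ybar n)       ≈⟨ ≈-trans (*-congʳ (recip-nat 1)) (*-identityˡ _) ⟩
        e * Ybar n                             ∎)

  recip-power : ∀ k → recip (d ℕ.^ k) ≈ powR e k
  recip-power zero    = recip-1
  recip-power (suc k) = ≈-trans (recip-* d (d ℕ.^ k)) (*-congˡ (recip-power k))

  errorTerm-coef : ∀ n → errorTerm λs n (errorCoefficient n) ≈ Σ[ range 2 n ] (λ k → powR e k * coef k (Φ 0 n))
  errorTerm-coef n = Σ-cong (range 2 n) (λ k → *-cong (recip-power k) (coef-partitions n k))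

  LHS-coef : ∀ n → n ≤ d → 1 ≤ n → moment λs n ≈ U 0 n + (mainTerm λs n + errorTerm λs n (errorCoefficient n))
  LHS-coef n n≤d 1≤n = ≈-trans (moment-Φ n n≤d) (≈-trans (value-coef n (Φ 0 n) degrees) (≈-trans (split n 1≤n)
    (+-congˡ (+-congˡ (≈-sym (errorTerm-coef n))))))
    where
    degrees : All (λ t → proj₁ (proj₂ t) < n) (Φ 0 n)
    degrees = All.map (λ b → ℕ.≤-<-trans (Bounded.degree b) (pred-< 1≤n)) (approx-bounded (suc n) 0 n)
      where pred-< : ∀ {n} → 1 ≤ n → ℕ.pred n < n
            pred-< (s≤s _) = ℕ.≤-refl
    split : ∀ n → 1 ≤ n → Σ[ upTo n ] (λ k → powR e k * coef k (Φ 0 n)) ≈ U 0 n + (mainTerm λs n + Σ[ range 2 n ] (λ k → powR e k * coef k (Φ 0 n)))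
    -- For n = 1 there is no coefficient of degree 1, in agreement with the absence of pairs r, s.
    split (suc zero)    _ = +-cong (*-identityˡ _) (≈-sym (≈-trans (+-identityʳ _) (zeroʳ _)))
    split (suc (suc N)) _ = +-cong (*-identityˡ _) (+-cong (≈-trans (*-congʳ (*-identityʳ e)) (≈-sym (mainTerm-X (suc (suc N)))))
      (reflexive (cong (λ ks → Σ[ ks ] (λ k → powR e k * coef k (Φ 0 (suc (suc N))))) (sym (map-applyUpTo id (λ i → suc (suc i)) N)))))

  expansion : ∀ n → 1 ≤ n → n ≤ d → LHS λs n ≈ mainTerm λs n + errorTerm λs n (errorCoefficient n)
  expansion n 1≤n n≤d = ≈-trans (+-cong (LHS-coef n n≤d 1≤n) (-‿cong (ΣNC U U-zero U-κ U-step n)))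
    (≈-trans (+-congʳ (+-comm _ _)) (≈-trans (+-assoc _ _ _) (≈-trans (+-congˡ (-‿inverseʳ _)) (+-identityʳ _))))

theorem1p3 : (n : ℕ) → 1 ≤ n →
    Σ[ c ∈ (ℕ → List ℕ → ℚ) ]
    ((R : CommutativeRing _ _) (ι : ℚ → CommutativeRing.Carrier R) →
    IsRingHomomorphism +-*-rawRing (CommutativeRing.rawRing R) ι →
    (d : ℕ) → n ≤ d → (λs : Vec (CommutativeRing.Carrier R) d) →
    CommutativeRing._≈_ R (Poly.LHS R ι λs n)
    (CommutativeRing._+_ R (Poly.mainTerm R ι λs n) (Poly.errorTerm R ι λs n c)))
theorem1p3 n 1≤n = errorCoefficient n , λ R ι hom d n≤d λs → Assembly.expansion R ι hom (ℕ.≤-trans 1≤n n≤d) λs n 1≤n n≤d
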